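{- Let $\epsilon>0$ be any constant and let $k\leq(1-\epsilon)\log_2 n$. Then there exists a function $F:(\{0,1\}^n)^{k+1}\to\{ -1,+1\}$ such that, in the $(k+1)$-party number-on-forehead model, \[N(F)=O(\log n)\qquad\text{and}\qquad \mathit{MA}(-F)=n^{\Omega(1)}.\] In particular, $\mathsf{coNP}_k^{cc}\not\subseteq\mathsf{MA}_k^{cc}$ and $\mathsf{NP}_k^{cc}\neq\mathsf{coNP}_k^{cc}$.
   Context: Boolean functions take values in $\{ -1,+1\}$, with $-1$ meaning "true". In the number-on-forehead model with players $1,\dots,k$ the input $(x_1,\dots,x_k)$ is distributed so that player $i$ sees every $x_j$ with $j\neq i$; players write bits on a shared blackboard. For $G$, $N(G)$ is the least cost $c_1+c_2$ of a nondeterministic protocol ($c_1$ nondeterministic bits, then $c_2$ deterministic bits), correct for at least one nondeterministic choice when $G=-1$ and for all choices when $G=+1$. $\mathit{MA}(G)$ is the least cost $c_1+c_2$ of a Merlin-Arthur protocol: $c_1$ nondeterministic bits followed by $c_2$ bits of public-coin randomized communication, with error probability at most $1/3$ for at least one nondeterministic choice when $G=-1$ and for all choices when $G=+1$. $\mathsf{NP}_k^{cc},\mathsf{coNP}_k^{cc},\mathsf{MA}_k^{cc}$ are the classes of functions $G:(\{0,1\}^n)^k\to\{ -1,+1\}$ with $N(G)$, $N(-G)$, $\mathit{MA}(G)$ respectively at most $\log^{O(1)}n$. -}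

module Defs where

open import Data.Nat using (ℕ; zero; suc; _+_; _*_; _^_; _≤_)
open import Data.Nat.Logarithm using (⌊log₂_⌋)
open import Data.Bool using (Bool; true; false; if_then_else_)
open import Data.Fin using (Fin)
open import Data.Vec using (Vec; []; _∷_)
open import Data.Product using (Σ; ∃; _×_; _,_)
open import Relation.Binary.PropositionalEquality using (_≡_; _≢_)

-- Boolean values in {-1,+1}; neg = -1 = "true", pos = +1.
data Sign : Set where
  neg pos : Sign

negate : Sign → Sign
negate neg = pos
negate pos = neg

sameSign : Sign → Sign → Bool
sameSign neg neg = true
sameSign pos pos = true
sameSign _   _   = false

Input : ℕ → ℕ → Set
Input p n = Fin p → Vec Bool n

SeenBy : {p n : ℕ} → Fin p → (Input p n → Bool) → Set
SeenBy {p} i f = ∀ x y → (∀ j → j ≢ i → x j ≡ y j) → f x ≡ f y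

-- Deterministic NOF protocol trees of cost (depth) at most d.
-- An internal node: player i writes the bit f(x) on the blackboard (f not depending
-- on x_i); the subsequent protocol depends on the blackboard history (tree position).
data Prot (p n : ℕ) : ℕ → Set where
  leaf : {d : ℕ} → Sign → Prot p n d
  node : {d : ℕ} (i : Fin p) (f : Input p n → Bool) → SeenBy i f →
         (onTrue onFalse : Prot p n d) → Prot p n (suc d)

run : {p n d : ℕ} → Prot p n d → Input p n → Sign
run (leaf s) x = s
run (node i f _ t e) x = if f x then run t x else run e x

-- Nondeterministic protocol: c1 guessed bits (written on the board), then a
-- deterministic protocol of cost c2 depending on the guess.
NProt : (p n c1 c2 : ℕ) → Set
NProt p n c1 c2 = Vec Bool c1 → Prot p n c2

NComputes : {p n c1 c2 : ℕ} → NProt p n c1 c2 → (Input p n → Sign) → Set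
NComputes {c1 = c1} P G =
  ∀ x → (G x ≡ neg → Σ (Vec Bool c1) λ w → run (P w) x ≡ neg)
      × (G x ≡ pos → ∀ w → run (P w) x ≡ pos)

NCostAtMost : {p n : ℕ} → (Input p n → Sign) → ℕ → Set
NCostAtMost {p} {n} G c =
  Σ ℕ λ c1 → Σ ℕ λ c2 → (c1 + c2 ≤ c) × Σ (NProt p n c1 c2) λ P → NComputes P G

count : (r : ℕ) → (Vec Bool r → Bool) → ℕ
count zero f = if f [] then 1 else 0
count (suc r) f = count r (λ v → f (true ∷ v)) + count r (λ v → f (false ∷ v))

-- Public-coin randomized protocol of cost c2: r uniformly random bits
-- select a deterministic protocol of cost c2.
RProt : (p n c2 : ℕ) → Set
RProt p n c2 = Σ ℕ λ r → (Vec Bool r → Prot p n c2)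

ErrAtMostThird : {p n c2 : ℕ} → RProt p n c2 → Input p n → Sign → Set
ErrAtMostThird (r , R) x s =
  3 * count r (λ ρ → if sameSign (run (R ρ) x) s then false else true) ≤ 2 ^ r

-- Merlin–Arthur protocol: c1 nondeterministic bits, then a public-coin
-- randomized protocol of cost c2 depending on them.
MAProt : (p n c1 c2 : ℕ) → Set
MAProt p n c1 c2 = Vec Bool c1 → RProt p n c2

MAComputes : {p n c1 c2 : ℕ} → MAProt p n c1 c2 → (Input p n → Sign) → Set
MAComputes {c1 = c1} P G =
  ∀ x → (G x ≡ neg → Σ (Vec Bool c1) λ w → ErrAtMostThird (P w) x (G x))
      × (G x ≡ pos → ∀ w → ErrAtMostThird (P w) x (G x))

-- Player 0 holds m arrays x_i of 2^p bits and every other player j holds m blocks y_{j,i};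
-- F asks whether some b_i = x_i[φ(y_{1,i}, …, y_{k,i})] is 1. Guessing i and the position makes
-- F cheap. The selector φ is a random function, whose existence follows by averaging: on a random
-- cube the 2^k selected positions rarely cancel in pairs, so the cube norm of one block is at
-- most β^(2^k). Cube norms multiply over blocks, so by iterated Cauchy–Schwarz every
-- cylinder intersection has correlation at most β^|S| with the parity of the b_i, i ∈ S.
--
-- Suppose a Merlin–Arthur protocol for -F accepts with probability q_w on message w, and let h be
-- the average of (3 q_w)^ℓ over w: at least 2^ℓ / 2^c₁ where all b_i vanish and at most 1 elsewhere.
-- Test h against an alternating binomial combination of the Riesz products ∏ (1 + c_j (-1)^(b_i)).
-- With the nodes c_j = 1 - 2 (j - d)² / d² the parities of fewer than d blocks cancel, and
-- those of d or more blocks contribute little because h is a combination of few cylinder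
-- intersections. The product with c_d = 1 is supported where all b_i vanish and retains
-- a fraction 1 / 2d of the weight, and there h is large: a contradiction unless the cost is large.
module Submission where

-- The logarithmic protocol for F makes F correlate noticeably with a cylinder intersection under
-- every input distribution, so a two-sided discrepancy bound for F is out of reach and the argument
-- must be one-sided. Accordingly the sign of the dual witness `Ψ` is uncontrolled where some b_i =
-- 1: there only `h ≤ 1` and the total mass 2^(2d) of the Riesz products are available. The
-- amplified value 2^(ℓ - c₁) of `h` on the other side has to outweigh this mass despite the loss 1
-- / 2d, hence ℓ = c₁ + log d + O(1). In return `h` counts as at most 2^((c₂ + 2) ℓ) cylinder
-- intersections, against a gain 2^(-d) from the parities of d or more blocks; the contradiction
-- arises once (c₂ + 2) ℓ ≤ d. The other parameters are polynomial in d: m = d³ blocks make the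
-- nodes other than 1 negligible where all b_i vanish, and β = 1 / 4m keeps the sum over all
-- parities bounded. Only the array length needs a factor 2^k, so that 2^k random positions seldom
-- coincide. Thus n = 2^k · poly(d), and the bound on k leaves n^Ω(1) for d.

-- Rational arithmetic: powers, the embedding of ℕ, iterated squaring.

module RationalFacts where

  open import Data.Nat as ℕ using (ℕ; zero; suc)
  import Data.Nat.Properties as ℕ
  open import Data.Rational
  open import Data.Rational.Properties
  open import Data.Maybe using (Maybe; just; nothing)
  open import Data.Sum using (inj₁; inj₂)
  open import Function using (_∘_)
  open import Relation.Binary.PropositionalEquality
  open import Relation.Nullary using (Dec; yes; no)
  open import Relation.Nullary.Negation using (contradiction)
  import Tactic.RingSolver.Core.AlmostCommutativeRing as ACR
  import Tactic.RingSolver as Solver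

  ℚ-ring : ACR.AlmostCommutativeRing _ _
  ℚ-ring = ACR.fromCommutativeRing +-*-commutativeRing (zero? ∘ (0ℚ ≟_))
    where
    zero? : ∀ {x} → Dec (0ℚ ≡ x) → Maybe (0ℚ ≡ x)
    zero? (yes 0≡x) = just 0≡x
    zero? (no _)    = nothing

  2ℚ : ℚ
  2ℚ = 1ℚ + 1ℚ

  3ℚ : ℚ
  3ℚ = 1ℚ + 2ℚ

  0≤1 : 0ℚ ≤ 1ℚ
  0≤1 = nonNegative⁻¹ 1ℚ

  0≤½ : 0ℚ ≤ ½
  0≤½ = nonNegative⁻¹ ½

  0≤2 : 0ℚ ≤ 2ℚ
  0≤2 = nonNegative⁻¹ 2ℚ

  0≤3 : 0ℚ ≤ 3ℚ
  0≤3 = nonNegative⁻¹ 3ℚ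

  ½≤1 : ½ ≤ 1ℚ
  ½≤1 = ≤ᵇ⇒≤ _

  ≡-≤-trans : ∀ {p q r : ℚ} → p ≡ q → q ≤ r → p ≤ r
  ≡-≤-trans refl q≤r = q≤r

  ≤-≡-trans : ∀ {p q r : ℚ} → p ≤ q → q ≡ r → p ≤ r
  ≤-≡-trans p≤q refl = p≤q

  *-monoˡ-≤ : ∀ {p q r} → 0ℚ ≤ r → p ≤ q → r * p ≤ r * q
  *-monoˡ-≤ {r = r} 0≤r = *-monoˡ-≤-nonNeg r {{nonNegative 0≤r}}

  *-monoʳ-≤ : ∀ {p q r} → 0ℚ ≤ r → p ≤ q → p * r ≤ q * r
  *-monoʳ-≤ {r = r} 0≤r = *-monoʳ-≤-nonNeg r {{nonNegative 0≤r}}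

  *-nonneg : ∀ {p q} → 0ℚ ≤ p → 0ℚ ≤ q → 0ℚ ≤ p * q
  *-nonneg {p} {q} 0≤p 0≤q = nonNegative⁻¹ (p * q) {{nonNeg*nonNeg⇒nonNeg p {{nonNegative 0≤p}} q {{nonNegative 0≤q}}}}

  +-nonneg : ∀ {p q} → 0ℚ ≤ p → 0ℚ ≤ q → 0ℚ ≤ p + q
  +-nonneg = +-mono-≤

  p≤q⇒0≤q-p : ∀ {p q} → p ≤ q → 0ℚ ≤ q - p
  p≤q⇒0≤q-p {p} {q} p≤q = subst (_≤ q - p) (+-inverseʳ p) (+-monoˡ-≤ (- p) p≤q)

  0≤q-p⇒p≤q : ∀ {p q} → 0ℚ ≤ q - p → p ≤ q
  0≤q-p⇒p≤q {p} {q} 0≤q-p = subst₂ _≤_ (+-identityˡ p) (lemma p q) (+-monoˡ-≤ p 0≤q-p)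
    where
    lemma : ∀ p q → q - p + p ≡ q
    lemma = Solver.solve-∀ ℚ-ring

  *-mono-≤ : ∀ {p q r s} → 0ℚ ≤ q → 0ℚ ≤ r → p ≤ q → r ≤ s → p * r ≤ q * s
  *-mono-≤ 0≤q 0≤r p≤q r≤s = ≤-trans (*-monoʳ-≤ 0≤r p≤q) (*-monoˡ-≤ 0≤q r≤s)

  infixr 8 _^_

  _^_ : ℚ → ℕ → ℚ
  x ^ zero  = 1ℚ
  x ^ suc n = x * x ^ n

  ^-+ : ∀ x m n → x ^ (m ℕ.+ n) ≡ x ^ m * x ^ n
  ^-+ x zero    n = sym (*-identityˡ _)
  ^-+ x (suc m) n = trans (cong (x *_) (^-+ x m n)) (sym (*-assoc x (x ^ m) (x ^ n)))

  ^-distrib-* : ∀ x y n → (x * y) ^ n ≡ x ^ n * y ^ n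
  ^-distrib-* x y zero    = refl
  ^-distrib-* x y (suc n) = trans (cong (x * y *_) (^-distrib-* x y n)) (lemma x y (x ^ n) (y ^ n))
    where
    lemma : ∀ x y u v → x * y * (u * v) ≡ x * u * (y * v)
    lemma = Solver.solve-∀ ℚ-ring

  ^-assoc : ∀ x m n → (x ^ m) ^ n ≡ x ^ (m ℕ.* n)
  ^-assoc x m zero    = sym (cong (x ^_) (ℕ.*-zeroʳ m))
  ^-assoc x m (suc n) = trans (cong (x ^ m *_) (^-assoc x m n)) (trans (sym (^-+ x m (m ℕ.* n))) (cong (x ^_) (sym (ℕ.*-suc m n))))

  ^-nonneg : ∀ {x} n → 0ℚ ≤ x → 0ℚ ≤ x ^ n
  ^-nonneg zero    0≤x = 0≤1
  ^-nonneg (suc n) 0≤x = *-nonneg 0≤x (^-nonneg n 0≤x)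

  ^-monoˡ-≤ : ∀ {x y} n → 0ℚ ≤ x → x ≤ y → x ^ n ≤ y ^ n
  ^-monoˡ-≤ zero    0≤x x≤y = ≤-refl
  ^-monoˡ-≤ (suc n) 0≤x x≤y = *-mono-≤ (≤-trans 0≤x x≤y) (^-nonneg n 0≤x) x≤y (^-monoˡ-≤ n 0≤x x≤y)

  1^n≡1 : ∀ n → 1ℚ ^ n ≡ 1ℚ
  1^n≡1 zero    = refl
  1^n≡1 (suc n) = trans (*-identityˡ _) (1^n≡1 n)

  ^-upper : ∀ {x} n → 0ℚ ≤ x → x ≤ 1ℚ → x ^ n ≤ 1ℚ
  ^-upper {x} n 0≤x x≤1 = subst (x ^ n ≤_) (1^n≡1 n) (^-monoˡ-≤ n 0≤x x≤1)

  ^-lower : ∀ {x} n → 1ℚ ≤ x → 1ℚ ≤ x ^ n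
  ^-lower {x} n 1≤x = subst (_≤ x ^ n) (1^n≡1 n) (^-monoˡ-≤ n 0≤1 1≤x)

  ^-monoʳ-≤ : ∀ {x m n} → 1ℚ ≤ x → m ℕ.≤ n → x ^ m ≤ x ^ n
  ^-monoʳ-≤ {n = n} 1≤x ℕ.z≤n = ^-lower n 1≤x
  ^-monoʳ-≤ 1≤x (ℕ.s≤s m≤n) = *-monoˡ-≤ (≤-trans 0≤1 1≤x) (^-monoʳ-≤ 1≤x m≤n)

  ½^-antimono : ∀ {m n} → m ℕ.≤ n → ½ ^ n ≤ ½ ^ m
  ½^-antimono {n = n} ℕ.z≤n   = ^-upper n 0≤½ ½≤1
  ½^-antimono (ℕ.s≤s m≤n)     = *-monoˡ-≤ 0≤½ (½^-antimono m≤n)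

  ½^n*2^n≡1 : ∀ n → ½ ^ n * 2ℚ ^ n ≡ 1ℚ
  ½^n*2^n≡1 n = trans (sym (^-distrib-* ½ 2ℚ n)) (1^n≡1 n)

  p*p≥0 : ∀ p → 0ℚ ≤ p * p
  p*p≥0 p with ≤-total 0ℚ p
  ... | inj₁ 0≤p = *-nonneg 0≤p 0≤p
  ... | inj₂ p≤0 = subst (0ℚ ≤_) (lemma p) (*-nonneg 0≤-p 0≤-p)
    where
    0≤-p : 0ℚ ≤ - p
    0≤-p = neg-antimono-≤ p≤0
    lemma : ∀ p → - p * - p ≡ p * p
    lemma = Solver.solve-∀ ℚ-ring

  p≤∣p∣ : ∀ p → p ≤ ∣ p ∣
  p≤∣p∣ p with ≤-total 0ℚ p
  ... | inj₁ 0≤p = ≤-reflexive (sym (0≤p⇒∣p∣≡p 0≤p))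
  ... | inj₂ p≤0 = ≤-trans p≤0 (0≤∣p∣ p)

  ∣p∣*∣p∣≡p*p : ∀ p → ∣ p ∣ * ∣ p ∣ ≡ p * p
  ∣p∣*∣p∣≡p*p p = trans (sym (∣p*q∣≡∣p∣*∣q∣ p p)) (0≤p⇒∣p∣≡p (p*p≥0 p))

  ∣p∣≤q : ∀ {p q} → p ≤ q → - p ≤ q → ∣ p ∣ ≤ q
  ∣p∣≤q {p} p≤q -p≤q with ∣p∣≡p∨∣p∣≡-p p
  ... | inj₁ eq = subst (_≤ _) (sym eq) p≤q
  ... | inj₂ eq = subst (_≤ _) (sym eq) -p≤q

  fromℕ : ℕ → ℚ
  fromℕ zero    = 0ℚ
  fromℕ (suc n) = 1ℚ + fromℕ n

  fromℕ-+ : ∀ m n → fromℕ (m ℕ.+ n) ≡ fromℕ m + fromℕ n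
  fromℕ-+ zero    n = sym (+-identityˡ _)
  fromℕ-+ (suc m) n = trans (cong (1ℚ +_) (fromℕ-+ m n)) (sym (+-assoc 1ℚ (fromℕ m) (fromℕ n)))

  fromℕ-* : ∀ m n → fromℕ (m ℕ.* n) ≡ fromℕ m * fromℕ n
  fromℕ-* zero    n = sym (*-zeroˡ (fromℕ n))
  fromℕ-* (suc m) n = trans (fromℕ-+ n (m ℕ.* n)) (trans (cong (fromℕ n +_) (fromℕ-* m n)) (lemma (fromℕ m) (fromℕ n)))
    where
    lemma : ∀ a b → b + a * b ≡ (1ℚ + a) * b
    lemma = Solver.solve-∀ ℚ-ring

  fromℕ-^ : ∀ m n → fromℕ (m ℕ.^ n) ≡ fromℕ m ^ n
  fromℕ-^ m zero    = refl
  fromℕ-^ m (suc n) = trans (fromℕ-* m (m ℕ.^ n)) (cong (fromℕ m *_) (fromℕ-^ m n))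

  fromℕ-nonneg : ∀ n → 0ℚ ≤ fromℕ n
  fromℕ-nonneg zero    = ≤-refl
  fromℕ-nonneg (suc n) = +-nonneg 0≤1 (fromℕ-nonneg n)

  fromℕ-mono-≤ : ∀ {m n} → m ℕ.≤ n → fromℕ m ≤ fromℕ n
  fromℕ-mono-≤ {n = n} ℕ.z≤n = fromℕ-nonneg n
  fromℕ-mono-≤ (ℕ.s≤s m≤n) = +-monoʳ-≤ 1ℚ (fromℕ-mono-≤ m≤n)

  -- The 2^k-th power, as iterated squaring: each Cauchy–Schwarz step peels off one squaring.
  pow₂ : ℕ → ℚ → ℚ
  pow₂ zero    x = x
  pow₂ (suc k) x = pow₂ k (x * x)

  pow₂-mono : ∀ k {x y} → 0ℚ ≤ x → x ≤ y → pow₂ k x ≤ pow₂ k y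
  pow₂-mono zero    0≤x x≤y = x≤y
  pow₂-mono (suc k) 0≤x x≤y = pow₂-mono k (*-nonneg 0≤x 0≤x) (*-mono-≤ (≤-trans 0≤x x≤y) 0≤x x≤y x≤y)

  pow₂-1 : ∀ k → pow₂ k 1ℚ ≡ 1ℚ
  pow₂-1 zero    = refl
  pow₂-1 (suc k) = pow₂-1 k

  pow₂-* : ∀ k x y → pow₂ k (x * y) ≡ pow₂ k x * pow₂ k y
  pow₂-* zero    x y = refl
  pow₂-* (suc k) x y = trans (cong (pow₂ k) (lemma x y)) (pow₂-* k (x * x) (y * y))
    where
    lemma : ∀ x y → x * y * (x * y) ≡ x * x * (y * y)
    lemma = Solver.solve-∀ ℚ-ring

  pow₂≡^ : ∀ k x → pow₂ k x ≡ x ^ (2 ℕ.^ k)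
  pow₂≡^ zero    x = sym (*-identityʳ x)
  pow₂≡^ (suc k) x = trans (pow₂≡^ k (x * x)) (trans (cong (λ y → (x * y) ^ (2 ℕ.^ k)) (sym (*-identityʳ x))) (^-assoc x 2 (2 ℕ.^ k)))

  square-cancel-≤ : ∀ {x y} → 0ℚ ≤ y → x * x ≤ y * y → x ≤ y
  square-cancel-≤ {x} {y} 0≤y x²≤y² with x ≤? y
  ... | yes x≤y = x≤y
  ... | no x≰y = contradiction (<-≤-trans (≤-<-trans yy≤xy xy<xx) x²≤y²) (<-irrefl refl)
    where
    y<x : y < x
    y<x = ≰⇒> x≰y
    yy≤xy : y * y ≤ x * y
    yy≤xy = *-monoʳ-≤ 0≤y (<⇒≤ y<x)
    xy<xx : x * y < x * x
    xy<xx = *-monoʳ-<-pos x {{positive (≤-<-trans 0≤y y<x)}} y<x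

  -- Stands in for extracting a 2^k-th root, which need not exist in ℚ. Correlation bounds are
  -- carried in `pow₂ k` form and cancelled only at the end.
  pow₂-cancel-≤ : ∀ k {x y} → 0ℚ ≤ y → pow₂ k x ≤ pow₂ k y → x ≤ y
  pow₂-cancel-≤ zero    0≤y h = h
  pow₂-cancel-≤ (suc k) {x} {y} 0≤y h = square-cancel-≤ 0≤y (pow₂-cancel-≤ k (p*p≥0 y) h)

-- Uniform averages over bit strings and function tables.

module Expectation where

  open RationalFacts
  open import Data.Nat as ℕ using (ℕ; zero; suc)
  import Data.Nat.Properties as ℕ
  open import Data.Bool using (Bool; true; false; if_then_else_; not; _∧_)
  import Data.Bool.Properties as Bool
  open import Data.Product using (Σ; _×_; _,_)
  open import Data.Product.Properties using (,-injective)
  open import Data.Rational hiding (_≟_)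
  open import Data.Rational.Properties hiding (_≟_)
  open import Data.Sum using (inj₁; inj₂)
  open import Data.Unit using (⊤; tt)
  open import Function using (_∘_)
  open import Relation.Binary.Definitions using (DecidableEquality)
  open import Relation.Binary.PropositionalEquality
  open import Relation.Nullary using (yes; no; does)
  open import Relation.Nullary.Decidable using (map′; _×-dec_)
  open import Relation.Nullary.Negation using (contradiction)
  import Data.Unit.Properties as Unit
  import Tactic.RingSolver as Solver

  infixr 6 _⊗_

  -- Codes for finite sets whose cardinality is a power of two. `E` becomes an exact rational
  -- recursion over coordinates, and random functions are themselves points of a space.
  data Space : Set where
    unit bit : Space
    _⊗_ : Space → Space → Space

  El : Space → Set
  El unit    = ⊤
  El bit     = Bool
  El (a ⊗ b) = El a × El b

  E : ∀ a → (El a → ℚ) → ℚ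
  E unit    f = f tt
  E bit     f = ½ * (f true + f false)
  E (a ⊗ b) f = E a λ x → E b λ y → f (x , y)

  E-mono : ∀ a {f g : El a → ℚ} → (∀ x → f x ≤ g x) → E a f ≤ E a g
  E-mono unit    f≤g = f≤g tt
  E-mono bit     f≤g = *-monoˡ-≤ 0≤½ (+-mono-≤ (f≤g true) (f≤g false))
  E-mono (a ⊗ b) f≤g = E-mono a λ x → E-mono b λ y → f≤g (x , y)

  E-cong : ∀ a {f g : El a → ℚ} → (∀ x → f x ≡ g x) → E a f ≡ E a g
  E-cong unit    f≡g = f≡g tt
  E-cong bit     f≡g = cong₂ (λ s t → ½ * (s + t)) (f≡g true) (f≡g false)
  E-cong (a ⊗ b) f≡g = E-cong a λ x → E-cong b λ y → f≡g (x , y)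

  E-const : ∀ a c → E a (λ _ → c) ≡ c
  E-const unit    c = refl
  E-const bit     c = lemma c
    where
    lemma : ∀ c → ½ * (c + c) ≡ c
    lemma = Solver.solve-∀ ℚ-ring
  E-const (a ⊗ b) c = trans (E-cong a λ _ → E-const b c) (E-const a c)

  E-+ : ∀ a (f g : El a → ℚ) → E a (λ x → f x + g x) ≡ E a f + E a g
  E-+ unit    f g = refl
  E-+ bit     f g = lemma (f true) (g true) (f false) (g false)
    where
    lemma : ∀ p q r s → ½ * (p + q + (r + s)) ≡ ½ * (p + r) + ½ * (q + s)
    lemma = Solver.solve-∀ ℚ-ring
  E-+ (a ⊗ b) f g = trans (E-cong a λ x → E-+ b _ _) (E-+ a _ _)

  E-*ˡ : ∀ a c (f : El a → ℚ) → E a (λ x → c * f x) ≡ c * E a f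
  E-*ˡ unit    c f = refl
  E-*ˡ bit     c f = lemma c (f true) (f false)
    where
    lemma : ∀ c p q → ½ * (c * p + c * q) ≡ c * (½ * (p + q))
    lemma = Solver.solve-∀ ℚ-ring
  E-*ˡ (a ⊗ b) c f = trans (E-cong a λ x → E-*ˡ b c _) (E-*ˡ a c _)

  E-*ʳ : ∀ a c (f : El a → ℚ) → E a (λ x → f x * c) ≡ E a f * c
  E-*ʳ a c f = trans (E-cong a λ x → *-comm (f x) c) (trans (E-*ˡ a c f) (*-comm c _))

  E-neg : ∀ a (f : El a → ℚ) → E a (λ x → - f x) ≡ - E a f
  E-neg a f = trans (E-cong a λ x → -1* (f x)) (trans (E-*ˡ a (- 1ℚ) f) (sym (-1* _)))
    where
    -1* : ∀ p → - p ≡ - 1ℚ * p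
    -1* = Solver.solve-∀ ℚ-ring

  E-nonneg : ∀ a {f : El a → ℚ} → (∀ x → 0ℚ ≤ f x) → 0ℚ ≤ E a f
  E-nonneg a 0≤f = ≡-≤-trans (sym (E-const a 0ℚ)) (E-mono a 0≤f)

  E-≤-const : ∀ a {f : El a → ℚ} {c} → (∀ x → f x ≤ c) → E a f ≤ c
  E-≤-const a f≤c = ≤-≡-trans (E-mono a f≤c) (E-const a _)

  ∣E∣≤E∣∣ : ∀ a (f : El a → ℚ) → ∣ E a f ∣ ≤ E a (λ x → ∣ f x ∣)
  ∣E∣≤E∣∣ a f = ∣p∣≤q (E-mono a λ x → p≤∣p∣ (f x))
    (≡-≤-trans (sym (E-neg a f)) (E-mono a λ x → ≤-≡-trans (p≤∣p∣ (- f x)) (∣-p∣≡∣p∣ (f x))))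

  E-swap : ∀ a b (f : El a → El b → ℚ) → E a (λ x → E b (f x)) ≡ E b (λ y → E a (λ x → f x y))
  E-swap unit      b f = refl
  E-swap bit       b f = trans (cong (½ *_) (sym (E-+ b _ _))) (sym (E-*ˡ b ½ _))
  E-swap (a₁ ⊗ a₂) b f = trans (E-cong a₁ λ x → E-swap a₂ b _) (E-swap a₁ b _)

  E-product : ∀ a b (f : El a → ℚ) (g : El b → ℚ) → E a (λ x → E b λ y → f x * g y) ≡ E a f * E b g
  E-product a b f g = trans (E-cong a λ x → E-*ˡ b (f x) g) (E-*ʳ a (E b g) f)

  -- The variance of `f` is nonnegative.
  E-square : ∀ a (f : El a → ℚ) → E a f * E a f ≤ E a (λ x → f x * f x)
  E-square a f = 0≤q-p⇒p≤q (subst (0ℚ ≤_) expand (E-nonneg a λ x → p*p≥0 (f x - μ)))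
    where
    μ : ℚ
    μ = E a f
    lemma : ∀ y m → (y - m) * (y - m) ≡ y * y + ((- (m + m)) * y + m * m)
    lemma = Solver.solve-∀ ℚ-ring
    collect : ∀ s m → s + ((- (m + m)) * m + m * m) ≡ s - m * m
    collect = Solver.solve-∀ ℚ-ring
    expand : E a (λ x → (f x - μ) * (f x - μ)) ≡ E a (λ x → f x * f x) - μ * μ
    expand = begin
      E a (λ x → (f x - μ) * (f x - μ))
        ≡⟨ E-cong a (λ x → lemma (f x) μ) ⟩
      E a (λ x → f x * f x + ((- (μ + μ)) * f x + μ * μ))
        ≡⟨ E-+ a _ _ ⟩
      E a (λ x → f x * f x) + E a (λ x → (- (μ + μ)) * f x + μ * μ)
        ≡⟨ cong (E a (λ x → f x * f x) +_) (trans (E-+ a _ _) (cong₂ _+_ (E-*ˡ a (- (μ + μ)) f) (E-const a (μ * μ)))) ⟩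
      E a (λ x → f x * f x) + ((- (μ + μ)) * μ + μ * μ)
        ≡⟨ collect (E a λ x → f x * f x) μ ⟩
      E a (λ x → f x * f x) - μ * μ ∎
      where open ≡-Reasoning

  -- Jensen's inequality for the power 2^k, with one variance inequality per squaring.
  pow₂-E : ∀ k a {f : El a → ℚ} → (∀ x → 0ℚ ≤ f x) → pow₂ k (E a f) ≤ E a (λ x → pow₂ k (f x))
  pow₂-E zero    a 0≤f = ≤-refl
  pow₂-E (suc k) a {f} 0≤f = ≤-trans
    (pow₂-mono k (p*p≥0 (E a f)) (E-square a f))
    (pow₂-E k a λ x → p*p≥0 (f x))

  -- The averaging argument as a search: coordinates are fixed one at a time, and at each bit the
  -- value with the smaller conditional mean is kept.
  E-witness : ∀ a (f : El a → ℚ) {c} → E a f ≤ c → Σ (El a) λ x → f x ≤ c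
  E-witness unit    f Ef≤c = tt , Ef≤c
  E-witness bit     f Ef≤c with ≤-total (f true) (f false)
  ... | inj₁ t≤f = true  , ≤-trans (≡-≤-trans (sym (E-const bit _)) (*-monoˡ-≤ 0≤½ (+-monoʳ-≤ (f true) t≤f))) Ef≤c
  ... | inj₂ f≤t = false , ≤-trans (≡-≤-trans (sym (E-const bit _)) (*-monoˡ-≤ 0≤½ (+-monoˡ-≤ (f false) f≤t))) Ef≤c
  E-witness (a ⊗ b) f Ef≤c =
    let x , h = E-witness a (λ x → E b λ y → f (x , y)) Ef≤c
        y , h′ = E-witness b (λ y → f (x , y)) h
    in (x , y) , h′

  size : Space → ℕ
  size unit    = 0
  size bit     = 1
  size (a ⊗ b) = size a ℕ.+ size b

  _≟_ : ∀ {a} → DecidableEquality (El a)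
  _≟_ {unit}  = Unit._≟_
  _≟_ {bit}   = Bool._≟_
  _≟_ {a ⊗ b} = λ (x , y) (x′ , y′) → map′ (λ (p , q) → cong₂ _,_ p q) ,-injective (_≟_ {a} x x′ ×-dec _≟_ {b} y y′)

  ⟦_⟧ : Bool → ℚ
  ⟦ b ⟧ = if b then 1ℚ else 0ℚ

  0≤⟦_⟧ : ∀ b → 0ℚ ≤ ⟦ b ⟧
  0≤⟦ true ⟧  = 0≤1
  0≤⟦ false ⟧ = ≤-refl

  ⟦_⟧≤1 : ∀ b → ⟦ b ⟧ ≤ 1ℚ
  ⟦ true ⟧≤1  = ≤-refl
  ⟦ false ⟧≤1 = 0≤1

  ⟦∧⟧ : ∀ b c → ⟦ b ∧ c ⟧ ≡ ⟦ b ⟧ * ⟦ c ⟧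
  ⟦∧⟧ true  c = sym (*-identityˡ ⟦ c ⟧)
  ⟦∧⟧ false c = sym (*-zeroˡ ⟦ c ⟧)

  E-≟ : ∀ a (x : El a) → E a (λ y → ⟦ does (_≟_ {a} x y) ⟧) ≡ ½ ^ size a
  E-≟ unit    x     = refl
  E-≟ bit     true  = refl
  E-≟ bit     false = refl
  E-≟ (a ⊗ b) (x , y) = begin
    E a (λ x′ → E b λ y′ → ⟦ does (_≟_ {a ⊗ b} (x , y) (x′ , y′)) ⟧)
      ≡⟨ E-cong a (λ x′ → E-cong b λ y′ → ⟦∧⟧ (does (_≟_ {a} x x′)) (does (_≟_ {b} y y′))) ⟩
    E a (λ x′ → E b λ y′ → ⟦ does (_≟_ {a} x x′) ⟧ * ⟦ does (_≟_ {b} y y′) ⟧)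
      ≡⟨ E-product a b _ _ ⟩
    E a (λ x′ → ⟦ does (_≟_ {a} x x′) ⟧) * E b (λ y′ → ⟦ does (_≟_ {b} y y′) ⟧)
      ≡⟨ cong₂ _*_ (E-≟ a x) (E-≟ b y) ⟩
    ½ ^ size a * ½ ^ size b
      ≡⟨ sym (^-+ ½ (size a) (size b)) ⟩
    ½ ^ (size a ℕ.+ size b) ∎
    where
    open ≡-Reasoning

  pow : Space → ℕ → Space
  pow a zero    = unit
  pow a (suc n) = a ⊗ pow a n

  size-pow : ∀ a n → size (pow a n) ≡ n ℕ.* size a
  size-pow a zero    = refl
  size-pow a (suc n) = cong (size a ℕ.+_) (size-pow a n)

  -- All functions El a → El c, as tables.
  fun : Space → Space → Space
  fun unit    c = c
  fun bit     c = c ⊗ c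
  fun (a ⊗ b) c = fun a (fun b c)

  app : ∀ a c → El (fun a c) → El a → El c
  app unit    c t       tt      = t
  app bit     c (t , _) true    = t
  app bit     c (_ , f) false   = f
  app (a ⊗ b) c t       (x , y) = app b c (app a (fun b c) t x) y

  size-fun : ∀ a c → size (fun a c) ≡ 2 ℕ.^ size a ℕ.* size c
  size-fun unit    c = sym (ℕ.*-identityˡ (size c))
  size-fun bit     c = cong (size c ℕ.+_) (sym (ℕ.*-identityˡ (size c)))
  size-fun (a ⊗ b) c = begin
    size (fun a (fun b c))                            ≡⟨ size-fun a (fun b c) ⟩
    2 ℕ.^ size a ℕ.* size (fun b c)                   ≡⟨ cong (2 ℕ.^ size a ℕ.*_) (size-fun b c) ⟩
    2 ℕ.^ size a ℕ.* (2 ℕ.^ size b ℕ.* size c)        ≡⟨ sym (ℕ.*-assoc (2 ℕ.^ size a) (2 ℕ.^ size b) (size c)) ⟩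
    2 ℕ.^ size a ℕ.* 2 ℕ.^ size b ℕ.* size c          ≡⟨ cong (ℕ._* size c) (sym (ℕ.^-distribˡ-+-* 2 (size a) (size b))) ⟩
    2 ℕ.^ (size a ℕ.+ size b) ℕ.* size c              ∎
    where open ≡-Reasoning

  E-app : ∀ a c x (h : El c → ℚ) → E (fun a c) (λ t → h (app a c t x)) ≡ E c h
  E-app unit    c tt      h = refl
  E-app bit     c true    h = E-cong c λ t → E-const c (h t)
  E-app bit     c false   h = E-const c _
  E-app (a ⊗ b) c (x , y) h = trans (E-app a (fun b c) x λ t → h (app b c t y)) (E-app b c y h)

  -- Pairwise independence of the values of a random function. Two distinct arguments either select
  -- different rows, which are independent, or differ inside a common row, which is again a uniform
  -- table.
  E-app₂ : ∀ a c {x y} → x ≢ y → (h : El c → El c → ℚ) →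
           E (fun a c) (λ t → h (app a c t x) (app a c t y)) ≡ E c λ u → E c λ v → h u v
  E-app₂ unit    c x≢y h = contradiction refl x≢y
  E-app₂ bit     c {true}  {true}  x≢y h = contradiction refl x≢y
  E-app₂ bit     c {true}  {false} x≢y h = refl
  E-app₂ bit     c {false} {true}  x≢y h = E-swap c c λ u v → h v u
  E-app₂ bit     c {false} {false} x≢y h = contradiction refl x≢y
  E-app₂ (a ⊗ b) c {x , y} {x′ , y′} xy≢x′y′ h with _≟_ {a} x x′
  ... | no x≢x′ = trans (E-app₂ a (fun b c) x≢x′ λ t t′ → h (app b c t y) (app b c t′ y′))
                        (trans (E-app b c y λ u → E (fun b c) λ t′ → h u (app b c t′ y′))
                               (E-cong c λ u → E-app b c y′ (h u)))
  ... | yes refl = trans (E-app a (fun b c) x λ t → h (app b c t y) (app b c t y′))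
                         (E-app₂ b c (λ y≡y′ → xy≢x′y′ (cong (x ,_) y≡y′)) h)

  modify : ∀ a c → El a → (El c → El c) → El (fun a c) → El (fun a c)
  modify unit    c tt      g t       = g t
  modify bit     c true    g (t , f) = g t , f
  modify bit     c false   g (t , f) = t , g f
  modify (a ⊗ b) c (x , y) g t       = modify a (fun b c) x (modify b c y g) t

  app-modify-≡ : ∀ a c x g t → app a c (modify a c x g t) x ≡ g (app a c t x)
  app-modify-≡ unit    c tt      g t = refl
  app-modify-≡ bit     c true    g t = refl
  app-modify-≡ bit     c false   g t = refl
  app-modify-≡ (a ⊗ b) c (x , y) g t =
    trans (cong (λ s → app b c s y) (app-modify-≡ a (fun b c) x _ t)) (app-modify-≡ b c y g _)

  app-modify-≢ : ∀ a c {x y} g t → x ≢ y → app a c (modify a c x g t) y ≡ app a c t y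
  app-modify-≢ unit    c g t x≢y = contradiction refl x≢y
  app-modify-≢ bit     c {true}  {true}  g t x≢y = contradiction refl x≢y
  app-modify-≢ bit     c {true}  {false} g t x≢y = refl
  app-modify-≢ bit     c {false} {true}  g t x≢y = refl
  app-modify-≢ bit     c {false} {false} g t x≢y = contradiction refl x≢y
  app-modify-≢ (a ⊗ b) c {x , y} {x′ , y′} g t xy≢x′y′ with _≟_ {a} x x′
  ... | no x≢x′ = cong (λ s → app b c s y′) (app-modify-≢ a (fun b c) _ t x≢x′)
  ... | yes refl = trans (cong (λ s → app b c s y′) (app-modify-≡ a (fun b c) x _ t))
                         (app-modify-≢ b c g _ λ y≡y′ → xy≢x′y′ (cong (x ,_) y≡y′))

  -- Only one entry of the table changes, and the entries are independent, so it is enough that `g`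
  -- preserves the uniform measure on a single entry.
  E-modify : ∀ a c x (g : El c → El c) → (∀ h → E c (h ∘ g) ≡ E c h) →
             ∀ h → E (fun a c) (h ∘ modify a c x g) ≡ E (fun a c) h
  E-modify unit    c tt      g inv h = inv h
  E-modify bit     c true    g inv h = inv _
  E-modify bit     c false   g inv h = E-cong c λ t → inv _
  E-modify (a ⊗ b) c (x , y) g inv h = E-modify a (fun b c) x _ (E-modify b c y g inv) h

  E-not : ∀ h → E bit (h ∘ not) ≡ E bit h
  E-not h = cong (½ *_) (+-comm (h false) (h true))

-- Cube norms, parities of blocks and cylinder intersections.

module Box where

  open RationalFacts
  open Expectation
  open import Data.Nat as ℕ using (ℕ; zero; suc)
  open import Data.Bool using (Bool; true; false; _∧_; _xor_)
  open import Data.Product using (_×_; _,_)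
  open import Data.Rational hiding (_≟_)
  open import Data.Rational.Properties hiding (_≟_)
  open import Data.Unit using (tt)
  open import Data.Vec using (Vec; []; _∷_)
  open import Relation.Binary.PropositionalEquality
  import Tactic.RingSolver as Solver
  open import Algebra.Bundles using (CommutativeRing)
  open import Data.Bool.Properties using (xor-∧-commutativeRing)
  open import Algebra.Properties.CommutativeSemigroup (CommutativeRing.+-commutativeSemigroup xor-∧-commutativeRing) using (interchange)

  sgn : Bool → ℚ
  sgn true  = - 1ℚ
  sgn false = 1ℚ

  sgn-xor : ∀ b c → sgn (b xor c) ≡ sgn b * sgn c
  sgn-xor true  true  = refl
  sgn-xor true  false = refl
  sgn-xor false c     = sym (*-identityˡ (sgn c))

  ∣sgn∣≡1 : ∀ b → ∣ sgn b ∣ ≡ 1ℚ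
  ∣sgn∣≡1 true  = refl
  ∣sgn∣≡1 false = refl

  -- b x ys, with x on player 0's forehead and ys on those of the k other players.
  Pred : Space → Space → ℕ → Set
  Pred A Y k = El A → El (pow Y k) → Bool

  -- The cube norm of (-1)^b, without its final root.
  box : ∀ A Y k → Pred A Y k → ℚ
  box A Y zero    b = ∣ E A (λ x → sgn (b x tt)) ∣
  box A Y (suc k) b = E Y λ y → E Y λ y′ → box A Y k λ x ys → b x (y , ys) xor b x (y′ , ys)

  box-cong : ∀ A Y k {b b′} → (∀ x ys → b x ys ≡ b′ x ys) → box A Y k b ≡ box A Y k b′
  box-cong A Y zero    b≡b′ = cong ∣_∣ (E-cong A λ x → cong sgn (b≡b′ x tt))
  box-cong A Y (suc k) b≡b′ = E-cong Y λ y → E-cong Y λ y′ → box-cong A Y k λ x ys →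
    cong₂ _xor_ (b≡b′ x (y , ys)) (b≡b′ x (y′ , ys))

  box-nonneg : ∀ A Y k b → 0ℚ ≤ box A Y k b
  box-nonneg A Y zero    b = 0≤∣p∣ _
  box-nonneg A Y (suc k) b = E-nonneg Y λ y → E-nonneg Y λ y′ → box-nonneg A Y k _

  box≤1 : ∀ A Y k b → box A Y k b ≤ 1ℚ
  box≤1 A Y zero    b = ≤-trans (∣E∣≤E∣∣ A _) (E-≤-const A λ x → ≤-reflexive (∣sgn∣≡1 (b x tt)))
  box≤1 A Y (suc k) b = E-≤-const Y λ y → E-≤-const Y λ y′ → box≤1 A Y k _

  box-false : ∀ A Y k → box A Y k (λ _ _ → false) ≡ 1ℚ
  box-false A Y zero    = cong ∣_∣ (E-const A 1ℚ)
  box-false A Y (suc k) = trans (E-cong Y λ y → trans (E-cong Y λ y′ → box-false A Y k) (E-const Y 1ℚ)) (E-const Y 1ℚ)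

  firsts : ∀ Y Z k → El (pow (Y ⊗ Z) k) → El (pow Y k)
  firsts Y Z zero    tt             = tt
  firsts Y Z (suc k) ((y , _) , ps) = y , firsts Y Z k ps

  seconds : ∀ Y Z k → El (pow (Y ⊗ Z) k) → El (pow Z k)
  seconds Y Z zero    tt             = tt
  seconds Y Z (suc k) ((_ , z) , ps) = z , seconds Y Z k ps

  direct-sum : ∀ A Y A′ Y′ k → Pred A Y k → Pred A′ Y′ k → Pred (A ⊗ A′) (Y ⊗ Y′) k
  direct-sum A Y A′ Y′ k b b′ (x , x′) ys = b x (firsts Y Y′ k ys) xor b′ x′ (seconds Y Y′ k ys)

  -- By `interchange` the difference of two slices of a direct sum is the direct sum of the
  -- differences. The variables of the two summands are independent, so every average factors, and
  -- absolute values multiply at the bottom.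
  box-direct-sum : ∀ A Y A′ Y′ k b b′ →
    box (A ⊗ A′) (Y ⊗ Y′) k (direct-sum A Y A′ Y′ k b b′) ≡ box A Y k b * box A′ Y′ k b′
  box-direct-sum A Y A′ Y′ zero b b′ = trans
    (cong ∣_∣ (trans (E-cong A λ x → E-cong A′ λ x′ → sgn-xor (b x tt) (b′ x′ tt)) (E-product A A′ (λ x → sgn (b x tt)) λ x′ → sgn (b′ x′ tt))))
    (∣p*q∣≡∣p∣*∣q∣ (E A λ x → sgn (b x tt)) _)
  box-direct-sum A Y A′ Y′ (suc k) b b′ = begin
    (E Y λ y → E Y′ λ z → E Y λ y′ → E Y′ λ z′ → box (A ⊗ A′) (Y ⊗ Y′) k λ x ys →
      direct-sum A Y A′ Y′ (suc k) b b′ x ((y , z) , ys) xor direct-sum A Y A′ Y′ (suc k) b b′ x ((y′ , z′) , ys))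
      ≡⟨ E-cong Y (λ y → E-cong Y′ λ z → E-cong Y λ y′ → E-cong Y′ λ z′ → trans
           (box-cong (A ⊗ A′) (Y ⊗ Y′) k λ (x , x′) ys → interchange (b x (y , firsts Y Y′ k ys)) _ _ _)
           (box-direct-sum A Y A′ Y′ k _ _)) ⟩
    (E Y λ y → E Y′ λ z → E Y λ y′ → E Y′ λ z′ → f y y′ * g z z′)
      ≡⟨ E-cong Y (λ y → E-swap Y′ Y _) ⟩
    (E Y λ y → E Y λ y′ → E Y′ λ z → E Y′ λ z′ → f y y′ * g z z′)
      ≡⟨ E-product (Y ⊗ Y) (Y′ ⊗ Y′) (λ (y , y′) → f y y′) (λ (z , z′) → g z z′) ⟩
    box A Y (suc k) b * box A′ Y′ (suc k) b′ ∎
    where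
    open ≡-Reasoning
    f : El Y → El Y → ℚ
    f y y′ = box A Y k λ x ys → b x (y , ys) xor b x (y′ , ys)
    g : El Y′ → El Y′ → ℚ
    g z z′ = box A′ Y′ k λ x ys → b′ x (z , ys) xor b′ x (z′ , ys)

  weight : ∀ {m} → Vec Bool m → ℕ
  weight []          = 0
  weight (true  ∷ S) = suc (weight S)
  weight (false ∷ S) = weight S

  -- `S` is a characteristic vector. A block outside it is masked to the constant `false`, whose
  -- cube norm is 1, so that all parities live on the same `m` blocks.
  parity : ∀ A Y k {m} → Pred A Y k → Vec Bool m → Pred (pow A m) (pow Y m) k
  parity A Y k b []      = λ _ _ → false
  parity A Y k {suc m} b (s ∷ S) =
    direct-sum A Y (pow A m) (pow Y m) k (λ x ys → s ∧ b x ys) (parity A Y k b S)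

  box-parity : ∀ A Y k {m} b (S : Vec Bool m) →
    box (pow A m) (pow Y m) k (parity A Y k b S) ≡ box A Y k b ^ weight S
  box-parity A Y k b [] = box-false unit unit k
  box-parity A Y k {suc m} b (true ∷ S) = trans
    (box-direct-sum A Y (pow A m) (pow Y m) k b (parity A Y k b S))
    (cong (box A Y k b *_) (box-parity A Y k b S))
  box-parity A Y k {suc m} b (false ∷ S) = begin
    box (pow A (suc m)) (pow Y (suc m)) k (parity A Y k b (false ∷ S))
      ≡⟨ box-direct-sum A Y (pow A m) (pow Y m) k (λ _ _ → false) (parity A Y k b S) ⟩
    box A Y k (λ _ _ → false) * box (pow A m) (pow Y m) k (parity A Y k b S)
      ≡⟨ cong₂ _*_ (box-false A Y k) (box-parity A Y k b S) ⟩
    1ℚ * box A Y k b ^ weight S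
      ≡⟨ *-identityˡ _ ⟩
    box A Y k b ^ weight S ∎
    where open ≡-Reasoning

  -- Cylinder intersections, peeled off player by player: the factor that does not depend on
  -- the first entry y of ys and, for each y, a cylinder intersection for the other players.
  Cylinder : Space → Space → ℕ → Set
  Cylinder A Y zero    = Bool
  Cylinder A Y (suc k) = Pred A Y k × (El Y → Cylinder A Y k)

  member : ∀ A Y k → Cylinder A Y k → Pred A Y k
  member A Y zero    c       x tt       = c
  member A Y (suc k) (u , w) x (y , ys) = u x ys ∧ member A Y k (w y) x ys

  meet : ∀ A Y k → Cylinder A Y k → Cylinder A Y k → Cylinder A Y k
  meet A Y zero    c       c′        = c ∧ c′
  meet A Y (suc k) (u , w) (u′ , w′) = (λ x ys → u x ys ∧ u′ x ys) , λ y → meet A Y k (w y) (w′ y)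

  ⟦member-meet⟧ : ∀ A Y k C C′ x ys →
    ⟦ member A Y k (meet A Y k C C′) x ys ⟧ ≡ ⟦ member A Y k C x ys ⟧ * ⟦ member A Y k C′ x ys ⟧
  ⟦member-meet⟧ A Y zero    c c′ x tt = ⟦∧⟧ c c′
  ⟦member-meet⟧ A Y (suc k) (u , w) (u′ , w′) x (y , ys) = begin
    ⟦ (u x ys ∧ u′ x ys) ∧ member A Y k (meet A Y k (w y) (w′ y)) x ys ⟧
      ≡⟨ ⟦∧⟧ (u x ys ∧ u′ x ys) _ ⟩
    ⟦ u x ys ∧ u′ x ys ⟧ * ⟦ member A Y k (meet A Y k (w y) (w′ y)) x ys ⟧
      ≡⟨ cong₂ _*_ (⟦∧⟧ (u x ys) (u′ x ys)) (⟦member-meet⟧ A Y k (w y) (w′ y) x ys) ⟩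
    ⟦ u x ys ⟧ * ⟦ u′ x ys ⟧ * (⟦ member A Y k (w y) x ys ⟧ * ⟦ member A Y k (w′ y) x ys ⟧)
      ≡⟨ lemma ⟦ u x ys ⟧ ⟦ u′ x ys ⟧ _ _ ⟩
    ⟦ u x ys ⟧ * ⟦ member A Y k (w y) x ys ⟧ * (⟦ u′ x ys ⟧ * ⟦ member A Y k (w′ y) x ys ⟧)
      ≡⟨ sym (cong₂ _*_ (⟦∧⟧ (u x ys) _) (⟦∧⟧ (u′ x ys) _)) ⟩
    ⟦ u x ys ∧ member A Y k (w y) x ys ⟧ * ⟦ u′ x ys ∧ member A Y k (w′ y) x ys ⟧ ∎
    where
    open ≡-Reasoning
    lemma : ∀ p q r s → p * q * (r * s) ≡ p * r * (q * s)
    lemma = Solver.solve-∀ ℚ-ring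

  correlation : ∀ A Y k → Cylinder A Y k → Pred A Y k → ℚ
  correlation A Y k C b = E A λ x → E (pow Y k) λ ys → ⟦ member A Y k C x ys ⟧ * sgn (b x ys)

  ⟦_⟧²≤1 : ∀ b → ⟦ b ⟧ * ⟦ b ⟧ ≤ 1ℚ
  ⟦ b ⟧²≤1 = *-mono-≤ 0≤1 0≤⟦ b ⟧ ⟦ b ⟧≤1 ⟦ b ⟧≤1

  -- One Cauchy-Schwarz step. The factor `u` does not depend on `y`, so it leaves the average over
  -- `y` and is dropped after squaring. The square of the rest ranges over pairs `y`, `y′` and
  -- involves the meet of two slices, again a cylinder intersection with one player fewer.
  correlation-square : ∀ A Y k u w b →
    correlation A Y (suc k) (u , w) b * correlation A Y (suc k) (u , w) b ≤
    (E Y λ y → E Y λ y′ → correlation A Y k (meet A Y k (w y) (w y′)) λ x ys → b x (y , ys) xor b x (y′ , ys))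
  correlation-square A Y k u w b = begin
    V * V
      ≡⟨ cong (λ v → v * v) pull-out ⟩
    E Ω (λ (x , ys) → ⟦ u x ys ⟧ * D x ys) * E Ω (λ (x , ys) → ⟦ u x ys ⟧ * D x ys)
      ≤⟨ E-square Ω _ ⟩
    E Ω (λ (x , ys) → ⟦ u x ys ⟧ * D x ys * (⟦ u x ys ⟧ * D x ys))
      ≤⟨ E-mono Ω (λ (x , ys) → drop (u x ys) (D x ys)) ⟩
    E Ω (λ (x , ys) → D x ys * D x ys)
      ≡⟨ E-cong Ω (λ (x , ys) → sym (E-product Y Y _ _)) ⟩
    (E Ω λ (x , ys) → E (Y ⊗ Y) λ (y , y′) → term x y ys * term x y′ ys)
      ≡⟨ E-swap Ω (Y ⊗ Y) _ ⟩
    (E (Y ⊗ Y) λ (y , y′) → E Ω λ (x , ys) → term x y ys * term x y′ ys)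
      ≡⟨ E-cong (Y ⊗ Y) (λ (y , y′) → E-cong Ω λ (x , ys) → combine x y y′ ys) ⟩
    (E Y λ y → E Y λ y′ → correlation A Y k (meet A Y k (w y) (w y′)) λ x ys → b x (y , ys) xor b x (y′ , ys)) ∎
    where
    open ≤-Reasoning
    Ω : Space
    Ω = A ⊗ pow Y k
    V : ℚ
    V = correlation A Y (suc k) (u , w) b
    term : El A → El Y → El (pow Y k) → ℚ
    term x y ys = ⟦ member A Y k (w y) x ys ⟧ * sgn (b x (y , ys))
    D : El A → El (pow Y k) → ℚ
    D x ys = E Y λ y → term x y ys
    pull-out : V ≡ E Ω λ (x , ys) → ⟦ u x ys ⟧ * D x ys
    pull-out = E-cong A λ x → trans (E-swap Y (pow Y k) _) (E-cong (pow Y k) λ ys → trans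
      (E-cong Y λ y → trans (cong (_* sgn (b x (y , ys))) (⟦∧⟧ (u x ys) _)) (*-assoc ⟦ u x ys ⟧ _ _))
      (E-*ˡ Y ⟦ u x ys ⟧ _))
    drop : ∀ c d → ⟦ c ⟧ * d * (⟦ c ⟧ * d) ≤ d * d
    drop c d = begin
      ⟦ c ⟧ * d * (⟦ c ⟧ * d)   ≡⟨ regroup ⟦ c ⟧ d ⟩
      ⟦ c ⟧ * ⟦ c ⟧ * (d * d)   ≤⟨ *-monoʳ-≤ (p*p≥0 d) ⟦ c ⟧²≤1 ⟩
      1ℚ * (d * d)              ≡⟨ *-identityˡ (d * d) ⟩
      d * d                     ∎
      where
      regroup : ∀ c d → c * d * (c * d) ≡ c * c * (d * d)
      regroup = Solver.solve-∀ ℚ-ring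
    combine : ∀ x y y′ ys → term x y ys * term x y′ ys ≡
      ⟦ member A Y k (meet A Y k (w y) (w y′)) x ys ⟧ * sgn (b x (y , ys) xor b x (y′ , ys))
    combine x y y′ ys = trans
      (regroup ⟦ member A Y k (w y) x ys ⟧ (sgn (b x (y , ys))) ⟦ member A Y k (w y′) x ys ⟧ (sgn (b x (y′ , ys))))
      (sym (cong₂ _*_ (⟦member-meet⟧ A Y k (w y) (w y′) x ys) (sgn-xor (b x (y , ys)) (b x (y′ , ys)))))
      where
      regroup : ∀ p q r s → p * q * (r * s) ≡ p * r * (q * s)
      regroup = Solver.solve-∀ ℚ-ring

  -- The base case rests on the cylinder being constant: the factor of player 0 cannot depend on
  -- `x`, the only variable left.
  correlation≤box : ∀ A Y k C b → pow₂ k ∣ correlation A Y k C b ∣ ≤ box A Y k b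
  correlation≤box A Y zero c b = begin
    ∣ E A (λ x → ⟦ c ⟧ * sgn (b x tt)) ∣      ≡⟨ cong ∣_∣ (E-*ˡ A ⟦ c ⟧ _) ⟩
    ∣ ⟦ c ⟧ * E A (λ x → sgn (b x tt)) ∣      ≡⟨ ∣p*q∣≡∣p∣*∣q∣ ⟦ c ⟧ _ ⟩
    ∣ ⟦ c ⟧ ∣ * ∣ E A (λ x → sgn (b x tt)) ∣  ≡⟨ cong (_* _) (0≤p⇒∣p∣≡p 0≤⟦ c ⟧) ⟩
    ⟦ c ⟧ * ∣ E A (λ x → sgn (b x tt)) ∣      ≤⟨ *-monoʳ-≤ (0≤∣p∣ _) ⟦ c ⟧≤1 ⟩
    1ℚ * ∣ E A (λ x → sgn (b x tt)) ∣         ≡⟨ *-identityˡ _ ⟩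
    ∣ E A (λ x → sgn (b x tt)) ∣              ∎
    where open ≤-Reasoning
  correlation≤box A Y (suc k) (u , w) b = begin
    pow₂ k (∣ V ∣ * ∣ V ∣)                    ≡⟨ cong (pow₂ k) (∣p∣*∣p∣≡p*p V) ⟩
    pow₂ k (V * V)                            ≤⟨ pow₂-mono k (p*p≥0 V) (≤-trans (correlation-square A Y k u w b)
                                                   (E-mono (Y ⊗ Y) λ p → p≤∣p∣ (V′ p))) ⟩
    pow₂ k (E (Y ⊗ Y) λ p → ∣ V′ p ∣)         ≤⟨ pow₂-E k (Y ⊗ Y) (λ p → 0≤∣p∣ (V′ p)) ⟩
    E (Y ⊗ Y) (λ p → pow₂ k ∣ V′ p ∣)         ≤⟨ E-mono (Y ⊗ Y) (λ p → correlation≤box A Y k _ _) ⟩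
    box A Y (suc k) b                         ∎
    where
    open ≤-Reasoning
    V : ℚ
    V = correlation A Y (suc k) (u , w) b
    V′ : El (Y ⊗ Y) → ℚ
    V′ (y , y′) = correlation A Y k (meet A Y k (w y) (w y′)) λ x ys → b x (y , ys) xor b x (y′ , ys)

  pow₂-^ : ∀ k x n → pow₂ k (x ^ n) ≡ pow₂ k x ^ n
  pow₂-^ k x zero    = pow₂-1 k
  pow₂-^ k x (suc n) = trans (pow₂-* k x (x ^ n)) (cong (pow₂ k x *_) (pow₂-^ k x n))

  correlation-parity : ∀ A Y k {m} b {β} → 0ℚ ≤ β → box A Y k b ≤ pow₂ k β →
    ∀ C (S : Vec Bool m) → ∣ correlation (pow A m) (pow Y m) k C (parity A Y k b S) ∣ ≤ β ^ weight S
  correlation-parity A Y k {m} b {β} 0≤β box≤β C S = pow₂-cancel-≤ k (^-nonneg (weight S) 0≤β) (begin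
    pow₂ k ∣ correlation (pow A m) (pow Y m) k C (parity A Y k b S) ∣  ≤⟨ correlation≤box (pow A m) (pow Y m) k C _ ⟩
    box (pow A m) (pow Y m) k (parity A Y k b S)                       ≡⟨ box-parity A Y k b S ⟩
    box A Y k b ^ weight S                                             ≤⟨ ^-monoˡ-≤ (weight S) (box-nonneg A Y k b) box≤β ⟩
    pow₂ k β ^ weight S                                                ≡⟨ sym (pow₂-^ k β (weight S)) ⟩
    pow₂ k (β ^ weight S)                                              ∎)
    where open ≤-Reasoning

-- Random selectors and the existence of a gadget of small cube norm.

module RandomSelection where

  open RationalFacts
  open Expectation
  open Box
  open import Algebra.Bundles using (CommutativeRing)
  open import Data.Bool using (Bool; true; false; not; _xor_)
  open import Data.Bool.Properties using (xor-∧-commutativeRing; xor-assoc; xor-same; xor-identityʳ; not-distribˡ-xor; not-distribʳ-xor)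
  open import Algebra.Properties.CommutativeSemigroup (CommutativeRing.+-commutativeSemigroup xor-∧-commutativeRing) using (interchange)
  open import Data.Nat as ℕ using (ℕ; zero; suc)
  import Data.Nat.Properties as ℕ
  open import Data.Product using (Σ; _,_)
  open import Data.Rational hiding (_≟_)
  open import Data.Rational.Properties hiding (_≟_)
  open import Data.Unit using (tt)
  open import Function using (_∘_)
  open import Relation.Binary.PropositionalEquality
  open import Relation.Nullary using (yes; no; does)
  import Tactic.RingSolver as Solver

  append : ∀ c s t → El (pow c s) → El (pow c t) → El (pow c (s ℕ.+ t))
  append c zero    t tt       vs = vs
  append c (suc s) t (u , us) vs = u , append c s t us vs

  E-append : ∀ c s t (h : El (pow c (s ℕ.+ t)) → ℚ) →
    E (pow c s) (λ us → E (pow c t) λ vs → h (append c s t us vs)) ≡ E (pow c (s ℕ.+ t)) h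
  E-append c zero    t h = refl
  E-append c (suc s) t h = E-cong c λ u → E-append c s t (h ∘ (u ,_))

  apps : ∀ a c t → El (pow (fun a c) t) → El a → El (pow c t)
  apps a c zero    tt       x = tt
  apps a c (suc t) (f , fs) x = app a c f x , apps a c t fs x

  apps-append : ∀ a c s t fs gs x →
    apps a c (s ℕ.+ t) (append (fun a c) s t fs gs) x ≡ append c s t (apps a c s fs x) (apps a c t gs x)
  apps-append a c zero    t tt       gs x = refl
  apps-append a c (suc s) t (f , fs) gs x = cong (app a c f x ,_) (apps-append a c s t fs gs x)

  E-apps₂ : ∀ a c t {x y} → x ≢ y → (h : El (pow c t) → El (pow c t) → ℚ) →
    E (pow (fun a c) t) (λ fs → h (apps a c t fs x) (apps a c t fs y)) ≡ E (pow c t) λ us → E (pow c t) (h us)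
  E-apps₂ a c zero    x≢y h = refl
  E-apps₂ a c (suc t) {x} {y} x≢y h = begin
    (E (fun a c) λ f → E (pow (fun a c) t) λ fs → h (app a c f x , apps a c t fs x) (app a c f y , apps a c t fs y))
      ≡⟨ E-cong (fun a c) (λ f → E-apps₂ a c t x≢y λ us vs → h (app a c f x , us) (app a c f y , vs)) ⟩
    (E (fun a c) λ f → E (pow c t) λ us → E (pow c t) λ vs → h (app a c f x , us) (app a c f y , vs))
      ≡⟨ E-app₂ a c x≢y (λ u v → E (pow c t) λ us → E (pow c t) λ vs → h (u , us) (v , vs)) ⟩
    (E c λ u → E c λ v → E (pow c t) λ us → E (pow c t) λ vs → h (u , us) (v , vs))
      ≡⟨ E-cong c (λ u → E-swap c (pow c t) _) ⟩
    (E c λ u → E (pow c t) λ us → E c λ v → E (pow c t) λ vs → h (u , us) (v , vs)) ∎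
    where open ≡-Reasoning

  module _ (p : ℕ) where

    Pos : Space
    Pos = pow bit p

    Array : Space
    Array = fun Pos bit

    _at_ : El Array → El Pos → Bool
    x at l = app Pos bit x l

    xor-at : ∀ t → El Array → El (pow Pos t) → Bool
    xor-at zero    x tt       = false
    xor-at (suc t) x (l , ls) = (x at l) xor xor-at t x ls

    xor-at-append : ∀ s t x ls ls′ → xor-at (s ℕ.+ t) x (append Pos s t ls ls′) ≡ xor-at s x ls xor xor-at t x ls′
    xor-at-append zero    t x tt       ls′ = refl
    xor-at-append (suc s) t x (l , ls) ls′ =
      trans (cong ((x at l) xor_) (xor-at-append s t x ls ls′)) (sym (xor-assoc (x at l) _ _))

    bias : (El Array → Bool) → ℚ
    bias W = ∣ E Array (λ x → sgn (W x)) ∣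

    bias-cong : ∀ {W W′} → (∀ x → W x ≡ W′ x) → bias W ≡ bias W′
    bias-cong W≡W′ = cong ∣_∣ (E-cong Array λ x → cong sgn (W≡W′ x))

    flip : El Pos → El Array → El Array
    flip l = modify Pos bit l not

    -- Flipping one bit preserves the uniform measure on arrays, so the mean equals its own
    -- negative.
    bias-flip : ∀ l {W} → (∀ x → W (flip l x) ≡ not (W x)) → bias W ≡ 0ℚ
    bias-flip l {W} odd = cong ∣_∣ (x≡-x⇒x≡0 (begin
      E Array (λ x → sgn (W x))             ≡⟨ sym (E-modify Pos bit l not E-not _) ⟩
      E Array (λ x → sgn (W (flip l x)))    ≡⟨ E-cong Array (λ x → trans (cong sgn (odd x)) (sgn-not (W x))) ⟩
      E Array (λ x → - sgn (W x))           ≡⟨ E-neg Array _ ⟩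
      - E Array (λ x → sgn (W x))           ∎))
      where
      open ≡-Reasoning
      sgn-not : ∀ b → sgn (not b) ≡ - sgn b
      sgn-not true  = refl
      sgn-not false = refl
      half : ∀ y → y ≡ ½ * (y - (- y))
      half = Solver.solve-∀ ℚ-ring
      zero′ : ∀ y → ½ * (y - y) ≡ 0ℚ
      zero′ = Solver.solve-∀ ℚ-ring
      x≡-x⇒x≡0 : ∀ {y} → y ≡ - y → y ≡ 0ℚ
      x≡-x⇒x≡0 {y} y≡-y = trans (half y) (trans (cong (λ z → ½ * (y - z)) (sym y≡-y)) (zero′ y))

    -- `W` carries the positions that are already fixed, while the other `t` are averaged. The
    -- induction moves positions from the second group into the first.
    mean-bias : ∀ t → (El Array → Bool) → ℚ
    mean-bias t W = E (pow Pos t) λ ls → bias λ x → W x xor xor-at t x ls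

    mean-bias-nonneg : ∀ t W → 0ℚ ≤ mean-bias t W
    mean-bias-nonneg t W = E-nonneg (pow Pos t) λ ls → 0≤∣p∣ _

    E-mean-bias : ∀ t W → E Pos (λ l → mean-bias t λ x → W x xor (x at l)) ≡ mean-bias (suc t) W
    E-mean-bias t W = E-cong Pos λ l → E-cong (pow Pos t) λ ls → bias-cong λ x → xor-assoc (W x) (x at l) _

    -- Unless x at l is balanced out by one of the t random positions, flipping it makes
    -- the sign change; the union bound over these positions gives the factor t.
    mean-bias-at : ∀ t W l → (∀ x → W (flip l x) ≡ W x) →
      mean-bias (suc t) (λ x → W x xor (x at l)) ≤ fromℕ (suc t) * (½ ^ p * mean-bias t W)
    mean-bias-at t W l W-even = begin
      mean-bias (suc t) (λ x → W x xor (x at l))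
        ≤⟨ E-mono Pos step ⟩
      E Pos (λ l′ → ⟦ does (_≟_ {Pos} l l′) ⟧ * mean-bias t W + rest t l′)
        ≡⟨ trans (E-+ Pos _ _) (cong₂ _+_ (E-*ʳ Pos (mean-bias t W) _) refl) ⟩
      E Pos (λ l′ → ⟦ does (_≟_ {Pos} l l′) ⟧) * mean-bias t W + E Pos (rest t)
        ≡⟨ cong₂ _+_ (cong (_* mean-bias t W) (trans (E-≟ Pos l) (cong (½ ^_) size-Pos))) (E-rest t) ⟩
      ½ ^ p * mean-bias t W + fromℕ t * (½ ^ p * mean-bias t W)
        ≡⟨ collect (½ ^ p * mean-bias t W) (fromℕ t) ⟩
      fromℕ (suc t) * (½ ^ p * mean-bias t W) ∎
      where
      open ≤-Reasoning
      size-Pos : size Pos ≡ p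
      size-Pos = trans (size-pow bit p) (ℕ.*-identityʳ p)
      collect : ∀ a b → a + b * a ≡ (1ℚ + b) * a
      collect = Solver.solve-∀ ℚ-ring
      -- The bound for a first random position `l′` that misses `l`. It is kept as a function of
      -- `l′`, so that averaging it over all `l′` turns the fixed `l′` back into a random position.
      rest : ∀ t → El Pos → ℚ
      rest zero    l′ = 0ℚ
      rest (suc t) l′ = fromℕ (suc t) * (½ ^ p * mean-bias t λ x → W x xor (x at l′))
      rest-nonneg : ∀ t l′ → 0ℚ ≤ rest t l′
      rest-nonneg zero    l′ = ≤-refl
      rest-nonneg (suc t) l′ = *-nonneg (fromℕ-nonneg (suc t)) (*-nonneg (^-nonneg p 0≤½) (mean-bias-nonneg t λ x → W x xor (x at l′)))
      E-rest : ∀ t → E Pos (rest t) ≡ fromℕ t * (½ ^ p * mean-bias t W)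
      E-rest zero    = trans (E-const Pos 0ℚ) (sym (*-zeroˡ (½ ^ p * mean-bias 0 W)))
      E-rest (suc t) = trans (E-*ˡ Pos (fromℕ (suc t)) _) (cong (fromℕ (suc t) *_) (trans (E-*ˡ Pos (½ ^ p) (λ l′ → mean-bias t λ x → W x xor (x at l′))) (cong (½ ^ p *_) (E-mean-bias t W))))
      W-even′ : ∀ {l′} → l ≢ l′ → ∀ x → W (flip l x) xor (flip l x at l′) ≡ W x xor (x at l′)
      W-even′ l≢l′ x = cong₂ _xor_ (W-even x) (app-modify-≢ Pos bit not x l≢l′)
      cancel : ∀ w b r → (w xor b) xor (b xor r) ≡ w xor r
      cancel w b r = trans (xor-assoc w b (b xor r)) (cong (w xor_) (trans (sym (xor-assoc b b r)) (cong (_xor r) (xor-same b))))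
      -- A first position `l′` that misses `l` is absorbed into `W`, which stays even under
      -- `flip l`, and the induction goes on with one position fewer. With none left, nothing can
      -- balance `l` and the bias vanishes.
      other : ∀ t {l′} → l ≢ l′ → E (pow Pos t) (λ ls → bias λ x → (W x xor (x at l)) xor ((x at l′) xor xor-at t x ls)) ≤ rest t l′
      other zero    l≢l′ = ≤-reflexive (bias-flip l λ x → trans
        (cong₂ _xor_ (cong₂ _xor_ (W-even x) (app-modify-≡ Pos bit l not x)) (cong (_xor false) (app-modify-≢ Pos bit not x l≢l′)))
        (trans (cong (_xor _) (sym (not-distribʳ-xor (W x) (x at l)))) (sym (not-distribˡ-xor (W x xor (x at l)) _))))
      other (suc t) {l′} l≢l′ = ≡-≤-trans
        (E-cong (pow Pos (suc t)) λ ls → bias-cong λ x → trans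
          (interchange (W x) (x at l) (x at l′) (xor-at (suc t) x ls)) (sym (xor-assoc (W x xor (x at l′)) (x at l) _)))
        (mean-bias-at t (λ x → W x xor (x at l′)) l (W-even′ l≢l′))
      step : ∀ l′ → E (pow Pos t) (λ ls → bias λ x → (W x xor (x at l)) xor ((x at l′) xor xor-at t x ls)) ≤
                    ⟦ does (_≟_ {Pos} l l′) ⟧ * mean-bias t W + rest t l′
      step l′ with _≟_ {Pos} l l′
      ... | yes refl = ≤-trans
        (≤-reflexive (trans (E-cong (pow Pos t) λ ls → bias-cong λ x → cancel (W x) (x at l) _) (sym (trans (+-identityʳ _) (*-identityˡ _)))))
        (+-monoʳ-≤ (1ℚ * mean-bias t W) (rest-nonneg t l))
      ... | no l≢l′ = ≤-trans (other t l≢l′)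
        (≤-reflexive (sym (trans (cong (_+ rest t l′) (*-zeroˡ (mean-bias t W))) (+-identityˡ _))))

    mean-bias₀ : ℕ → ℚ
    mean-bias₀ t = mean-bias t λ _ → false

    mean-bias₀-step : ∀ t → mean-bias₀ (2 ℕ.+ t) ≤ fromℕ (suc t) * (½ ^ p * mean-bias₀ t)
    mean-bias₀-step t = E-≤-const Pos λ l → mean-bias-at t (λ _ → false) l λ _ → refl

    -- Repeating the step yields the factors 1, 3, ..., 2s - 1, whose product counts the perfect
    -- matchings of the 2s positions; each factor is rounded up to `T`.
    mean-bias₀-bound : ∀ T s → 2 ℕ.* s ℕ.≤ T → mean-bias₀ (2 ℕ.* s) ≤ (fromℕ T * ½ ^ p) ^ s
    mean-bias₀-bound T zero    2s≤T = box≤1 Array unit 0 λ _ _ → false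
    mean-bias₀-bound T (suc s) 2s≤T = begin
      mean-bias₀ (2 ℕ.* suc s)                            ≡⟨ cong mean-bias₀ (ℕ.*-suc 2 s) ⟩
      mean-bias₀ (2 ℕ.+ 2 ℕ.* s)                          ≤⟨ mean-bias₀-step (2 ℕ.* s) ⟩
      fromℕ (1 ℕ.+ 2 ℕ.* s) * (½ ^ p * mean-bias₀ (2 ℕ.* s))
        ≤⟨ *-mono-≤ (fromℕ-nonneg T) (*-nonneg (^-nonneg p 0≤½) (mean-bias-nonneg (2 ℕ.* s) λ _ → false))
             (fromℕ-mono-≤ (ℕ.≤-trans (ℕ.n≤1+n _) 2+2s≤T))
             (*-monoˡ-≤ (^-nonneg p 0≤½) (mean-bias₀-bound T s (ℕ.≤-trans (ℕ.m≤n+m (2 ℕ.* s) 2) 2+2s≤T))) ⟩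
      fromℕ T * (½ ^ p * (fromℕ T * ½ ^ p) ^ s)           ≡⟨ sym (*-assoc (fromℕ T) (½ ^ p) _) ⟩
      (fromℕ T * ½ ^ p) ^ suc s                           ∎
      where
      open ≤-Reasoning
      2+2s≤T : 2 ℕ.+ 2 ℕ.* s ℕ.≤ T
      2+2s≤T = subst (ℕ._≤ T) (ℕ.*-suc 2 s) 2s≤T

    module _ (Y : Space) where

      -- Curried, so that fixing the string of one player leaves a selector for the remaining ones,
      -- and distinct strings give independent such selectors.
      Selector : ℕ → Space
      Selector zero    = Pos
      Selector (suc k) = fun Y (Selector k)

      select : ∀ k → El (Selector k) → El (pow Y k) → El Pos
      select zero    φ tt       = φ
      select (suc k) φ (y , ys) = select k (app Y (Selector k) φ y) ys

      selects : ∀ k t → El (pow (Selector k) t) → El (pow Y k) → El (pow Pos t)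
      selects zero    t φs tt       = φs
      selects (suc k) t φs (y , ys) = selects k t (apps Y (Selector k) t φs y) ys

      selects-1 : ∀ k φ ys → selects k 1 (φ , tt) ys ≡ (select k φ ys , tt)
      selects-1 zero    φ tt       = refl
      selects-1 (suc k) φ (y , ys) = selects-1 k _ ys

      selects-append : ∀ k s t φs φs′ ys →
        selects k (s ℕ.+ t) (append (Selector k) s t φs φs′) ys ≡ append Pos s t (selects k s φs ys) (selects k t φs′ ys)
      selects-append zero    s t φs φs′ tt       = refl
      selects-append (suc k) s t φs φs′ (y , ys) = trans
        (cong (λ ψ → selects k (s ℕ.+ t) ψ ys) (apps-append Y (Selector k) s t φs φs′ y))
        (selects-append k s t _ _ ys)

      selected-xor : ∀ k t → El (pow (Selector k) t) → Pred Array Y k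
      selected-xor k t φs x ys = xor-at t x (selects k t φs ys)

      doubled : ℕ → ℕ → ℕ
      doubled zero    t = t
      doubled (suc k) t = doubled k (t ℕ.+ t)

      -- Passing from y ≢ y′ to the difference of the two slices replaces t independent random
      -- selectors of k+1 arguments by 2t independent random selectors of k arguments.
      E-box : ∀ k t → E (pow (Selector k) t) (λ φs → box Array Y k (selected-xor k t φs)) ≤
                      fromℕ k * ½ ^ size Y + mean-bias₀ (doubled k t)
      E-box zero    t = ≤-reflexive (sym (trans (cong (_+ mean-bias₀ t) (*-zeroˡ (½ ^ size Y))) (+-identityˡ _)))
      E-box (suc k) t = begin
        (E (pow (fun Y S) t) λ φs → E Y λ y → E Y λ y′ → box Array Y k (slice φs y y′))
          ≡⟨ E-swap (pow (fun Y S) t) (Y ⊗ Y) _ ⟩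
        (E Y λ y → E Y λ y′ → E (pow (fun Y S) t) λ φs → box Array Y k (slice φs y y′))
          ≤⟨ E-mono (Y ⊗ Y) (λ (y , y′) → step y y′) ⟩
        (E Y λ y → E Y λ y′ → ⟦ does (_≟_ {Y} y y′) ⟧ + B)
          ≡⟨ E-cong Y (λ y → trans (E-+ Y _ _) (cong₂ _+_ (E-≟ Y y) (E-const Y B))) ⟩
        E Y (λ _ → ½ ^ size Y + B)
          ≡⟨ E-const Y _ ⟩
        ½ ^ size Y + B
          ≤⟨ +-monoʳ-≤ (½ ^ size Y) (E-box k (t ℕ.+ t)) ⟩
        ½ ^ size Y + (fromℕ k * ½ ^ size Y + mean-bias₀ (doubled k (t ℕ.+ t)))
          ≡⟨ collect (½ ^ size Y) (fromℕ k) _ ⟩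
        fromℕ (suc k) * ½ ^ size Y + mean-bias₀ (doubled (suc k) t) ∎
        where
        open ≤-Reasoning
        S : Space
        S = Selector k
        slice : El (pow (fun Y S) t) → El Y → El Y → Pred Array Y k
        slice φs y y′ x ys = selected-xor (suc k) t φs x (y , ys) xor selected-xor (suc k) t φs x (y′ , ys)
        B : ℚ
        B = E (pow S (t ℕ.+ t)) λ ψs → box Array Y k (selected-xor k (t ℕ.+ t) ψs)
        0≤B : 0ℚ ≤ B
        0≤B = E-nonneg (pow S (t ℕ.+ t)) λ ψs → box-nonneg Array Y k _
        collect : ∀ e n q → e + (n * e + q) ≡ (1ℚ + n) * e + q
        collect = Solver.solve-∀ ℚ-ring
        step : ∀ y y′ → E (pow (fun Y S) t) (λ φs → box Array Y k (slice φs y y′)) ≤ ⟦ does (_≟_ {Y} y y′) ⟧ + B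
        step y y′ with _≟_ {Y} y y′
        -- The diagonal gets the trivial bound 1, which the collision probability `½ ^ size Y` pays
        -- for in the average over `y` and `y′`.
        ... | yes _ = ≤-trans (E-≤-const (pow (fun Y S) t) λ φs → box≤1 Array Y k _)
                              (≡-≤-trans (sym (+-identityʳ 1ℚ)) (+-monoʳ-≤ 1ℚ 0≤B))
        ... | no y≢y′ = ≤-reflexive (trans (trans
          (E-cong (pow (fun Y S) t) λ φs → box-cong Array Y k λ x ys → sym (trans
            (cong (xor-at (t ℕ.+ t) x) (selects-append k t t _ _ ys))
            (xor-at-append t t x _ _)))
          (trans (E-apps₂ Y S t y≢y′ λ us vs → box Array Y k (selected-xor k (t ℕ.+ t) (append S t t us vs)))
                 (E-append S t t λ ψs → box Array Y k (selected-xor k (t ℕ.+ t) ψs))))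
          (sym (+-identityˡ B)))

      gadget : ∀ k → El (Selector k) → Pred Array Y k
      gadget k φ x ys = x at select k φ ys

      doubled≡ : ∀ k t → doubled k t ≡ 2 ℕ.^ k ℕ.* t
      doubled≡ zero    t = sym (ℕ.*-identityˡ t)
      doubled≡ (suc k) t = trans (doubled≡ k (t ℕ.+ t)) (trans (cong (λ s → 2 ℕ.^ k ℕ.* (t ℕ.+ s)) (sym (ℕ.+-identityʳ t)))
        (trans (sym (ℕ.*-assoc (2 ℕ.^ k) 2 t)) (cong (ℕ._* t) (ℕ.*-comm (2 ℕ.^ k) 2))))

      good-selector : ∀ k → Σ (El (Selector k)) λ φ →
        box Array Y k (gadget k φ) ≤ fromℕ k * ½ ^ size Y + mean-bias₀ (2 ℕ.^ k)
      good-selector k =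
        let φ , h = E-witness (Selector k) _ (E-box k 1)
        in φ , ≤-trans
             (≤-reflexive (box-cong Array Y k λ x ys →
               sym (trans (cong (xor-at 1 x) (selects-1 k φ ys)) (xor-identityʳ _))))
             (≤-≡-trans h (cong (λ t → fromℕ k * ½ ^ size Y + mean-bias₀ t) (trans (doubled≡ k 1) (ℕ.*-identityʳ (2 ℕ.^ k)))))

-- Protocols as combinations of cylinder intersections.

module Protocols where

  open import Defs
  open RationalFacts
  open Expectation
  open Box
  open import Data.Bool using (Bool; true; false; not; if_then_else_; _∧_)
  open import Data.Fin using (Fin; zero; suc)
  open import Data.Nat as ℕ using (ℕ; zero; suc)
  open import Data.Product using (_,_)
  open import Data.Rational hiding (_≟_; pos; neg)
  open import Data.Rational.Properties hiding (_≟_)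
  open import Data.Unit using (tt)
  open import Data.Vec using (Vec; []; _∷_)
  open import Function using (_∘_)
  open import Relation.Binary.PropositionalEquality
  open import Relation.Nullary.Negation using (contradiction)
  import Tactic.RingSolver as Solver

  default : ∀ a → El a
  default unit    = tt
  default bit     = false
  default (a ⊗ b) = default a , default b

  nth : ∀ Y k → El (pow Y k) → Fin k → El Y
  nth Y (suc k) (y , ys) zero    = y
  nth Y (suc k) (y , ys) (suc j) = nth Y k ys j

  Blind : ∀ A Y k → Fin (suc k) → Pred A Y k → Set
  Blind A Y k i f = ∀ x x′ ys ys′ → (i ≢ zero → x ≡ x′) →
    (∀ j → suc j ≢ i → nth Y k ys j ≡ nth Y k ys′ j) → f x ys ≡ f x′ ys′

  -- Intersects with the set where `f` holds. As `f` ignores the string of player `i`, a default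
  -- value is put there and the result joins the factor of player `i`, below the strings peeled off
  -- earlier.
  restrict : ∀ A Y k → Fin (suc k) → Pred A Y k → Cylinder A Y k → Cylinder A Y k
  restrict A Y zero    zero          f c       = f (default A) tt ∧ c
  restrict A Y (suc k) zero          f (u , w) = u , λ y → restrict A Y k zero (λ x ys → f x (y , ys)) (w y)
  restrict A Y (suc k) (suc zero)    f (u , w) = (λ x ys → f x (default Y , ys) ∧ u x ys) , w
  restrict A Y (suc k) (suc (suc i)) f (u , w) = u , λ y → restrict A Y k (suc i) (λ x ys → f x (y , ys)) (w y)

  ⟦member-restrict⟧ : ∀ A Y k i f C → Blind A Y k i f → ∀ x ys →
    ⟦ member A Y k (restrict A Y k i f C) x ys ⟧ ≡ ⟦ f x ys ⟧ * ⟦ member A Y k C x ys ⟧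
  ⟦member-restrict⟧ A Y zero zero f c blind x tt = trans
    (cong (λ b → ⟦ b ∧ c ⟧) (blind (default A) x tt tt (contradiction refl) λ ()))
    (⟦∧⟧ (f x tt) c)
  ⟦member-restrict⟧ A Y (suc k) zero f (u , w) blind x (y , ys) = begin
    ⟦ u x ys ∧ member A Y k (restrict A Y k zero g (w y)) x ys ⟧
      ≡⟨ ⟦∧⟧ (u x ys) _ ⟩
    ⟦ u x ys ⟧ * ⟦ member A Y k (restrict A Y k zero g (w y)) x ys ⟧
      ≡⟨ cong (⟦ u x ys ⟧ *_) (⟦member-restrict⟧ A Y k zero g (w y) g-blind x ys) ⟩
    ⟦ u x ys ⟧ * (⟦ f x (y , ys) ⟧ * ⟦ member A Y k (w y) x ys ⟧)
      ≡⟨ regroup ⟦ u x ys ⟧ ⟦ f x (y , ys) ⟧ ⟦ member A Y k (w y) x ys ⟧ ⟩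
    ⟦ f x (y , ys) ⟧ * (⟦ u x ys ⟧ * ⟦ member A Y k (w y) x ys ⟧)
      ≡⟨ cong (⟦ f x (y , ys) ⟧ *_) (sym (⟦∧⟧ (u x ys) _)) ⟩
    ⟦ f x (y , ys) ⟧ * ⟦ u x ys ∧ member A Y k (w y) x ys ⟧ ∎
    where
    open ≡-Reasoning
    g : Pred A Y k
    g x ys = f x (y , ys)
    g-blind : Blind A Y k zero g
    g-blind x x′ ys ys′ x≡x′ ys≡ys′ = blind x x′ _ _ (contradiction refl) λ where
      zero    _ → refl
      (suc j) _ → ys≡ys′ j λ ()
    regroup : ∀ p q r → p * (q * r) ≡ q * (p * r)
    regroup = Solver.solve-∀ ℚ-ring
  ⟦member-restrict⟧ A Y (suc k) (suc zero) f (u , w) blind x (y , ys) = begin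
    ⟦ (f x (default Y , ys) ∧ u x ys) ∧ member A Y k (w y) x ys ⟧
      ≡⟨ cong (λ b → ⟦ (b ∧ u x ys) ∧ member A Y k (w y) x ys ⟧) (blind x x _ _ (λ _ → refl) agree) ⟩
    ⟦ (f x (y , ys) ∧ u x ys) ∧ member A Y k (w y) x ys ⟧
      ≡⟨ trans (⟦∧⟧ (f x (y , ys) ∧ u x ys) _) (cong (_* _) (⟦∧⟧ (f x (y , ys)) (u x ys))) ⟩
    ⟦ f x (y , ys) ⟧ * ⟦ u x ys ⟧ * ⟦ member A Y k (w y) x ys ⟧
      ≡⟨ *-assoc ⟦ f x (y , ys) ⟧ _ _ ⟩
    ⟦ f x (y , ys) ⟧ * (⟦ u x ys ⟧ * ⟦ member A Y k (w y) x ys ⟧)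
      ≡⟨ cong (⟦ f x (y , ys) ⟧ *_) (sym (⟦∧⟧ (u x ys) _)) ⟩
    ⟦ f x (y , ys) ⟧ * ⟦ u x ys ∧ member A Y k (w y) x ys ⟧ ∎
    where
    open ≡-Reasoning
    agree : ∀ j → suc j ≢ suc zero → nth Y (suc k) (default Y , ys) j ≡ nth Y (suc k) (y , ys) j
    agree zero    1≢1 = contradiction refl 1≢1
    agree (suc j) _   = refl
  ⟦member-restrict⟧ A Y (suc k) (suc (suc i)) f (u , w) blind x (y , ys) = begin
    ⟦ u x ys ∧ member A Y k (restrict A Y k (suc i) g (w y)) x ys ⟧
      ≡⟨ ⟦∧⟧ (u x ys) _ ⟩
    ⟦ u x ys ⟧ * ⟦ member A Y k (restrict A Y k (suc i) g (w y)) x ys ⟧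
      ≡⟨ cong (⟦ u x ys ⟧ *_) (⟦member-restrict⟧ A Y k (suc i) g (w y) g-blind x ys) ⟩
    ⟦ u x ys ⟧ * (⟦ f x (y , ys) ⟧ * ⟦ member A Y k (w y) x ys ⟧)
      ≡⟨ regroup ⟦ u x ys ⟧ ⟦ f x (y , ys) ⟧ ⟦ member A Y k (w y) x ys ⟧ ⟩
    ⟦ f x (y , ys) ⟧ * (⟦ u x ys ⟧ * ⟦ member A Y k (w y) x ys ⟧)
      ≡⟨ cong (⟦ f x (y , ys) ⟧ *_) (sym (⟦∧⟧ (u x ys) _)) ⟩
    ⟦ f x (y , ys) ⟧ * ⟦ u x ys ∧ member A Y k (w y) x ys ⟧ ∎
    where
    open ≡-Reasoning
    g : Pred A Y k
    g x ys = f x (y , ys)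
    g-blind : Blind A Y k (suc i) g
    g-blind x x′ ys ys′ x≡x′ ys≡ys′ = blind x x′ _ _ (λ _ → x≡x′ λ ()) λ where
      zero    _     → refl
      (suc j) j+2≢i → ys≡ys′ j λ j+1≡i → j+2≢i (cong suc j+1≡i)
    regroup : ∀ p q r → p * (q * r) ≡ q * (p * r)
    regroup = Solver.solve-∀ ℚ-ring

  everything : ∀ A Y k → Cylinder A Y k
  everything A Y zero    = true
  everything A Y (suc k) = (λ _ _ → true) , λ _ → everything A Y k

  member-everything : ∀ A Y k x ys → member A Y k (everything A Y k) x ys ≡ true
  member-everything A Y zero    x tt       = refl
  member-everything A Y (suc k) x (y , ys) = member-everything A Y k x ys

  toVec : ∀ r → El (pow bit r) → Vec Bool r
  toVec zero    tt       = []
  toVec (suc r) (b , bs) = b ∷ toVec r bs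

  fromVec : ∀ {r} → Vec Bool r → El (pow bit r)
  fromVec []       = tt
  fromVec (b ∷ bs) = b , fromVec bs

  toVec-fromVec : ∀ {r} (v : Vec Bool r) → toVec r (fromVec v) ≡ v
  toVec-fromVec []       = refl
  toVec-fromVec (b ∷ bs) = cong (b ∷_) (toVec-fromVec bs)

  count≡E : ∀ r (f : Vec Bool r → Bool) → fromℕ (count r f) ≡ 2ℚ ^ r * E (pow bit r) (λ ρ → ⟦ f (toVec r ρ) ⟧)
  count≡E zero f with f []
  ... | true  = refl
  ... | false = refl
  count≡E (suc r) f = begin
    fromℕ (count r (f ∘ (true ∷_)) ℕ.+ count r (f ∘ (false ∷_)))
      ≡⟨ fromℕ-+ (count r (f ∘ (true ∷_))) _ ⟩
    fromℕ (count r (f ∘ (true ∷_))) + fromℕ (count r (f ∘ (false ∷_)))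
      ≡⟨ cong₂ _+_ (count≡E r _) (count≡E r _) ⟩
    2ℚ ^ r * E (pow bit r) (λ ρ → ⟦ f (true ∷ toVec r ρ) ⟧) + 2ℚ ^ r * E (pow bit r) (λ ρ → ⟦ f (false ∷ toVec r ρ) ⟧)
      ≡⟨ collect (2ℚ ^ r) _ _ ⟩
    2ℚ ^ suc r * E (pow bit (suc r)) (λ ρ → ⟦ f (toVec (suc r) ρ) ⟧) ∎
    where
    open ≡-Reasoning
    collect : ∀ c p q → c * p + c * q ≡ (1ℚ + 1ℚ) * c * (½ * (p + q))
    collect = Solver.solve-∀ ℚ-ring

  accepting : Sign → Bool
  accepting neg = true
  accepting pos = false

  module _ (A Y : Space) {n : ℕ} (encA : El A → Vec Bool n) (encY : El Y → Vec Bool n) (k : ℕ) where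

    input : El A → El (pow Y k) → Input (suc k) n
    input x ys zero    = encA x
    input x ys (suc j) = encY (nth Y k ys j)

    SeenBy⇒Blind : ∀ {i f} → SeenBy i f → Blind A Y k i (λ x ys → f (input x ys))
    SeenBy⇒Blind seen x x′ ys ys′ x≡x′ ys≡ys′ = seen _ _ λ where
      zero    0≢i   → cong encA (x≡x′ (0≢i ∘ sym))
      (suc j) j+1≢i → cong encY (ys≡ys′ j j+1≢i)

    accepts : ∀ {d} → Prot (suc k) n d → Pred A Y k
    accepts P x ys = accepting (run P (input x ys))

    acceptance : ∀ {c} → RProt (suc k) n c → El A → El (pow Y k) → ℚ
    acceptance (r , R) x ys = E (pow bit r) λ ρ → ⟦ accepts (R (toVec r ρ)) x ys ⟧

    acceptance-nonneg : ∀ {c} (R : RProt (suc k) n c) x ys → 0ℚ ≤ acceptance R x ys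
    acceptance-nonneg (r , R) x ys = E-nonneg (pow bit r) λ ρ → 0≤⟦ accepts (R (toVec r ρ)) x ys ⟧

    threefold-E≤1 : ∀ r f → 3 ℕ.* count r f ℕ.≤ 2 ℕ.^ r → 3ℚ * E (pow bit r) (λ ρ → ⟦ f (toVec r ρ) ⟧) ≤ 1ℚ
    threefold-E≤1 r f h = begin
      3ℚ * e                          ≡⟨ sym (trans (cong (_* (3ℚ * e)) (½^n*2^n≡1 r)) (*-identityˡ _)) ⟩
      ½ ^ r * 2ℚ ^ r * (3ℚ * e)       ≡⟨ regroup (½ ^ r) (2ℚ ^ r) 3ℚ e ⟩
      ½ ^ r * (3ℚ * (2ℚ ^ r * e))     ≡⟨ cong (λ m → ½ ^ r * (3ℚ * m)) (sym (count≡E r f)) ⟩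
      ½ ^ r * (3ℚ * fromℕ (count r f)) ≡⟨ cong (½ ^ r *_) (sym (fromℕ-* 3 (count r f))) ⟩
      ½ ^ r * fromℕ (3 ℕ.* count r f) ≤⟨ *-monoˡ-≤ (^-nonneg r 0≤½) (fromℕ-mono-≤ h) ⟩
      ½ ^ r * fromℕ (2 ℕ.^ r)         ≡⟨ trans (cong (½ ^ r *_) (fromℕ-^ 2 r)) (½^n*2^n≡1 r) ⟩
      1ℚ                              ∎
      where
      open ≤-Reasoning
      e : ℚ
      e = E (pow bit r) λ ρ → ⟦ f (toVec r ρ) ⟧
      regroup : ∀ a b c d → a * b * (c * d) ≡ a * (c * (b * d))
      regroup = Solver.solve-∀ ℚ-ring

    -- Scaled by 3, the probabilities 1/3 and 2/3 become the thresholds 1 and 2: powers stay at most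
    -- 1 on one side and grow at least like 2^ℓ on the other.
    acceptance-pos : ∀ {c} (R : RProt (suc k) n c) x ys → ErrAtMostThird R (input x ys) pos → 3ℚ * acceptance R x ys ≤ 1ℚ
    acceptance-pos (r , R) x ys err = ≡-≤-trans
      (cong (3ℚ *_) (E-cong (pow bit r) λ ρ → cong ⟦_⟧ (errs (run (R (toVec r ρ)) (input x ys)))))
      (threefold-E≤1 r _ err)
      where
      errs : ∀ s → accepting s ≡ (if sameSign s pos then false else true)
      errs neg = refl
      errs pos = refl

    acceptance-neg : ∀ {c} (R : RProt (suc k) n c) x ys → ErrAtMostThird R (input x ys) neg → 2ℚ ≤ 3ℚ * acceptance R x ys
    acceptance-neg (r , R) x ys err = begin
      2ℚ                                        ≡⟨ refl ⟩
      3ℚ - 1ℚ                                   ≤⟨ +-monoʳ-≤ 3ℚ (neg-antimono-≤ (threefold-E≤1 r _ err)) ⟩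
      3ℚ - 3ℚ * e                               ≡⟨ regroup e ⟩
      3ℚ * (1ℚ + - e)                           ≡⟨ cong (3ℚ *_) (sym E-acc) ⟩
      3ℚ * acceptance (r , R) x ys              ∎
      where
      open ≤-Reasoning
      wrong : Sign → Bool
      wrong s = if sameSign s neg then false else true
      e : ℚ
      e = E (pow bit r) λ ρ → ⟦ wrong (run (R (toVec r ρ)) (input x ys)) ⟧
      regroup : ∀ e → 3ℚ - 3ℚ * e ≡ 3ℚ * (1ℚ + - e)
      regroup = Solver.solve-∀ ℚ-ring
      complement : ∀ s → ⟦ accepting s ⟧ ≡ 1ℚ + - ⟦ wrong s ⟧
      complement neg = refl
      complement pos = refl
      E-acc : acceptance (r , R) x ys ≡ 1ℚ + - e
      E-acc = trans (E-cong (pow bit r) λ ρ → complement (run (R (toVec r ρ)) (input x ys)))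
        (trans (E-+ (pow bit r) _ _) (cong₂ _+_ (E-const (pow bit r) 1ℚ) (E-neg (pow bit r) _)))

    module _ (b : Pred A Y k) (β : ℚ) where

      restricted : Cylinder A Y k → (El A → El (pow Y k) → ℚ) → ℚ
      restricted C h = E (A ⊗ pow Y k) λ (x , ys) → ⟦ member A Y k C x ys ⟧ * (h x ys * sgn (b x ys))

      -- `K` measures how many cylinder intersections `h` is made of, each having correlation at
      -- most `β` with `b`. Quantifying over all `C` makes the property stable under multiplication
      -- by a bit that some player can compute, since that bit is absorbed into `C`.
      record Bounded (h : El A → El (pow Y k) → ℚ) (K : ℚ) : Set where
        constructor bounded
        field bound : ∀ C → ∣ restricted C h ∣ ≤ K * β
      open Bounded

      Bounded-cong : ∀ {h h′ K} → (∀ x ys → h x ys ≡ h′ x ys) → Bounded h K → Bounded h′ K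
      Bounded-cong h≡h′ h-bounded .bound C = ≡-≤-trans
        (cong ∣_∣ (E-cong (A ⊗ pow Y k) λ (x , ys) →
          cong (λ v → ⟦ member A Y k C x ys ⟧ * (v * sgn (b x ys))) (sym (h≡h′ x ys))))
        (h-bounded .bound C)

      Bounded-1 : (∀ C → ∣ correlation A Y k C b ∣ ≤ β) → Bounded (λ _ _ → 1ℚ) 1ℚ
      Bounded-1 correlation≤β .bound C = begin
        ∣ restricted C (λ _ _ → 1ℚ) ∣   ≡⟨ cong ∣_∣ (E-cong (A ⊗ pow Y k) λ (x , ys) → cong (⟦ member A Y k C x ys ⟧ *_) (*-identityˡ _)) ⟩
        ∣ correlation A Y k C b ∣       ≤⟨ correlation≤β C ⟩
        β                               ≡⟨ sym (*-identityˡ β) ⟩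
        1ℚ * β                          ∎
        where open ≤-Reasoning

      Bounded-+ : ∀ {h h′ K K′} → Bounded h K → Bounded h′ K′ → Bounded (λ x ys → h x ys + h′ x ys) (K + K′)
      Bounded-+ {h} {h′} {K} {K′} h-bounded h′-bounded .bound C = begin
        ∣ restricted C (λ x ys → h x ys + h′ x ys) ∣    ≡⟨ cong ∣_∣ (trans
          (E-cong (A ⊗ pow Y k) λ (x , ys) → distrib ⟦ member A Y k C x ys ⟧ (h x ys) (h′ x ys) (sgn (b x ys)))
          (E-+ (A ⊗ pow Y k) _ _)) ⟩
        ∣ restricted C h + restricted C h′ ∣            ≤⟨ ∣p+q∣≤∣p∣+∣q∣ (restricted C h) _ ⟩
        ∣ restricted C h ∣ + ∣ restricted C h′ ∣        ≤⟨ +-mono-≤ (h-bounded .bound C) (h′-bounded .bound C) ⟩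
        K * β + K′ * β                                  ≡⟨ sym (*-distribʳ-+ β K K′) ⟩
        (K + K′) * β                                    ∎
        where
        open ≤-Reasoning
        distrib : ∀ p q r s → p * ((q + r) * s) ≡ p * (q * s) + p * (r * s)
        distrib = Solver.solve-∀ ℚ-ring

      Bounded-*ˡ : ∀ c {h K} → 0ℚ ≤ c → Bounded h K → Bounded (λ x ys → c * h x ys) (c * K)
      Bounded-*ˡ c {h} {K} 0≤c h-bounded .bound C = begin
        ∣ restricted C (λ x ys → c * h x ys) ∣   ≡⟨ cong ∣_∣ (trans
          (E-cong (A ⊗ pow Y k) λ (x , ys) → regroup ⟦ member A Y k C x ys ⟧ c (h x ys) (sgn (b x ys)))
          (E-*ˡ (A ⊗ pow Y k) c _)) ⟩
        ∣ c * restricted C h ∣                   ≡⟨ trans (∣p*q∣≡∣p∣*∣q∣ c _) (cong (_* ∣ restricted C h ∣) (0≤p⇒∣p∣≡p 0≤c)) ⟩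
        c * ∣ restricted C h ∣                   ≤⟨ *-monoˡ-≤ 0≤c (h-bounded .bound C) ⟩
        c * (K * β)                              ≡⟨ sym (*-assoc c K β) ⟩
        c * K * β                                ∎
        where
        open ≤-Reasoning
        regroup : ∀ p c q s → p * (c * q * s) ≡ c * (p * (q * s))
        regroup = Solver.solve-∀ ℚ-ring

      Bounded-E : ∀ D {h : El D → El A → El (pow Y k) → ℚ} {K} → (∀ ρ → Bounded (h ρ) K) →
                  Bounded (λ x ys → E D λ ρ → h ρ x ys) K
      Bounded-E D {h} {K} h-bounded .bound C = begin
        ∣ restricted C (λ x ys → E D λ ρ → h ρ x ys) ∣   ≡⟨ cong ∣_∣ (trans
          (E-cong (A ⊗ pow Y k) λ (x , ys) → trans
            (cong (⟦ member A Y k C x ys ⟧ *_) (sym (E-*ʳ D (sgn (b x ys)) _)))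
            (sym (E-*ˡ D ⟦ member A Y k C x ys ⟧ _)))
          (E-swap (A ⊗ pow Y k) D _)) ⟩
        ∣ E D (λ ρ → restricted C (h ρ)) ∣               ≤⟨ ∣E∣≤E∣∣ D _ ⟩
        E D (λ ρ → ∣ restricted C (h ρ) ∣)               ≤⟨ E-≤-const D (λ ρ → h-bounded ρ .bound C) ⟩
        K * β                                            ∎
        where open ≤-Reasoning

      Bounded-filter : ∀ i {f h K} → Blind A Y k i f → Bounded h K → Bounded (λ x ys → ⟦ f x ys ⟧ * h x ys) K
      Bounded-filter i {f} {h} blind h-bounded .bound C = ≡-≤-trans
        (cong ∣_∣ (E-cong (A ⊗ pow Y k) λ (x , ys) → trans
          (regroup ⟦ member A Y k C x ys ⟧ ⟦ f x ys ⟧ (h x ys) (sgn (b x ys)))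
          (cong (_* (h x ys * sgn (b x ys))) (sym (⟦member-restrict⟧ A Y k i f C blind x ys)))))
        (h-bounded .bound (restrict A Y k i f C))
        where
        regroup : ∀ p q r s → p * (q * r * s) ≡ q * p * (r * s)
        regroup = Solver.solve-∀ ℚ-ring

      module _ (0≤β : 0ℚ ≤ β) where

        Bounded-weaken : ∀ {h K K′} → K ≤ K′ → Bounded h K → Bounded h K′
        Bounded-weaken K≤K′ h-bounded .bound C = ≤-trans (h-bounded .bound C) (*-monoʳ-≤ 0≤β K≤K′)

        -- A node splits the acceptance indicator into two filtered parts, so each bit of
        -- communication doubles `K`. The extra factor `h` allows several runs to be multiplied.
        Bounded-accepts : ∀ {d} (P : Prot (suc k) n d) {h K} → 0ℚ ≤ K → Bounded h K →
                          Bounded (λ x ys → ⟦ accepts P x ys ⟧ * h x ys) (2ℚ ^ d * K)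
        Bounded-accepts {d} (leaf neg) {h} {K} 0≤K h-bounded = Bounded-weaken
          (≡-≤-trans (sym (*-identityˡ K)) (*-monoʳ-≤ 0≤K (^-lower d (≤ᵇ⇒≤ tt))))
          (Bounded-cong (λ x ys → sym (*-identityˡ (h x ys))) h-bounded)
        Bounded-accepts {d} (leaf pos) {h} {K} 0≤K h-bounded = Bounded-weaken
          (≡-≤-trans (*-zeroˡ K) (*-nonneg (^-nonneg d 0≤2) 0≤K))
          (Bounded-*ˡ 0ℚ ≤-refl h-bounded)
        Bounded-accepts {suc d} (node i f seen P Q) {h} {K} 0≤K h-bounded = subst
          (Bounded _) (double (2ℚ ^ d) K)
          (Bounded-cong (λ x ys → branch (f (input x ys)) (run P (input x ys)) (run Q (input x ys)) (h x ys))
            (Bounded-+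
              (Bounded-filter i (SeenBy⇒Blind seen) (Bounded-accepts P 0≤K h-bounded))
              (Bounded-filter i (SeenBy⇒Blind λ x y x≡y → cong not (seen x y x≡y)) (Bounded-accepts Q 0≤K h-bounded))))
          where
          double : ∀ c K → c * K + c * K ≡ (1ℚ + 1ℚ) * c * K
          double = Solver.solve-∀ ℚ-ring
          branch : ∀ c s t v → ⟦ c ⟧ * (⟦ accepting s ⟧ * v) + ⟦ not c ⟧ * (⟦ accepting t ⟧ * v) ≡
                               ⟦ accepting (if c then s else t) ⟧ * v
          branch true  s t v = simplify ⟦ accepting s ⟧ ⟦ accepting t ⟧ v
            where
            simplify : ∀ p q v → 1ℚ * (p * v) + 0ℚ * (q * v) ≡ p * v
            simplify = Solver.solve-∀ ℚ-ring
          branch false s t v = simplify ⟦ accepting s ⟧ ⟦ accepting t ⟧ v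
            where
            simplify : ∀ p q v → 0ℚ * (p * v) + 1ℚ * (q * v) ≡ q * v
            simplify = Solver.solve-∀ ℚ-ring

        -- The power of a probability is treated as ℓ independent runs. One run is split off at a
        -- time: for fixed coins it is deterministic and multiplies the power that remains, at the
        -- price `3ℚ * 2ℚ ^ c`.
        Bounded-acceptance^ : ∀ {c} (R : RProt (suc k) n c) ℓ → (∀ C → ∣ correlation A Y k C b ∣ ≤ β) →
          Bounded (λ x ys → (3ℚ * acceptance R x ys) ^ ℓ) ((3ℚ * 2ℚ ^ c) ^ ℓ)
        Bounded-acceptance^ R zero small = Bounded-1 small
        Bounded-acceptance^ {c} (r , R) (suc ℓ) small = subst (Bounded _) (sym (*-assoc 3ℚ (2ℚ ^ c) _))
          (Bounded-cong
            (λ x ys → trans (cong (3ℚ *_) (E-*ʳ (pow bit r) ((3ℚ * acceptance (r , R) x ys) ^ ℓ) _)) (sym (*-assoc 3ℚ (acceptance (r , R) x ys) _)))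
            (Bounded-*ˡ 3ℚ 0≤3 (Bounded-E (pow bit r) λ ρ →
              Bounded-accepts (R (toVec r ρ)) (^-nonneg ℓ (*-nonneg 0≤3 (^-nonneg c 0≤2)))
                (Bounded-acceptance^ (r , R) ℓ small))))

-- Binomial sums, finite differences and the nodes.

module AlternatingSums where

  open RationalFacts
  open Expectation
  open import Data.Nat as ℕ using (ℕ; zero; suc)
  import Data.Nat.Properties as ℕ
  open import Data.Nat.Combinatorics using (_C_; nCk+nC[k+1]≡[n+1]C[k+1]; nCk≡nC[n∸k]; nC1≡n)
  open import Data.Product using (∃; _×_; _,_)
  open import Data.Sum using (inj₁; inj₂)
  open import Data.Rational hiding (_≟_)
  open import Data.Rational.Properties hiding (_≟_)
  open import Function using (_∘_)
  open import Relation.Binary.PropositionalEquality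
  import Data.Nat.Solver
  import Tactic.RingSolver as Solver

  -- ∑_{j ≤ N} (N choose j) f j
  binomial-sum : ℕ → (ℕ → ℚ) → ℚ
  binomial-sum zero    f = f 0
  binomial-sum (suc N) f = binomial-sum N f + binomial-sum N (f ∘ suc)

  binomial-sum-mono : ∀ N {f g} → (∀ j → j ℕ.≤ N → f j ≤ g j) → binomial-sum N f ≤ binomial-sum N g
  binomial-sum-mono zero    f≤g = f≤g 0 ℕ.z≤n
  binomial-sum-mono (suc N) f≤g = +-mono-≤
    (binomial-sum-mono N λ j j≤N → f≤g j (ℕ.m≤n⇒m≤1+n j≤N))
    (binomial-sum-mono N λ j j≤N → f≤g (suc j) (ℕ.s≤s j≤N))

  binomial-sum-cong : ∀ N {f g} → (∀ j → f j ≡ g j) → binomial-sum N f ≡ binomial-sum N g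
  binomial-sum-cong zero    f≡g = f≡g 0
  binomial-sum-cong (suc N) f≡g = cong₂ _+_ (binomial-sum-cong N f≡g) (binomial-sum-cong N (f≡g ∘ suc))

  binomial-sum-+ : ∀ N f g → binomial-sum N (λ j → f j + g j) ≡ binomial-sum N f + binomial-sum N g
  binomial-sum-+ zero    f g = refl
  binomial-sum-+ (suc N) f g = trans
    (cong₂ _+_ (binomial-sum-+ N f g) (binomial-sum-+ N (f ∘ suc) (g ∘ suc)))
    (interchange (binomial-sum N f) _ _ _)
    where
    interchange : ∀ p q r s → p + q + (r + s) ≡ p + r + (q + s)
    interchange = Solver.solve-∀ ℚ-ring

  binomial-sum-*ˡ : ∀ N c f → binomial-sum N (λ j → c * f j) ≡ c * binomial-sum N f
  binomial-sum-*ˡ zero    c f = refl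
  binomial-sum-*ˡ (suc N) c f = trans
    (cong₂ _+_ (binomial-sum-*ˡ N c f) (binomial-sum-*ˡ N c (f ∘ suc)))
    (sym (*-distribˡ-+ c _ _))

  binomial-sum-const : ∀ N c → binomial-sum N (λ _ → c) ≡ 2ℚ ^ N * c
  binomial-sum-const zero    c = sym (*-identityˡ c)
  binomial-sum-const (suc N) c = trans (cong₂ _+_ (binomial-sum-const N c) (binomial-sum-const N c)) (double (2ℚ ^ N) c)
    where
    double : ∀ p c → p * c + p * c ≡ (1ℚ + 1ℚ) * p * c
    double = Solver.solve-∀ ℚ-ring

  ∣binomial-sum∣≤ : ∀ N f → ∣ binomial-sum N f ∣ ≤ binomial-sum N (λ j → ∣ f j ∣)
  ∣binomial-sum∣≤ zero    f = ≤-refl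
  ∣binomial-sum∣≤ (suc N) f = ≤-trans (∣p+q∣≤∣p∣+∣q∣ (binomial-sum N f) _)
    (+-mono-≤ (∣binomial-sum∣≤ N f) (∣binomial-sum∣≤ N (f ∘ suc)))

  E-binomial-sum : ∀ N a (f : ℕ → El a → ℚ) →
    binomial-sum N (λ j → E a (f j)) ≡ E a λ x → binomial-sum N λ j → f j x
  E-binomial-sum zero    a f = refl
  E-binomial-sum (suc N) a f = trans
    (cong₂ _+_ (E-binomial-sum N a f) (E-binomial-sum N a (f ∘ suc)))
    (sym (E-+ a _ _))

  [_≡ᵇ_] : ℕ → ℕ → ℚ
  [ j ≡ᵇ d ] = ⟦ j ℕ.≡ᵇ d ⟧

  binomial-sum-δ : ∀ N d → binomial-sum N [_≡ᵇ d ] ≡ fromℕ (N C d)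
  binomial-sum-δ zero    zero    = refl
  binomial-sum-δ zero    (suc d) = refl
  binomial-sum-δ (suc N) zero    =
    cong₂ _+_ (binomial-sum-δ N zero) (trans (binomial-sum-const N 0ℚ) (*-zeroʳ (2ℚ ^ N)))
  binomial-sum-δ (suc N) (suc d) = trans
    (cong₂ _+_ (binomial-sum-δ N (suc d)) (binomial-sum-δ N d))
    (trans (sym (fromℕ-+ (N C suc d) (N C d)))
           (cong fromℕ (trans (ℕ.+-comm (N C suc d) (N C d)) (nCk+nC[k+1]≡[n+1]C[k+1] N d))))

  absorption : ∀ n k → suc k ℕ.* (suc n C suc k) ≡ suc n ℕ.* (n C k)
  absorption n       zero    = begin
    1 ℕ.* (suc n C 1)              ≡⟨ ℕ.*-identityˡ _ ⟩
    suc n C 1                      ≡⟨ nC1≡n (suc n) ⟩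
    suc n                          ≡⟨ sym (ℕ.*-identityʳ (suc n)) ⟩
    suc n ℕ.* (n C 0)              ∎
    where
    open ≡-Reasoning
  absorption zero    (suc k) = ℕ.*-zeroʳ (2 ℕ.+ k)
  absorption (suc n) (suc k) = begin
    (2 ℕ.+ k) ℕ.* (suc (suc n) C suc (suc k))
      ≡⟨ cong ((2 ℕ.+ k) ℕ.*_) (sym (nCk+nC[k+1]≡[n+1]C[k+1] (suc n) (suc k))) ⟩
    (2 ℕ.+ k) ℕ.* (suc n C suc k ℕ.+ suc n C suc (suc k))
      ≡⟨ expand k (suc n C suc k) _ ⟩
    suc n C suc k ℕ.+ suc k ℕ.* (suc n C suc k) ℕ.+ (2 ℕ.+ k) ℕ.* (suc n C suc (suc k))
      ≡⟨ cong₂ (λ p q → suc n C suc k ℕ.+ p ℕ.+ q) (absorption n k) (absorption n (suc k)) ⟩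
    suc n C suc k ℕ.+ suc n ℕ.* (n C k) ℕ.+ suc n ℕ.* (n C suc k)
      ≡⟨ collect (suc n C suc k) (suc n) (n C k) (n C suc k) ⟩
    suc n C suc k ℕ.+ suc n ℕ.* (n C k ℕ.+ n C suc k)
      ≡⟨ cong (λ p → suc n C suc k ℕ.+ suc n ℕ.* p) (nCk+nC[k+1]≡[n+1]C[k+1] n k) ⟩
    (2 ℕ.+ n) ℕ.* (suc n C suc k) ∎
    where
    open ≡-Reasoning
    open Data.Nat.Solver.+-*-Solver
    expand : ∀ k a b → (2 ℕ.+ k) ℕ.* (a ℕ.+ b) ≡ a ℕ.+ suc k ℕ.* a ℕ.+ (2 ℕ.+ k) ℕ.* b
    expand = solve 3 (λ k a b → (con 2 :+ k) :* (a :+ b) := a :+ (con 1 :+ k) :* a :+ (con 2 :+ k) :* b) refl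
    collect : ∀ a n b c → a ℕ.+ n ℕ.* b ℕ.+ n ℕ.* c ≡ a ℕ.+ n ℕ.* (b ℕ.+ c)
    collect = solve 4 (λ a n b c → a :+ n :* b :+ n :* c := a :+ n :* (b :+ c)) refl

  central : ℕ → ℕ
  central d = (d ℕ.+ d) C d

  central-suc : ∀ d → suc d ℕ.* central (suc d) ≡ 2 ℕ.* (suc (d ℕ.+ d) ℕ.* central d)
  central-suc d = begin
    suc d ℕ.* (suc (d ℕ.+ suc d) C suc d)
      ≡⟨ cong (λ m → suc d ℕ.* (suc m C suc d)) (ℕ.+-suc d d) ⟩
    suc d ℕ.* (suc (suc (d ℕ.+ d)) C suc d)
      ≡⟨ cong (suc d ℕ.*_) (sym (nCk+nC[k+1]≡[n+1]C[k+1] (suc (d ℕ.+ d)) d)) ⟩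
    suc d ℕ.* (suc (d ℕ.+ d) C d ℕ.+ suc (d ℕ.+ d) C suc d)
      ≡⟨ cong (λ p → suc d ℕ.* (p ℕ.+ suc (d ℕ.+ d) C suc d)) symmetric ⟩
    suc d ℕ.* (suc (d ℕ.+ d) C suc d ℕ.+ suc (d ℕ.+ d) C suc d)
      ≡⟨ double (suc d) (suc (d ℕ.+ d) C suc d) ⟩
    2 ℕ.* (suc d ℕ.* (suc (d ℕ.+ d) C suc d))
      ≡⟨ cong (2 ℕ.*_) (absorption (d ℕ.+ d) d) ⟩
    2 ℕ.* (suc (d ℕ.+ d) ℕ.* central d) ∎
    where
    open ≡-Reasoning
    open Data.Nat.Solver.+-*-Solver
    double : ∀ a b → a ℕ.* (b ℕ.+ b) ≡ 2 ℕ.* (a ℕ.* b)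
    double = solve 2 (λ a b → a :* (b :+ b) := con 2 :* (a :* b)) refl
    symmetric : suc (d ℕ.+ d) C d ≡ suc (d ℕ.+ d) C suc d
    symmetric = trans (nCk≡nC[n∸k] (ℕ.m≤n⇒m≤1+n (ℕ.m≤m+n d d)))
      (cong (suc (d ℕ.+ d) C_) (trans (cong (ℕ._∸ d) (sym (ℕ.+-suc d d))) (ℕ.m+n∸m≡n d (suc d))))

  -- By `central-suc`, passing from d to d + 1 multiplies `d * central d` by (4d + 2) / d, which is
  -- more than 4.
  central-lower : ∀ d → 4 ℕ.^ suc d ℕ.≤ 2 ℕ.* suc d ℕ.* central (suc d)
  central-lower zero    = ℕ.≤-refl
  central-lower (suc d) = begin
    4 ℕ.* 4 ℕ.^ suc d
      ≤⟨ ℕ.*-monoʳ-≤ 4 (central-lower d) ⟩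
    4 ℕ.* (2 ℕ.* suc d ℕ.* central (suc d))
      ≤⟨ ℕ.m≤m+n _ _ ⟩
    4 ℕ.* (2 ℕ.* suc d ℕ.* central (suc d)) ℕ.+ 4 ℕ.* central (suc d)
      ≡⟨ regroup (suc d) (central (suc d)) ⟩
    2 ℕ.* (2 ℕ.* (suc (suc d ℕ.+ suc d) ℕ.* central (suc d)))
      ≡⟨ cong (2 ℕ.*_) (sym (central-suc (suc d))) ⟩
    2 ℕ.* (suc (suc d) ℕ.* central (suc (suc d)))
      ≡⟨ sym (ℕ.*-assoc 2 (suc (suc d)) (central (suc (suc d)))) ⟩
    2 ℕ.* suc (suc d) ℕ.* central (suc (suc d)) ∎
    where
    open ℕ.≤-Reasoning
    open Data.Nat.Solver.+-*-Solver
    regroup : ∀ d c → 4 ℕ.* (2 ℕ.* d ℕ.* c) ℕ.+ 4 ℕ.* c ≡ 2 ℕ.* (2 ℕ.* (suc (d ℕ.+ d) ℕ.* c))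
    regroup = solve 2 (λ d c → con 4 :* (con 2 :* d :* c) :+ con 4 :* c := con 2 :* (con 2 :* ((con 1 :+ (d :+ d)) :* c))) refl

  Δ : (ℕ → ℚ) → ℕ → ℚ
  Δ f j = f (suc j) - f j

  -- Polynomials of degree < N, as the functions killed by N finite differences.
  Degree< : ℕ → (ℕ → ℚ) → Set
  Degree< zero    f = ∀ j → f j ≡ 0ℚ
  Degree< (suc N) f = Degree< N (Δ f)

  Degree<-cong : ∀ N {f g} → (∀ j → f j ≡ g j) → Degree< N f → Degree< N g
  Degree<-cong zero    f≡g f≡0 j = trans (sym (f≡g j)) (f≡0 j)
  Degree<-cong (suc N) f≡g = Degree<-cong N λ j → cong₂ _-_ (f≡g (suc j)) (f≡g j)

  Degree<-+ : ∀ N {f g} → Degree< N f → Degree< N g → Degree< N (λ j → f j + g j)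
  Degree<-+ zero    f≡0 g≡0 j = cong₂ _+_ (f≡0 j) (g≡0 j)
  Degree<-+ (suc N) {f} {g} Δf Δg = Degree<-cong N
    (λ j → interchange (f (suc j)) (f j) (g (suc j)) (g j)) (Degree<-+ N Δf Δg)
    where
    interchange : ∀ p q r s → (p - q) + (r - s) ≡ (p + r) - (q + s)
    interchange = Solver.solve-∀ ℚ-ring

  Degree<-*ˡ : ∀ N c {f} → Degree< N f → Degree< N (λ j → c * f j)
  Degree<-*ˡ zero    c f≡0 j = trans (cong (c *_) (f≡0 j)) (*-zeroʳ c)
  Degree<-*ˡ (suc N) c {f} Δf = Degree<-cong N (λ j → distrib c (f (suc j)) (f j)) (Degree<-*ˡ N c Δf)
    where
    distrib : ∀ c p q → c * (p - q) ≡ c * p - c * q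
    distrib = Solver.solve-∀ ℚ-ring

  Degree<-suc : ∀ N {f} → Degree< N f → Degree< (suc N) f
  Degree<-suc zero    f≡0 j = cong₂ _-_ (f≡0 (suc j)) (f≡0 j)
  Degree<-suc (suc N) Δf    = Degree<-suc N Δf

  Degree<-weaken : ∀ {M N f} → M ℕ.≤ N → Degree< M f → Degree< N f
  Degree<-weaken {zero} {zero} ℕ.z≤n deg = deg
  Degree<-weaken {zero} {suc N} ℕ.z≤n deg = Degree<-suc N (Degree<-weaken {N = N} ℕ.z≤n deg)
  Degree<-weaken (ℕ.s≤s M≤N) deg = Degree<-weaken M≤N deg

  -- The product rule for differences: `Δ` of `(x + c) f` is `(x + c) Δ f + f + Δ f`, and each
  -- summand obeys the degree bound that is left after one difference.
  Degree<-linear : ∀ N c {f} → Degree< N f → Degree< (suc N) (λ j → (fromℕ j + c) * f j)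
  Degree<-linear zero    c {f} f≡0 = Degree<-suc 0 λ j → trans (cong ((fromℕ j + c) *_) (f≡0 j)) (*-zeroʳ (fromℕ j + c))
  Degree<-linear (suc N) c {f} Δf = Degree<-cong (suc N)
    (λ j → leibniz (fromℕ j) c (f (suc j)) (f j))
    (Degree<-+ (suc N) {λ j → (fromℕ j + c) * Δ f j} {λ j → f j + Δ f j}
      (Degree<-linear N c Δf) (Degree<-+ (suc N) {f} {Δ f} Δf (Degree<-suc N Δf)))
    where
    leibniz : ∀ x c p q → (x + c) * (p - q) + (q + (p - q)) ≡ (1ℚ + x + c) * p - (x + c) * q
    leibniz = Solver.solve-∀ ℚ-ring

  alternating : ℕ → ℚ
  alternating zero    = 1ℚ
  alternating (suc j) = - alternating j

  ∣alternating∣≡1 : ∀ j → ∣ alternating j ∣ ≡ 1ℚ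
  ∣alternating∣≡1 zero    = refl
  ∣alternating∣≡1 (suc j) = trans (∣-p∣≡∣p∣ (alternating j)) (∣alternating∣≡1 j)

  alternating² : ∀ d → alternating d * alternating d ≡ 1ℚ
  alternating² zero    = refl
  alternating² (suc d) = trans (neg² (alternating d)) (alternating² d)
    where
    neg² : ∀ p → - p * - p ≡ p * p
    neg² = Solver.solve-∀ ℚ-ring

  -- Pascal's rule turns the alternating sum of `f` over row N + 1 into minus that of `Δ f` over row
  -- N. After all rows only an N-fold difference remains.
  alternating-sum : ∀ N {f} → Degree< N f → binomial-sum N (λ j → alternating j * f j) ≡ 0ℚ
  alternating-sum zero    {f} f≡0 = trans (*-identityˡ (f 0)) (f≡0 0)
  alternating-sum (suc N) {f} Δf  = begin
    binomial-sum N (λ j → alternating j * f j) + binomial-sum N (λ j → - alternating j * f (suc j))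
      ≡⟨ sym (binomial-sum-+ N _ _) ⟩
    binomial-sum N (λ j → alternating j * f j + - alternating j * f (suc j))
      ≡⟨ binomial-sum-cong N (λ j → difference (alternating j) (f j) (f (suc j))) ⟩
    binomial-sum N (λ j → - 1ℚ * (alternating j * Δ f j))
      ≡⟨ binomial-sum-*ˡ N (- 1ℚ) _ ⟩
    - 1ℚ * binomial-sum N (λ j → alternating j * Δ f j)
      ≡⟨ cong (- 1ℚ *_) (alternating-sum N Δf) ⟩
    0ℚ ∎
    where
    open ≡-Reasoning
    difference : ∀ s p q → s * p + - s * q ≡ - 1ℚ * (s * (q - p))
    difference = Solver.solve-∀ ℚ-ring

  -- The nodes 1 - 2 (j - d)² / d², with δ standing for 1 / d². They are quadratic in j, so the
  -- alternating binomial sum over j ≤ 2d kills their polynomials of degree < d, although the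
  -- single node 1 (at j = d) carries a fraction ≥ 1 / 2d of its total weight.
  module Nodes (d : ℕ) (δ : ℚ) (0≤δ : 0ℚ ≤ δ) (δd²≡1 : δ * fromℕ (d ℕ.* d) ≡ 1ℚ) where

    offset : ℕ → ℚ
    offset j = fromℕ j + - fromℕ d

    height : ℕ → ℚ
    height j = δ * (offset j * offset j)

    node : ℕ → ℚ
    node j = 1ℚ - 2ℚ * height j

    -- The witness is the distance |j - d| as a natural number. Integrality gives the lower bound 1
    -- off the center, which is what separates the other nodes from 1.
    offset² : ∀ j → ∃ λ e → (offset j * offset j ≡ fromℕ (e ℕ.* e)) × (j ℕ.≤ d ℕ.+ d → e ℕ.≤ d) × (j ≢ d → 1 ℕ.≤ e)
    offset² j with ℕ.≤-total d j
    ... | inj₁ d≤j = j ℕ.∸ d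
                   , trans (cong (λ x → x * x) offset≡) (sym (fromℕ-* (j ℕ.∸ d) _))
                   , (λ j≤d+d → ℕ.m≤n+o⇒m∸n≤o j d j≤d+d)
                   , (λ j≢d → ℕ.m<n⇒0<n∸m (ℕ.≤∧≢⇒< d≤j (j≢d ∘ sym)))
      where
      cancel : ∀ p q → p + q + - p ≡ q
      cancel = Solver.solve-∀ ℚ-ring
      offset≡ : offset j ≡ fromℕ (j ℕ.∸ d)
      offset≡ = trans (cong (λ i → fromℕ i + - fromℕ d) (sym (ℕ.m+[n∸m]≡n d≤j)))
        (trans (cong (_+ - fromℕ d) (fromℕ-+ d (j ℕ.∸ d))) (cancel (fromℕ d) _))
    ... | inj₂ j≤d = d ℕ.∸ j
                   , trans (cong (λ x → x * x) offset≡) (trans (neg² (fromℕ (d ℕ.∸ j))) (sym (fromℕ-* (d ℕ.∸ j) _)))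
                   , (λ _ → ℕ.m∸n≤m d j)
                   , (λ j≢d → ℕ.m<n⇒0<n∸m (ℕ.≤∧≢⇒< j≤d j≢d))
      where
      cancel : ∀ p q → p + - (p + q) ≡ - q
      cancel = Solver.solve-∀ ℚ-ring
      neg² : ∀ p → - p * - p ≡ p * p
      neg² = Solver.solve-∀ ℚ-ring
      offset≡ : offset j ≡ - fromℕ (d ℕ.∸ j)
      offset≡ = trans (cong (λ i → fromℕ j + - fromℕ i) (sym (ℕ.m+[n∸m]≡n j≤d)))
        (trans (cong (λ x → fromℕ j + - x) (fromℕ-+ j (d ℕ.∸ j))) (cancel (fromℕ j) _))

    height-nonneg : ∀ j → 0ℚ ≤ height j
    height-nonneg j = *-nonneg 0≤δ (p*p≥0 (offset j))

    height≤1 : ∀ j → j ℕ.≤ d ℕ.+ d → height j ≤ 1ℚ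
    height≤1 j j≤d+d with offset² j
    ... | e , eq , e≤d , _ = ≤-≡-trans
      (*-monoˡ-≤ 0≤δ (≡-≤-trans eq (fromℕ-mono-≤ (ℕ.*-mono-≤ (e≤d j≤d+d) (e≤d j≤d+d))))) δd²≡1

    δ≤height : ∀ j → j ≢ d → δ ≤ height j
    δ≤height j j≢d with offset² j
    ... | e , eq , _ , 1≤e = ≡-≤-trans (sym (*-identityʳ δ))
      (*-monoˡ-≤ 0≤δ (≤-≡-trans (fromℕ-mono-≤ (ℕ.*-mono-≤ (1≤e j≢d) (1≤e j≢d))) (sym eq)))

    node-d : node d ≡ 1ℚ
    node-d = center δ (fromℕ d)
      where
      center : ∀ δ p → 1ℚ - 2ℚ * (δ * ((p + - p) * (p + - p))) ≡ 1ℚ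
      center = Solver.solve-∀ ℚ-ring

    1+node : ∀ j → 1ℚ + node j ≡ 2ℚ * (1ℚ - height j)
    1+node j = expand (height j)
      where
      expand : ∀ h → 1ℚ + (1ℚ - 2ℚ * h) ≡ 2ℚ * (1ℚ - h)
      expand = Solver.solve-∀ ℚ-ring

    1+node-nonneg : ∀ j → j ℕ.≤ d ℕ.+ d → 0ℚ ≤ 1ℚ + node j
    1+node-nonneg j j≤d+d = ≤-≡-trans (*-nonneg 0≤2 (p≤q⇒0≤q-p (height≤1 j j≤d+d))) (sym (1+node j))

    1+node≤ : ∀ j → j ≢ d → 1ℚ + node j ≤ 2ℚ * (1ℚ - δ)
    1+node≤ j j≢d = ≡-≤-trans (1+node j) (*-monoˡ-≤ 0≤2 (+-monoʳ-≤ 1ℚ (neg-antimono-≤ (δ≤height j j≢d))))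

    1-node-nonneg : ∀ j → 0ℚ ≤ 1ℚ - node j
    1-node-nonneg j = ≤-≡-trans (*-nonneg 0≤2 (height-nonneg j)) (expand (height j))
      where
      expand : ∀ h → 2ℚ * h ≡ 1ℚ - (1ℚ - 2ℚ * h)
      expand = Solver.solve-∀ ℚ-ring

    ∣node∣≤1 : ∀ j → j ℕ.≤ d ℕ.+ d → ∣ node j ∣ ≤ 1ℚ
    ∣node∣≤1 j j≤d+d = ∣p∣≤q (0≤q-p⇒p≤q (1-node-nonneg j))
      (0≤q-p⇒p≤q (≤-≡-trans (1+node-nonneg j j≤d+d) (cong (1ℚ +_) (sym (neg-involutive (node j))))))
      where
      neg-involutive : ∀ p → - (- p) ≡ p
      neg-involutive = Solver.solve-∀ ℚ-ring

    -- One more factor `node j` amounts to two multiplications by the linear function `offset j`, so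
    -- it raises the degree by two.
    Degree<-node^ : ∀ s → Degree< (suc (s ℕ.+ s)) (λ j → node j ^ s)
    Degree<-node^ zero    = λ j → +-inverseʳ 1ℚ
    Degree<-node^ (suc s) = subst (λ N → Degree< N (λ j → node j ^ suc s)) (cong (suc ∘ suc) (sym (ℕ.+-suc s s)))
      (Degree<-cong (3 ℕ.+ (s ℕ.+ s)) (λ j → expand δ (offset j) (node j ^ s))
        (Degree<-+ (3 ℕ.+ (s ℕ.+ s)) {λ j → node j ^ s} {λ j → - (2ℚ * δ) * (offset j * (offset j * node j ^ s))}
          (Degree<-weaken {suc (s ℕ.+ s)} {3 ℕ.+ (s ℕ.+ s)} {λ j → node j ^ s} (ℕ.m≤n+m _ 2) (Degree<-node^ s))
          (Degree<-*ˡ (3 ℕ.+ (s ℕ.+ s)) (- (2ℚ * δ)) {λ j → offset j * (offset j * node j ^ s)}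
            (Degree<-linear (2 ℕ.+ (s ℕ.+ s)) (- fromℕ d) {λ j → offset j * node j ^ s}
              (Degree<-linear (suc (s ℕ.+ s)) (- fromℕ d) {λ j → node j ^ s} (Degree<-node^ s))))))
      where
      expand : ∀ δ x p → p + - (2ℚ * δ) * (x * (x * p)) ≡ (1ℚ - 2ℚ * (δ * (x * x))) * p
      expand = Solver.solve-∀ ℚ-ring

-- Riesz products and the dual witness.

module Combination where

  open RationalFacts
  open Expectation
  open Box
  open AlternatingSums
  open import Data.Bool using (Bool; true; false; _∨_; T)
  open import Data.Nat as ℕ using (ℕ; zero; suc)
  import Data.Nat.Properties as ℕ
  open import Data.Product using (_,_)
  open import Data.Rational hiding (_≟_)
  open import Data.Rational.Properties hiding (_≟_)
  open import Data.Unit using (tt)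
  open import Data.Vec using (Vec; []; _∷_)
  open import Function using (_∘_)
  open import Relation.Binary.PropositionalEquality
  open import Relation.Nullary using (yes; no)
  open import Relation.Nullary.Negation using (contradiction)
  import Tactic.RingSolver as Solver

  subset-sum : ∀ m → (Vec Bool m → ℚ) → ℚ
  subset-sum zero    f = f []
  subset-sum (suc m) f = subset-sum m (f ∘ (false ∷_)) + subset-sum m (f ∘ (true ∷_))

  subset-sum-cong : ∀ m {f g} → (∀ S → f S ≡ g S) → subset-sum m f ≡ subset-sum m g
  subset-sum-cong zero    f≡g = f≡g []
  subset-sum-cong (suc m) f≡g = cong₂ _+_ (subset-sum-cong m (f≡g ∘ (false ∷_))) (subset-sum-cong m (f≡g ∘ (true ∷_)))

  subset-sum-mono : ∀ m {f g} → (∀ S → f S ≤ g S) → subset-sum m f ≤ subset-sum m g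
  subset-sum-mono zero    f≤g = f≤g []
  subset-sum-mono (suc m) f≤g = +-mono-≤ (subset-sum-mono m (f≤g ∘ (false ∷_))) (subset-sum-mono m (f≤g ∘ (true ∷_)))

  subset-sum-*ˡ : ∀ m c f → subset-sum m (λ S → c * f S) ≡ c * subset-sum m f
  subset-sum-*ˡ zero    c f = refl
  subset-sum-*ˡ (suc m) c f = trans (cong₂ _+_ (subset-sum-*ˡ m c _) (subset-sum-*ˡ m c _)) (sym (*-distribˡ-+ c _ _))

  ∣subset-sum∣≤ : ∀ m f → ∣ subset-sum m f ∣ ≤ subset-sum m (λ S → ∣ f S ∣)
  ∣subset-sum∣≤ zero    f = ≤-refl
  ∣subset-sum∣≤ (suc m) f = ≤-trans (∣p+q∣≤∣p∣+∣q∣ (subset-sum m (f ∘ (false ∷_))) _)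
    (+-mono-≤ (∣subset-sum∣≤ m _) (∣subset-sum∣≤ m _))

  E-subset-sum : ∀ m a (f : Vec Bool m → El a → ℚ) →
    E a (λ x → subset-sum m λ S → f S x) ≡ subset-sum m λ S → E a (f S)
  E-subset-sum zero    a f = refl
  E-subset-sum (suc m) a f = trans (E-+ a _ _) (cong₂ _+_ (E-subset-sum m a _) (E-subset-sum m a _))

  binomial-subset-sum : ∀ N m (f : ℕ → Vec Bool m → ℚ) →
    binomial-sum N (λ j → subset-sum m (f j)) ≡ subset-sum m λ S → binomial-sum N λ j → f j S
  binomial-subset-sum N zero    f = refl
  binomial-subset-sum N (suc m) f = trans (binomial-sum-+ N _ _)
    (cong₂ _+_ (binomial-subset-sum N m _) (binomial-subset-sum N m _))

  subset-sum-weight : ∀ m c → subset-sum m (λ S → c ^ weight S) ≡ (1ℚ + c) ^ m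
  subset-sum-weight zero    c = refl
  subset-sum-weight (suc m) c = begin
    subset-sum m (λ S → c ^ weight S) + subset-sum m (λ S → c * c ^ weight S)
      ≡⟨ cong (subset-sum m (λ S → c ^ weight S) +_) (subset-sum-*ˡ m c _) ⟩
    subset-sum m (λ S → c ^ weight S) + c * subset-sum m (λ S → c ^ weight S)
      ≡⟨ collect c _ ⟩
    (1ℚ + c) * subset-sum m (λ S → c ^ weight S)
      ≡⟨ cong ((1ℚ + c) *_) (subset-sum-weight m c) ⟩
    (1ℚ + c) ^ suc m ∎
    where
    open ≡-Reasoning
    collect : ∀ c p → p + c * p ≡ (1ℚ + c) * p
    collect = Solver.solve-∀ ℚ-ring

  some : ∀ A Y k → Pred A Y k → ∀ m → Pred (pow A m) (pow Y m) k
  some A Y k b zero    tt       ys = false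
  some A Y k b (suc m) (x , xs) ys = b x (firsts Y (pow Y m) k ys) ∨ some A Y k b m xs (seconds Y (pow Y m) k ys)

  module _ (A Y : Space) (k : ℕ) (b : Pred A Y k) where

    -- For balanced bits and c between -1 and 1, this is the density that makes the bits independent
    -- with `sgn` of mean c. At c = 1 it lives where all bits vanish.
    riesz : ∀ m → ℚ → El (pow A m) → El (pow (pow Y m) k) → ℚ
    riesz zero    c tt       ys = 1ℚ
    riesz (suc m) c (x , xs) ys =
      (1ℚ + c * sgn (b x (firsts Y (pow Y m) k ys))) * riesz m c xs (seconds Y (pow Y m) k ys)

    riesz-expand : ∀ m c xs ys → riesz m c xs ys ≡ subset-sum m λ S → c ^ weight S * sgn (parity A Y k b S xs ys)
    riesz-expand zero    c tt       ys = refl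
    riesz-expand (suc m) c (x , xs) ys = begin
      (1ℚ + c * s) * riesz m c xs zs
        ≡⟨ cong ((1ℚ + c * s) *_) (riesz-expand m c xs zs) ⟩
      (1ℚ + c * s) * Σ
        ≡⟨ expand c s Σ ⟩
      Σ + c * s * Σ
        ≡⟨ cong (Σ +_) (sym (subset-sum-*ˡ m (c * s) _)) ⟩
      Σ + subset-sum m (λ S → c * s * (c ^ weight S * sgn (parity A Y k b S xs zs)))
        ≡⟨ cong (Σ +_) (subset-sum-cong m λ S → trans
             (regroup c s (c ^ weight S) (sgn (parity A Y k b S xs zs)))
             (cong (c ^ suc (weight S) *_) (sym (sgn-xor (b x (firsts Y (pow Y m) k ys)) _)))) ⟩
      subset-sum (suc m) (λ S → c ^ weight S * sgn (parity A Y k b S (x , xs) ys)) ∎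
      where
      open ≡-Reasoning
      zs : El (pow (pow Y m) k)
      zs = seconds Y (pow Y m) k ys
      s : ℚ
      s = sgn (b x (firsts Y (pow Y m) k ys))
      Σ : ℚ
      Σ = subset-sum m λ S → c ^ weight S * sgn (parity A Y k b S xs zs)
      expand : ∀ c s p → (1ℚ + c * s) * p ≡ p + c * s * p
      expand = Solver.solve-∀ ℚ-ring
      regroup : ∀ c s p q → c * s * (p * q) ≡ c * p * (s * q)
      regroup = Solver.solve-∀ ℚ-ring

    riesz-nonneg : ∀ m {c} → 0ℚ ≤ 1ℚ + c → 0ℚ ≤ 1ℚ - c → ∀ xs ys → 0ℚ ≤ riesz m c xs ys
    riesz-nonneg zero    0≤1+c 0≤1-c tt       ys = 0≤1
    riesz-nonneg (suc m) {c} 0≤1+c 0≤1-c (x , xs) ys = *-nonneg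
      (factor (b x (firsts Y (pow Y m) k ys))) (riesz-nonneg m 0≤1+c 0≤1-c xs (seconds Y (pow Y m) k ys))
      where
      minus : ∀ c → 1ℚ - c ≡ 1ℚ + c * - 1ℚ
      minus = Solver.solve-∀ ℚ-ring
      factor : ∀ t → 0ℚ ≤ 1ℚ + c * sgn t
      factor true  = ≤-≡-trans 0≤1-c (minus c)
      factor false = ≤-≡-trans 0≤1+c (cong (1ℚ +_) (sym (*-identityʳ c)))

    E-riesz : (∀ ys → E A (λ x → sgn (b x ys)) ≡ 0ℚ) → ∀ m c ys → E (pow A m) (λ xs → riesz m c xs ys) ≡ 1ℚ
    E-riesz balanced zero    c ys = refl
    E-riesz balanced (suc m) c ys = begin
      (E A λ x → E (pow A m) λ xs → (1ℚ + c * sgn (b x us)) * riesz m c xs zs)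
        ≡⟨ E-product A (pow A m) (λ x → 1ℚ + c * sgn (b x us)) (λ xs → riesz m c xs zs) ⟩
      E A (λ x → 1ℚ + c * sgn (b x us)) * E (pow A m) (λ xs → riesz m c xs zs)
        ≡⟨ cong₂ _*_ (trans (E-+ A _ _) (cong₂ _+_ (E-const A 1ℚ) (trans (E-*ˡ A c _) (cong (c *_) (balanced us))))) (E-riesz balanced m c zs) ⟩
      (1ℚ + c * 0ℚ) * 1ℚ
        ≡⟨ simplify c ⟩
      1ℚ ∎
      where
      open ≡-Reasoning
      us : El (pow Y k)
      us = firsts Y (pow Y m) k ys
      zs : El (pow (pow Y m) k)
      zs = seconds Y (pow Y m) k ys
      simplify : ∀ c → (1ℚ + c * 0ℚ) * 1ℚ ≡ 1ℚ
      simplify = Solver.solve-∀ ℚ-ring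

    riesz-none : ∀ m c xs ys → some A Y k b m xs ys ≡ false → riesz m c xs ys ≡ (1ℚ + c) ^ m
    riesz-none zero    c tt       ys none = refl
    riesz-none (suc m) c (x , xs) ys none with b x (firsts Y (pow Y m) k ys)
    ... | false = cong₂ (λ p q → (1ℚ + p) * q) (*-identityʳ c) (riesz-none m c xs _ none)

    riesz-some : ∀ m xs ys → some A Y k b m xs ys ≡ true → riesz m 1ℚ xs ys ≡ 0ℚ
    riesz-some (suc m) (x , xs) ys hit with b x (firsts Y (pow Y m) k ys)
    ... | true  = *-zeroˡ (riesz m 1ℚ xs (seconds Y (pow Y m) k ys))
    ... | false = trans (cong (2ℚ *_) (riesz-some m xs _ hit)) (*-zeroʳ 2ℚ)

    module _ (d m : ℕ) (δ : ℚ) (0≤δ : 0ℚ ≤ δ) (δ≤1 : δ ≤ 1ℚ) (δd²≡1 : δ * fromℕ (d ℕ.* d) ≡ 1ℚ)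
             (β : ℚ) (0≤β : 0ℚ ≤ β) (K : ℚ) (0≤K : 0ℚ ≤ K)
             (h : El (pow A m) → El (pow (pow Y m) k) → ℚ) where

      open Nodes d δ 0≤δ δd²≡1

      N : ℕ
      N = d ℕ.+ d

      Ω : Space
      Ω = pow A m ⊗ pow (pow Y m) k

      -- The factor `alternating d` normalizes the sign at the central node `d` to +1.
      sign : ℕ → ℚ
      sign j = alternating d * alternating j

      ∣sign∣≡1 : ∀ j → ∣ sign j ∣ ≡ 1ℚ
      ∣sign∣≡1 j = trans (∣p*q∣≡∣p∣*∣q∣ (alternating d) _) (cong₂ _*_ (∣alternating∣≡1 d) (∣alternating∣≡1 j))

      -sign≤1 : ∀ j → - 1ℚ ≤ sign j
      -sign≤1 j = ≡-≤-trans (cong -_ (sym (∣sign∣≡1 j))) (≤-≡-trans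
        (neg-antimono-≤ (≤-≡-trans (p≤∣p∣ (- sign j)) (∣-p∣≡∣p∣ (sign j)))) (neg-involutive (sign j)))
        where
        neg-involutive : ∀ p → - (- p) ≡ p
        neg-involutive = Solver.solve-∀ ℚ-ring

      M : ℕ → El (pow A m) → El (pow (pow Y m) k) → ℚ
      M j = riesz m (node j)

      M-nonneg : ∀ j → j ℕ.≤ N → ∀ xs ys → 0ℚ ≤ M j xs ys
      M-nonneg j j≤N = riesz-nonneg m (1+node-nonneg j j≤N) (1-node-nonneg j)

      -- The dual witness: orthogonal to every parity of fewer than d blocks.
      Ψ : El (pow A m) → El (pow (pow Y m) k) → ℚ
      Ψ xs ys = binomial-sum N λ j → sign j * M j xs ys

      -- The coefficient in `Ψ` of every parity of `w` blocks, because a Riesz product has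
      -- coefficients `c ^ w`.
      moment : ℕ → ℚ
      moment w = binomial-sum N λ j → sign j * node j ^ w

      -- `node j ^ w` has degree 2w in j, below the number N = 2d of differences that the
      -- alternating sum takes.
      moment-small : ∀ w → w ℕ.< d → moment w ≡ 0ℚ
      moment-small w w<d = begin
        moment w                                                              ≡⟨ binomial-sum-cong N (λ j → *-assoc (alternating d) _ _) ⟩
        binomial-sum N (λ j → alternating d * (alternating j * node j ^ w))   ≡⟨ binomial-sum-*ˡ N (alternating d) _ ⟩
        alternating d * binomial-sum N (λ j → alternating j * node j ^ w)     ≡⟨ cong (alternating d *_) (alternating-sum N
                                                                                   (Degree<-weaken {suc (w ℕ.+ w)} {N} {λ j → node j ^ w} (ℕ.+-mono-≤ w<d (ℕ.<⇒≤ w<d)) (Degree<-node^ w))) ⟩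
        alternating d * 0ℚ                                                    ≡⟨ *-zeroʳ (alternating d) ⟩
        0ℚ                                                                    ∎
        where open ≡-Reasoning

      ∣^∣ : ∀ p w → ∣ p ^ w ∣ ≡ ∣ p ∣ ^ w
      ∣^∣ p zero    = refl
      ∣^∣ p (suc w) = trans (∣p*q∣≡∣p∣*∣q∣ p _) (cong (∣ p ∣ *_) (∣^∣ p w))

      ∣moment∣≤ : ∀ w → ∣ moment w ∣ ≤ 2ℚ ^ N
      ∣moment∣≤ w = begin
        ∣ moment w ∣                                        ≤⟨ ∣binomial-sum∣≤ N _ ⟩
        binomial-sum N (λ j → ∣ sign j * node j ^ w ∣)      ≤⟨ binomial-sum-mono N (λ j j≤N → ≡-≤-trans
                                                                 (trans (∣p*q∣≡∣p∣*∣q∣ (sign j) _) (trans (cong₂ _*_ (∣sign∣≡1 j) (∣^∣ (node j) w)) (*-identityˡ _)))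
                                                                 (^-upper w (0≤∣p∣ (node j)) (∣node∣≤1 j j≤N))) ⟩
        binomial-sum N (λ _ → 1ℚ)                           ≡⟨ trans (binomial-sum-const N 1ℚ) (*-identityʳ _) ⟩
        2ℚ ^ N                                              ∎
        where open ≤-Reasoning

      -- Half of each factor `β` is given up: since only w ≥ d survives, `½ ^ w` yields the gain
      -- `½ ^ d`, and the powers of `2ℚ * β` left over are still summable over all subsets.
      moment-β : ∀ w → ∣ moment w ∣ * β ^ w ≤ 2ℚ ^ N * ½ ^ d * (2ℚ * β) ^ w
      moment-β w with w ℕ.<? d
      ... | yes w<d = ≡-≤-trans
        (trans (cong (λ q → ∣ q ∣ * β ^ w) (moment-small w w<d)) (*-zeroˡ (β ^ w)))
        (*-nonneg (*-nonneg (^-nonneg N 0≤2) (^-nonneg d 0≤½)) (^-nonneg w (*-nonneg 0≤2 0≤β)))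
      ... | no w≮d = begin
        ∣ moment w ∣ * β ^ w                    ≤⟨ *-monoʳ-≤ (^-nonneg w 0≤β) (∣moment∣≤ w) ⟩
        2ℚ ^ N * β ^ w                          ≡⟨ cong (λ q → 2ℚ ^ N * q ^ w) (halve β) ⟩
        2ℚ ^ N * (½ * (2ℚ * β)) ^ w             ≡⟨ cong (2ℚ ^ N *_) (^-distrib-* ½ (2ℚ * β) w) ⟩
        2ℚ ^ N * (½ ^ w * (2ℚ * β) ^ w)         ≤⟨ *-monoˡ-≤ (^-nonneg N 0≤2) (*-monoʳ-≤ (^-nonneg w (*-nonneg 0≤2 0≤β)) (½^-antimono (ℕ.≮⇒≥ w≮d))) ⟩
        2ℚ ^ N * (½ ^ d * (2ℚ * β) ^ w)         ≡⟨ sym (*-assoc (2ℚ ^ N) _ _) ⟩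
        2ℚ ^ N * ½ ^ d * (2ℚ * β) ^ w           ∎
        where
        open ≤-Reasoning
        halve : ∀ β → β ≡ ½ * (2ℚ * β)
        halve = Solver.solve-∀ ℚ-ring

      a : Vec Bool m → ℚ
      a S = E Ω λ (xs , ys) → h xs ys * sgn (parity A Y k b S xs ys)

      total : ℚ
      total = E Ω λ (xs , ys) → h xs ys * Ψ xs ys

      total≡ : total ≡ subset-sum m λ S → moment (weight S) * a S
      total≡ = begin
        E Ω (λ (xs , ys) → h xs ys * Ψ xs ys)
          ≡⟨ E-cong Ω (λ (xs , ys) → trans
               (sym (binomial-sum-*ˡ N (h xs ys) _))
               (binomial-sum-cong N λ j → trans (left-comm (h xs ys) (sign j) _) (cong (λ q → sign j * (h xs ys * q)) (riesz-expand m (node j) xs ys)))) ⟩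
        E Ω (λ (xs , ys) → binomial-sum N λ j → sign j * (h xs ys * subset-sum m (term j xs ys)))
          ≡⟨ sym (E-binomial-sum N Ω _) ⟩
        binomial-sum N (λ j → E Ω λ (xs , ys) → sign j * (h xs ys * subset-sum m (term j xs ys)))
          ≡⟨ binomial-sum-cong N (λ j → trans
               (E-cong Ω λ (xs , ys) → trans
                 (cong (sign j *_) (sym (subset-sum-*ˡ m (h xs ys) _)))
                 (trans (sym (subset-sum-*ˡ m (sign j) _))
                        (subset-sum-cong m λ S → regroup (sign j) (h xs ys) (node j ^ weight S) _)))
               (trans (E-subset-sum m Ω _) (subset-sum-cong m λ S → E-*ˡ Ω (sign j * node j ^ weight S) _))) ⟩
        binomial-sum N (λ j → subset-sum m λ S → sign j * node j ^ weight S * a S)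
          ≡⟨ binomial-subset-sum N m _ ⟩
        subset-sum m (λ S → binomial-sum N λ j → sign j * node j ^ weight S * a S)
          ≡⟨ subset-sum-cong m (λ S → trans
               (trans (binomial-sum-cong N λ j → *-comm _ (a S)) (binomial-sum-*ˡ N (a S) _))
               (*-comm (a S) _)) ⟩
        subset-sum m (λ S → moment (weight S) * a S) ∎
        where
        open ≡-Reasoning
        term : ℕ → El (pow A m) → El (pow (pow Y m) k) → Vec Bool m → ℚ
        term j xs ys S = node j ^ weight S * sgn (parity A Y k b S xs ys)
        left-comm : ∀ p q r → p * (q * r) ≡ q * (p * r)
        left-comm = Solver.solve-∀ ℚ-ring
        regroup : ∀ s h c g → s * (h * (c * g)) ≡ s * c * (h * g)
        regroup = Solver.solve-∀ ℚ-ring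

      -- All 2^m parities are summed without regard to cancellation. Weighted by
      -- `(2ℚ * β) ^ weight S` they add up to `(1ℚ + 2ℚ * β) ^ m`, which costs a mere factor 2.
      total-upper : (∀ S → ∣ a S ∣ ≤ K * β ^ weight S) → (1ℚ + 2ℚ * β) ^ m ≤ 2ℚ →
                    total ≤ 2ℚ ^ N * ½ ^ d * K * 2ℚ
      total-upper a-small 1+2β≤2 = begin
        total                                                           ≤⟨ p≤∣p∣ total ⟩
        ∣ total ∣                                                       ≡⟨ cong ∣_∣ total≡ ⟩
        ∣ subset-sum m (λ S → moment (weight S) * a S) ∣                ≤⟨ ∣subset-sum∣≤ m _ ⟩
        subset-sum m (λ S → ∣ moment (weight S) * a S ∣)                ≤⟨ subset-sum-mono m bound ⟩
        subset-sum m (λ S → R * (2ℚ * β) ^ weight S)                    ≡⟨ trans (subset-sum-*ˡ m R _) (cong (R *_) (subset-sum-weight m (2ℚ * β))) ⟩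
        R * (1ℚ + 2ℚ * β) ^ m                                           ≤⟨ *-monoˡ-≤ (*-nonneg (*-nonneg (^-nonneg N 0≤2) (^-nonneg d 0≤½)) 0≤K) 1+2β≤2 ⟩
        R * 2ℚ                                                          ∎
        where
        open ≤-Reasoning
        R : ℚ
        R = 2ℚ ^ N * ½ ^ d * K
        swap : ∀ p q r → p * (q * r) ≡ p * r * q
        swap = Solver.solve-∀ ℚ-ring
        bound : ∀ S → ∣ moment (weight S) * a S ∣ ≤ R * (2ℚ * β) ^ weight S
        bound S = begin
          ∣ moment w * a S ∣                              ≡⟨ ∣p*q∣≡∣p∣*∣q∣ (moment w) (a S) ⟩
          ∣ moment w ∣ * ∣ a S ∣                          ≤⟨ *-monoˡ-≤ (0≤∣p∣ (moment w)) (a-small S) ⟩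
          ∣ moment w ∣ * (K * β ^ w)                      ≡⟨ swap (∣ moment w ∣) K (β ^ w) ⟩
          ∣ moment w ∣ * β ^ w * K                        ≤⟨ *-monoʳ-≤ 0≤K (moment-β w) ⟩
          2ℚ ^ N * ½ ^ d * (2ℚ * β) ^ w * K               ≡⟨ regroup (2ℚ ^ N * ½ ^ d) ((2ℚ * β) ^ w) K ⟩
          R * (2ℚ * β) ^ w                                ∎
          where
          w : ℕ
          w = weight S
          regroup : ∀ p q r → p * q * r ≡ p * r * q
          regroup = Solver.solve-∀ ℚ-ring

      C : ℚ
      C = fromℕ (central d)

      module _ (τ : ℚ) (0≤τ : 0ℚ ≤ τ) (0≤gap : 0ℚ ≤ C - 2ℚ ^ N * (1ℚ - δ) ^ m)
               (0≤h : ∀ xs ys → 0ℚ ≤ h xs ys)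
               (h-none : ∀ xs ys → some A Y k b m xs ys ≡ false → τ ≤ h xs ys)
               (h-some : ∀ xs ys → some A Y k b m xs ys ≡ true → h xs ys ≤ 1ℚ)
               (balanced : ∀ ys → E A (λ x → sgn (b x ys)) ≡ 0ℚ) where

        gap : ℚ
        gap = C - 2ℚ ^ N * (1ℚ - δ) ^ m

        0≤1-δ : 0ℚ ≤ 1ℚ - δ
        0≤1-δ = p≤q⇒0≤q-p δ≤1

        M-sum : El (pow A m) → El (pow (pow Y m) k) → ℚ
        M-sum xs ys = binomial-sum N λ j → M j xs ys

        M-sum-nonneg : ∀ xs ys → 0ℚ ≤ M-sum xs ys
        M-sum-nonneg xs ys = ≡-≤-trans (sym (trans (binomial-sum-const N 0ℚ) (*-zeroʳ (2ℚ ^ N))))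
          (binomial-sum-mono N λ j j≤N → M-nonneg j j≤N xs ys)

        -- Where all bits vanish, `M j` equals `(1ℚ + node j) ^ m`, largest at the node 1. Every
        -- other node is smaller by a factor `(1ℚ - δ) ^ m`, so its sign does not matter and the
        -- central binomial coefficient prevails.
        Ψ-none : ∀ xs ys → some A Y k b m xs ys ≡ false → gap * M d xs ys ≤ Ψ xs ys
        Ψ-none xs ys none = begin
          gap * M d xs ys
            ≡⟨ expand C (2ℚ ^ N) ((1ℚ - δ) ^ m) (M d xs ys) ⟩
          M d xs ys * C + 2ℚ ^ N * - ((1ℚ - δ) ^ m * M d xs ys)
            ≡⟨ sym (cong₂ _+_ (trans (binomial-sum-*ˡ N (M d xs ys) _) (cong (M d xs ys *_) (binomial-sum-δ N d))) (binomial-sum-const N _)) ⟩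
          binomial-sum N (λ j → M d xs ys * [ j ≡ᵇ d ]) + binomial-sum N (λ _ → - ((1ℚ - δ) ^ m * M d xs ys))
            ≡⟨ sym (binomial-sum-+ N _ _) ⟩
          binomial-sum N (λ j → M d xs ys * [ j ≡ᵇ d ] + - ((1ℚ - δ) ^ m * M d xs ys))
            ≤⟨ binomial-sum-mono N pointwise ⟩
          Ψ xs ys ∎
          where
          open ≤-Reasoning
          expand : ∀ c p q r → (c - p * q) * r ≡ r * c + p * - (q * r)
          expand = Solver.solve-∀ ℚ-ring
          M≤ : ∀ j → j ℕ.≤ N → j ≢ d → M j xs ys ≤ (1ℚ - δ) ^ m * M d xs ys
          M≤ j j≤N j≢d = begin
            M j xs ys                       ≡⟨ riesz-none m (node j) xs ys none ⟩
            (1ℚ + node j) ^ m               ≤⟨ ^-monoˡ-≤ m (1+node-nonneg j j≤N) (1+node≤ j j≢d) ⟩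
            (2ℚ * (1ℚ - δ)) ^ m             ≡⟨ cong (_^ m) (*-comm 2ℚ (1ℚ - δ)) ⟩
            ((1ℚ - δ) * 2ℚ) ^ m             ≡⟨ ^-distrib-* (1ℚ - δ) 2ℚ m ⟩
            (1ℚ - δ) ^ m * 2ℚ ^ m           ≡⟨ cong (λ c → (1ℚ - δ) ^ m * (1ℚ + c) ^ m) (sym node-d) ⟩
            (1ℚ - δ) ^ m * (1ℚ + node d) ^ m ≡⟨ cong ((1ℚ - δ) ^ m *_) (sym (riesz-none m (node d) xs ys none)) ⟩
            (1ℚ - δ) ^ m * M d xs ys        ∎
          d≤N : d ℕ.≤ N
          d≤N = ℕ.m≤m+n d d
          at-d : ∀ j → (j ℕ.≡ᵇ d) ≡ true → j ≡ d
          at-d j eq = ℕ.≡ᵇ⇒≡ j d (subst T (sym eq) tt)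
          off-d : ∀ j → (j ℕ.≡ᵇ d) ≡ false → j ≢ d
          off-d j eq refl = contradiction (trans (sym eq) (≡ᵇ-refl j)) λ ()
            where
            ≡ᵇ-refl : ∀ n → (n ℕ.≡ᵇ n) ≡ true
            ≡ᵇ-refl zero    = refl
            ≡ᵇ-refl (suc n) = ≡ᵇ-refl n
          pointwise : ∀ j → j ℕ.≤ N → M d xs ys * [ j ≡ᵇ d ] + - ((1ℚ - δ) ^ m * M d xs ys) ≤ sign j * M j xs ys
          pointwise j j≤N with j ℕ.≡ᵇ d in eq
          ... | true with refl ← at-d j eq = begin
            M d xs ys * 1ℚ + - ((1ℚ - δ) ^ m * M d xs ys)   ≤⟨ +-monoʳ-≤ (M d xs ys * 1ℚ) (neg-antimono-≤ (*-nonneg (^-nonneg m 0≤1-δ) (M-nonneg d d≤N xs ys))) ⟩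
            M d xs ys * 1ℚ + - 0ℚ                           ≡⟨ simplify (M d xs ys) ⟩
            1ℚ * M d xs ys                                  ≡⟨ cong (_* M d xs ys) (sym (alternating² d)) ⟩
            sign d * M d xs ys                              ∎
            where
            simplify : ∀ p → p * 1ℚ + - 0ℚ ≡ 1ℚ * p
            simplify = Solver.solve-∀ ℚ-ring
          ... | false = begin
            M d xs ys * 0ℚ + - ((1ℚ - δ) ^ m * M d xs ys)   ≡⟨ simplify (M d xs ys) _ ⟩
            - ((1ℚ - δ) ^ m * M d xs ys)                    ≤⟨ neg-antimono-≤ (M≤ j j≤N (off-d j eq)) ⟩
            - M j xs ys                                     ≡⟨ minus (M j xs ys) ⟩
            - 1ℚ * M j xs ys                                ≤⟨ *-monoʳ-≤ (M-nonneg j j≤N xs ys) (-sign≤1 j) ⟩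
            sign j * M j xs ys                              ∎
            where
            simplify : ∀ p q → p * 0ℚ + - q ≡ - q
            simplify = Solver.solve-∀ ℚ-ring
            minus : ∀ p → - p ≡ - 1ℚ * p
            minus = Solver.solve-∀ ℚ-ring

        Ψ-lower : ∀ xs ys → - M-sum xs ys ≤ Ψ xs ys
        Ψ-lower xs ys = begin
          - M-sum xs ys                                  ≡⟨ minus (M-sum xs ys) ⟩
          - 1ℚ * M-sum xs ys                             ≡⟨ sym (binomial-sum-*ˡ N (- 1ℚ) _) ⟩
          binomial-sum N (λ j → - 1ℚ * M j xs ys)        ≤⟨ binomial-sum-mono N (λ j j≤N → *-monoʳ-≤ (M-nonneg j j≤N xs ys) (-sign≤1 j)) ⟩
          Ψ xs ys                                        ∎
          where
          open ≤-Reasoning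
          minus : ∀ p → - p ≡ - 1ℚ * p
          minus = Solver.solve-∀ ℚ-ring

        -- One inequality covers both sides. Without a hit the term `- M-sum` is only a loss and the
        -- amplification `τ` acts on the central Riesz product; with a hit that product vanishes and
        -- `h ≤ 1` limits the damage to `M-sum`.
        pointwise-lower : ∀ xs ys → τ * gap * M d xs ys - M-sum xs ys ≤ h xs ys * Ψ xs ys
        pointwise-lower xs ys with some A Y k b m xs ys in eq
        ... | false = begin
          τ * gap * M d xs ys - M-sum xs ys      ≤⟨ +-monoʳ-≤ (τ * gap * M d xs ys) (neg-antimono-≤ (M-sum-nonneg xs ys)) ⟩
          τ * gap * M d xs ys - 0ℚ               ≡⟨ simplify τ gap (M d xs ys) ⟩
          τ * (gap * M d xs ys)                  ≤⟨ *-mono-≤ (0≤h xs ys) 0≤gapM (h-none xs ys eq) (Ψ-none xs ys eq) ⟩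
          h xs ys * Ψ xs ys                      ∎
          where
          open ≤-Reasoning
          0≤gapM : 0ℚ ≤ gap * M d xs ys
          0≤gapM = *-nonneg 0≤gap (M-nonneg d (ℕ.m≤m+n d d) xs ys)
          simplify : ∀ p q r → p * q * r - 0ℚ ≡ p * (q * r)
          simplify = Solver.solve-∀ ℚ-ring
        ... | true = begin
          τ * gap * M d xs ys - M-sum xs ys      ≡⟨ cong (λ q → τ * gap * q - M-sum xs ys) M-d≡0 ⟩
          τ * gap * 0ℚ - M-sum xs ys             ≡⟨ simplify (τ * gap) (M-sum xs ys) ⟩
          - (1ℚ * M-sum xs ys)                   ≤⟨ neg-antimono-≤ (*-monoʳ-≤ (M-sum-nonneg xs ys) (h-some xs ys eq)) ⟩
          - (h xs ys * M-sum xs ys)              ≡⟨ neg-distribʳ-* (h xs ys) (M-sum xs ys) ⟩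
          h xs ys * - M-sum xs ys                ≤⟨ *-monoˡ-≤ (0≤h xs ys) (Ψ-lower xs ys) ⟩
          h xs ys * Ψ xs ys                      ∎
          where
          open ≤-Reasoning
          M-d≡0 : M d xs ys ≡ 0ℚ
          M-d≡0 = trans (cong (λ c → riesz m c xs ys) node-d) (riesz-some m xs ys eq)
          simplify : ∀ p q → p * 0ℚ - q ≡ - (1ℚ * q)
          simplify = Solver.solve-∀ ℚ-ring

        E-M : ∀ j → E Ω (λ (xs , ys) → M j xs ys) ≡ 1ℚ
        E-M j = trans (E-swap (pow A m) (pow (pow Y m) k) _)
          (trans (E-cong (pow (pow Y m) k) λ ys → E-riesz balanced m (node j) ys) (E-const (pow (pow Y m) k) 1ℚ))

        -- Each Riesz product has mean 1, so the central one retains its coefficient, and the damage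
        -- `M-sum` averages to the number 2^N of terms counted with multiplicity.
        total-lower : τ * gap - 2ℚ ^ N ≤ total
        total-lower = begin
          τ * gap - 2ℚ ^ N                                                  ≡⟨ sym (cong₂ _-_ (*-identityʳ (τ * gap)) E-M-sum) ⟩
          τ * gap * 1ℚ - E Ω (λ (xs , ys) → M-sum xs ys)                    ≡⟨ cong₂ _+_ (cong (τ * gap *_) (sym (E-M d))) (sym (E-neg Ω _)) ⟩
          τ * gap * E Ω (λ (xs , ys) → M d xs ys) + E Ω (λ (xs , ys) → - M-sum xs ys)
            ≡⟨ cong (_+ E Ω (λ (xs , ys) → - M-sum xs ys)) (sym (E-*ˡ Ω (τ * gap) _)) ⟩
          E Ω (λ (xs , ys) → τ * gap * M d xs ys) + E Ω (λ (xs , ys) → - M-sum xs ys)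
            ≡⟨ sym (E-+ Ω _ _) ⟩
          E Ω (λ (xs , ys) → τ * gap * M d xs ys - M-sum xs ys)             ≤⟨ E-mono Ω (λ (xs , ys) → pointwise-lower xs ys) ⟩
          total                                                             ∎
          where
          open ≤-Reasoning
          E-M-sum : E Ω (λ (xs , ys) → M-sum xs ys) ≡ 2ℚ ^ N
          E-M-sum = trans (sym (E-binomial-sum N Ω _)) (trans (binomial-sum-cong N E-M) (trans (binomial-sum-const N 1ℚ) (*-identityʳ _)))

-- Bit-string inputs, the function F and its nondeterministic protocol.

module Encoding where

  open import Defs
  open Expectation
  open Box using (Pred; firsts; seconds)
  open RandomSelection
  open Protocols using (nth; toVec; fromVec)
  open Combination using (some)
  open import Data.Bool using (Bool; true; false; if_then_else_; T)
  open import Data.Empty using (⊥-elim)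
  open import Data.Fin using (Fin; zero; suc; combine)
  open import Data.Fin.Properties using (combine-surjective)
  open import Data.Nat using (ℕ; zero; suc; _+_; _∸_; _*_; _^_; _≤_; _<_; _<ᵇ_; s≤s; z≤n)
  open import Data.Nat.Properties hiding (_≟_)
  open import Data.Product using (Σ; ∃; _,_; proj₁; proj₂)
  open import Data.Unit using (tt)
  open import Data.Vec using (Vec; []; _∷_; _++_; take; drop)
  open import Data.Vec.Properties using (++-injective; take++drop≡id)
  open import Function using (_∘_)
  open import Relation.Binary.PropositionalEquality
  open import Relation.Nullary using (does; yes; no)
  open import Relation.Nullary.Decidable using (dec-true)
  open import Relation.Nullary.Negation using (contradiction)

  -- Infinite streams make decoding total: surplus bits are ignored and missing ones read as
  -- `false`. Only the round trip `decode-encode` needs enough length.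
  fromStream : ∀ a → (ℕ → Bool) → El a
  fromStream unit    s = tt
  fromStream bit     s = s 0
  fromStream (a ⊗ b) s = fromStream a s , fromStream b (s ∘ (size a +_))

  toStream : ∀ a → El a → ℕ → Bool
  toStream unit    x       i = false
  toStream bit     x       i = x
  toStream (a ⊗ b) (x , y) i = if i <ᵇ size a then toStream a x i else toStream b y (i ∸ size a)

  fromStream-cong : ∀ a {s t} → (∀ i → i < size a → s i ≡ t i) → fromStream a s ≡ fromStream a t
  fromStream-cong unit    s≡t = refl
  fromStream-cong bit     s≡t = s≡t 0 (s≤s z≤n)
  fromStream-cong (a ⊗ b) s≡t = cong₂ _,_
    (fromStream-cong a λ i i<a → s≡t i (≤-trans i<a (m≤m+n (size a) (size b))))
    (fromStream-cong b λ i i<b → s≡t (size a + i) (+-monoʳ-< (size a) i<b))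

  fromStream-toStream : ∀ a x → fromStream a (toStream a x) ≡ x
  fromStream-toStream unit    x       = refl
  fromStream-toStream bit     x       = refl
  fromStream-toStream (a ⊗ b) (x , y) = cong₂ _,_
    (trans (fromStream-cong a λ i → left i) (fromStream-toStream a x))
    (trans (fromStream-cong b λ i _ → right i) (fromStream-toStream b y))
    where
    left : ∀ i → i < size a → toStream (a ⊗ b) (x , y) i ≡ toStream a x i
    left i i<a with i <ᵇ size a in eq
    ... | true  = refl
    ... | false = ⊥-elim (subst T eq (<⇒<ᵇ i<a))
    right : ∀ i → toStream (a ⊗ b) (x , y) (size a + i) ≡ toStream b y i
    right i with (size a + i) <ᵇ size a in eq
    ... | true  = contradiction (<ᵇ⇒< (size a + i) (size a) (subst T (sym eq) tt)) (m+n≮m (size a) i)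
    ... | false = cong (toStream b y) (m+n∸m≡n (size a) i)

  prefix : ∀ n → (ℕ → Bool) → Vec Bool n
  prefix zero    s = []
  prefix (suc n) s = s 0 ∷ prefix n (s ∘ suc)

  -- Padded with false beyond the end of the vector.
  stream : ∀ {n} → Vec Bool n → ℕ → Bool
  stream []      i       = false
  stream (b ∷ v) zero    = b
  stream (b ∷ v) (suc i) = stream v i

  stream-prefix : ∀ n s i → i < n → stream (prefix n s) i ≡ s i
  stream-prefix (suc n) s zero    _         = refl
  stream-prefix (suc n) s (suc i) (s≤s i<n) = stream-prefix n (s ∘ suc) i i<n

  encode : ∀ a n → El a → Vec Bool n
  encode a n x = prefix n (toStream a x)

  decode : ∀ a {n} → Vec Bool n → El a
  decode a v = fromStream a (stream v)

  decode-encode : ∀ a {n} → size a ≤ n → ∀ x → decode a (encode a n x) ≡ x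
  decode-encode a {n} a≤n x = trans
    (fromStream-cong a λ i i<a → stream-prefix n (toStream a x) i (≤-trans i<a a≤n))
    (fromStream-toStream a x)

  decodes : ∀ a {n} k → (Fin k → Vec Bool n) → El (pow a k)
  decodes a zero    vs = tt
  decodes a (suc k) vs = decode a (vs zero) , decodes a k (vs ∘ suc)

  decodes-cong : ∀ a {n} k {vs ws : Fin k → Vec Bool n} → (∀ j → vs j ≡ ws j) → decodes a k vs ≡ decodes a k ws
  decodes-cong a zero    vs≡ws = refl
  decodes-cong a (suc k) vs≡ws = cong₂ _,_ (cong (decode a) (vs≡ws zero)) (decodes-cong a k (vs≡ws ∘ suc))

  decodes-encode : ∀ a {n} → size a ≤ n → ∀ k ys → decodes a k (λ j → encode a n (nth a k ys j)) ≡ ys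
  decodes-encode a a≤n zero    tt       = refl
  decodes-encode a a≤n (suc k) (y , ys) = cong₂ _,_ (decode-encode a a≤n y) (decodes-encode a a≤n k ys)

  column : ∀ Y k m → El (pow (pow Y m) k) → Fin m → El (pow Y k)
  column Y k (suc m) ys zero    = firsts Y (pow Y m) k ys
  column Y k (suc m) ys (suc i) = column Y k m (seconds Y (pow Y m) k ys) i

  some⇒∃ : ∀ A Y k b m xs ys → some A Y k b m xs ys ≡ true → ∃ λ i → b (nth A m xs i) (column Y k m ys i) ≡ true
  some⇒∃ A Y k b (suc m) (x , xs) ys hit with b x (firsts Y (pow Y m) k ys) in eq
  ... | true  = zero , eq
  ... | false = let i , h = some⇒∃ A Y k b m xs (seconds Y (pow Y m) k ys) hit in suc i , h

  ∃⇒some : ∀ A Y k b m xs ys i → b (nth A m xs i) (column Y k m ys i) ≡ true → some A Y k b m xs ys ≡ true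
  ∃⇒some A Y k b (suc m) (x , xs) ys zero    h rewrite h = refl
  ∃⇒some A Y k b (suc m) (x , xs) ys (suc i) h with b x (firsts Y (pow Y m) k ys)
  ... | true  = refl
  ... | false = ∃⇒some A Y k b m xs _ i h

  index : ∀ {r} → Vec Bool r → Fin (2 ^ r)
  index []          = zero
  index (false ∷ v) = combine {2} zero (index v)
  index (true ∷ v)  = combine {2} (suc zero) (index v)

  index-surjective : ∀ r (i : Fin (2 ^ r)) → ∃ λ v → index {r} v ≡ i
  index-surjective zero    zero = [] , refl
  index-surjective (suc r) i with combine-surjective {2} {2 ^ r} i
  ... | zero     , j , eq = let v , h = index-surjective r j in false ∷ v , trans (cong (combine {2} zero) h) eq
  ... | suc zero , j , eq = let v , h = index-surjective r j in true ∷ v , trans (cong (combine {2} (suc zero)) h) eq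

  fromVec-toVec : ∀ r l → fromVec (toVec r l) ≡ l
  fromVec-toVec zero    tt       = refl
  fromVec-toVec (suc r) (b , bs) = cong (b ,_) (fromVec-toVec r bs)

  take-++ : ∀ {A : Set} m {n} (v : Vec A m) (w : Vec A n) → take m (v ++ w) ≡ v
  take-++ m v w = proj₁ (++-injective (take m (v ++ w)) v (take++drop≡id m (v ++ w)))

  drop-++ : ∀ {A : Set} m {n} (v : Vec A m) (w : Vec A n) → drop m (v ++ w) ≡ w
  drop-++ m v w = proj₂ (++-injective (take m (v ++ w)) v (take++drop≡id m (v ++ w)))

  module SelectedBits (p μ k n : ℕ) (φ : El (Selector p (Array p) (suc k))) where

    B : Space
    B = Array p

    m : ℕ
    m = 2 ^ μ

    bits : Pred B B (suc k)
    bits = gadget p B (suc k) φ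

    F-Bool : Input (2 + k) n → Bool
    F-Bool x = some B B (suc k) bits m (decode (pow B m) (x zero)) (decodes (pow B m) (suc k) (x ∘ suc))

    F : Input (2 + k) n → Sign
    F x = if F-Bool x then neg else pos

    position : Input (2 + k) n → Fin m → El (Pos p)
    position x i = select p B (suc k) φ (column B (suc k) m (decodes (pow B m) (suc k) (x ∘ suc)) i)

    -- No player sees both the arrays and all selecting blocks, so the work is shared: player 0
    -- checks the guessed position against the blocks, and player 1 reads the array there. Each
    -- writes one bit.
    verify : Fin m → El (Pos p) → Prot (2 + k) n 2
    verify i l = node zero selected selected-seen (node (suc zero) read read-seen (leaf neg) (leaf pos)) (leaf pos)
      where
      selected : Input (2 + k) n → Bool
      selected x = does (_≟_ {Pos p} (position x i) l)
      selected-seen : SeenBy zero selected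
      selected-seen x y x≡y = cong
        (λ ys → does (_≟_ {Pos p} (select p B (suc k) φ (column B (suc k) m ys i)) l))
        (decodes-cong (pow B m) (suc k) λ j → x≡y (suc j) λ ())
      read : Input (2 + k) n → Bool
      read x = app (Pos p) bit (nth B m (decode (pow B m) (x zero)) i) l
      read-seen : SeenBy (suc zero) read
      read-seen x y x≡y = cong (λ v → app (Pos p) bit (nth B m (decode (pow B m) v) i) l) (x≡y zero λ ())

    nondeterministic : NProt (2 + k) n (μ + p) 2
    nondeterministic w = verify (index (take μ w)) (fromVec (drop μ w))

    verify-complete : ∀ x i → bits (nth B m (decode (pow B m) (x zero)) i)
      (column B (suc k) m (decodes (pow B m) (suc k) (x ∘ suc)) i) ≡ true → run (verify i (position x i)) x ≡ neg
    verify-complete x i h rewrite dec-true (_≟_ {Pos p} (position x i) (position x i)) refl | h = refl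

    verify-sound : ∀ x i l → F-Bool x ≡ false → run (verify i l) x ≡ pos
    verify-sound x i l none with _≟_ {Pos p} (position x i) l
    ... | no  _    = refl
    ... | yes refl with app (Pos p) bit (nth B m (decode (pow B m) (x zero)) i) (position x i) in eq
    ...   | false = refl
    ...   | true  = contradiction (trans (sym (∃⇒some B B (suc k) bits m _ _ i eq)) none) λ ()

    nondeterministic-computes : NComputes nondeterministic F
    nondeterministic-computes x with F-Bool x in eq
    ... | true  = (λ _ → witness) , λ ()
      where
      witness : Σ (Vec Bool (μ + p)) λ w → run (nondeterministic w) x ≡ neg
      witness with some⇒∃ B B (suc k) bits m _ _ eq
      ... | i , hit with index-surjective μ i
      ...   | v , refl = v ++ toVec p (position x i) , trans
        (cong₂ (λ j l → run (verify j l) x)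
          (cong index (take-++ μ v _))
          (trans (cong fromVec (drop-++ μ v _)) (fromVec-toVec p _)))
        (verify-complete x i hit)
    ... | false = (λ ()) , λ _ w → verify-sound x _ _ eq

    NCost-F : NCostAtMost F (μ + p + 2)
    NCost-F = μ + p , 2 , ≤-refl , nondeterministic , nondeterministic-computes

    size-player : size (pow B m) ≡ 2 ^ (μ + p)
    size-player = begin
      size (pow B m)                     ≡⟨ size-pow B m ⟩
      2 ^ μ * size (Array p)             ≡⟨ cong (2 ^ μ *_) (trans (size-fun (Pos p) bit) (*-identityʳ _)) ⟩
      2 ^ μ * 2 ^ size (Pos p)           ≡⟨ cong (λ s → 2 ^ μ * 2 ^ s) (trans (size-pow bit p) (*-identityʳ p)) ⟩
      2 ^ μ * 2 ^ p                      ≡⟨ sym (^-distribˡ-+-* 2 μ p) ⟩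
      2 ^ (μ + p)                        ∎
      where open ≡-Reasoning

-- Numerical estimates and the choice of parameters.

module Parameters where

  open RationalFacts
  open Expectation
  open RandomSelection
  open AlternatingSums using (central; central-lower)
  open import Data.Nat as ℕ using (ℕ; zero; suc)
  import Data.Nat.Properties as ℕ
  open import Data.Rational hiding (_≟_)
  open import Data.Rational.Properties hiding (_≟_)
  open import Relation.Binary.PropositionalEquality
  import Data.Nat.Solver
  import Tactic.RingSolver as Solver

  n<2^n : ∀ n → n ℕ.< 2 ℕ.^ n
  n<2^n zero    = ℕ.s≤s ℕ.z≤n
  n<2^n (suc n) = begin
    2 ℕ.+ n                     ≤⟨ ℕ.s≤s (n<2^n n) ⟩
    1 ℕ.+ 2 ℕ.^ n               ≤⟨ ℕ.+-monoˡ-≤ (2 ℕ.^ n) (ℕ.≤-trans (ℕ.s≤s ℕ.z≤n) (n<2^n n)) ⟩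
    2 ℕ.^ n ℕ.+ 2 ℕ.^ n         ≡⟨ cong (2 ℕ.^ n ℕ.+_) (sym (ℕ.+-identityʳ _)) ⟩
    2 ℕ.^ suc n                 ∎
    where open ℕ.≤-Reasoning

  2+n≤2^n : ∀ n → 2 ℕ.≤ n → 2 ℕ.+ n ℕ.≤ 2 ℕ.^ n
  2+n≤2^n (suc zero) (ℕ.s≤s ())
  2+n≤2^n (suc (suc n)) _ = begin
    4 ℕ.+ n                               ≤⟨ ℕ.+-monoʳ-≤ 4 (ℕ.m≤m+n n _) ⟩
    4 ℕ.+ (n ℕ.+ (n ℕ.+ (n ℕ.+ n)))       ≡⟨ lemma n ⟩
    4 ℕ.* suc n                           ≤⟨ ℕ.*-monoʳ-≤ 4 (n<2^n n) ⟩
    4 ℕ.* 2 ℕ.^ n                         ≡⟨ ℕ.*-assoc 2 2 (2 ℕ.^ n) ⟩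
    2 ℕ.^ suc (suc n)                     ∎
    where
    open ℕ.≤-Reasoning
    open Data.Nat.Solver.+-*-Solver
    lemma : ∀ n → 4 ℕ.+ (n ℕ.+ (n ℕ.+ (n ℕ.+ n))) ≡ 4 ℕ.* suc n
    lemma = solve 1 (λ n → con 4 :+ (n :+ (n :+ (n :+ n))) := con 4 :* (con 1 :+ n)) refl

  fromℕ-2^ : ∀ n → fromℕ (2 ℕ.^ n) ≡ 2ℚ ^ n
  fromℕ-2^ n = fromℕ-^ 2 n

  2^m*½^[m+n] : ∀ m n → 2ℚ ^ m * ½ ^ (m ℕ.+ n) ≡ ½ ^ n
  2^m*½^[m+n] m n = begin
    2ℚ ^ m * ½ ^ (m ℕ.+ n)      ≡⟨ cong (2ℚ ^ m *_) (^-+ ½ m n) ⟩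
    2ℚ ^ m * (½ ^ m * ½ ^ n)    ≡⟨ regroup (2ℚ ^ m) (½ ^ m) (½ ^ n) ⟩
    ½ ^ m * 2ℚ ^ m * ½ ^ n      ≡⟨ cong (_* ½ ^ n) (½^n*2^n≡1 m) ⟩
    1ℚ * ½ ^ n                  ≡⟨ *-identityˡ _ ⟩
    ½ ^ n                       ∎
    where
    open ≡-Reasoning
    regroup : ∀ p q r → p * (q * r) ≡ q * p * r
    regroup = Solver.solve-∀ ℚ-ring

  bernoulli : ∀ n {x} → 0ℚ ≤ x → 1ℚ + fromℕ n * x ≤ (1ℚ + x) ^ n
  bernoulli zero    {x} 0≤x = ≤-reflexive (trans (cong (1ℚ +_) (*-zeroˡ x)) (+-identityʳ 1ℚ))
  bernoulli (suc n) {x} 0≤x = begin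
    1ℚ + (1ℚ + fromℕ n) * x                          ≡⟨ sym (+-identityʳ _) ⟩
    1ℚ + (1ℚ + fromℕ n) * x + 0ℚ                     ≤⟨ +-monoʳ-≤ (1ℚ + (1ℚ + fromℕ n) * x) (*-nonneg (fromℕ-nonneg n) (*-nonneg 0≤x 0≤x)) ⟩
    1ℚ + (1ℚ + fromℕ n) * x + fromℕ n * (x * x)      ≡⟨ expand (fromℕ n) x ⟩
    (1ℚ + x) * (1ℚ + fromℕ n * x)                    ≤⟨ *-monoˡ-≤ (+-nonneg 0≤1 0≤x) (bernoulli n 0≤x) ⟩
    (1ℚ + x) * (1ℚ + x) ^ n                          ∎
    where
    open ≤-Reasoning
    expand : ∀ n x → 1ℚ + (1ℚ + n) * x + n * (x * x) ≡ (1ℚ + x) * (1ℚ + n * x)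
    expand = Solver.solve-∀ ℚ-ring

  -- The bound 1 / (1 - nx) on `(1ℚ + x) ^ n` without division. The factor added by the induction
  -- loses (n + 1) x², which is nonnegative.
  growth : ∀ n {x} → 0ℚ ≤ x → (1ℚ + x) ^ n * (1ℚ - fromℕ n * x) ≤ 1ℚ
  growth zero    {x} 0≤x = ≤-reflexive (simplify x)
    where
    simplify : ∀ x → 1ℚ * (1ℚ - 0ℚ * x) ≡ 1ℚ
    simplify = Solver.solve-∀ ℚ-ring
  growth (suc n) {x} 0≤x = begin
    (1ℚ + x) * (1ℚ + x) ^ n * (1ℚ - (1ℚ + fromℕ n) * x)
      ≡⟨ expand x ((1ℚ + x) ^ n) (fromℕ n) ⟩
    (1ℚ + x) ^ n * (1ℚ - fromℕ n * x) - (1ℚ + x) ^ n * ((1ℚ + fromℕ n) * (x * x))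
      ≤⟨ +-monoʳ-≤ ((1ℚ + x) ^ n * (1ℚ - fromℕ n * x)) (neg-antimono-≤ (*-nonneg (^-nonneg n (+-nonneg 0≤1 0≤x)) (*-nonneg (fromℕ-nonneg (suc n)) (*-nonneg 0≤x 0≤x)))) ⟩
    (1ℚ + x) ^ n * (1ℚ - fromℕ n * x) - 0ℚ
      ≡⟨ +-identityʳ _ ⟩
    (1ℚ + x) ^ n * (1ℚ - fromℕ n * x)
      ≤⟨ growth n 0≤x ⟩
    1ℚ ∎
    where
    open ≤-Reasoning
    expand : ∀ x p n → (1ℚ + x) * p * (1ℚ - (1ℚ + n) * x) ≡ p * (1ℚ - n * x) - p * ((1ℚ + n) * (x * x))
    expand = Solver.solve-∀ ℚ-ring

  growth-2 : ∀ n {x} → 0ℚ ≤ x → fromℕ n * x ≡ ½ → (1ℚ + x) ^ n ≤ 2ℚ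
  growth-2 n {x} 0≤x nx≡½ = begin
    (1ℚ + x) ^ n                               ≡⟨ double ((1ℚ + x) ^ n) ⟩
    2ℚ * ((1ℚ + x) ^ n * (1ℚ - ½))             ≡⟨ cong (λ y → 2ℚ * ((1ℚ + x) ^ n * (1ℚ - y))) (sym nx≡½) ⟩
    2ℚ * ((1ℚ + x) ^ n * (1ℚ - fromℕ n * x))   ≤⟨ *-monoˡ-≤ 0≤2 (growth n 0≤x) ⟩
    2ℚ * 1ℚ                                    ≡⟨ *-identityʳ 2ℚ ⟩
    2ℚ                                         ∎
    where
    open ≤-Reasoning
    double : ∀ p → p ≡ 2ℚ * (p * (1ℚ - ½))
    double = Solver.solve-∀ ℚ-ring

  -- By Bernoulli `(1ℚ + x) ^ n` is at least 2, and its product with `(1ℚ - x) ^ n` is at most 1.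
  decay : ∀ n {x} → 0ℚ ≤ x → x ≤ 1ℚ → fromℕ n * x ≡ 1ℚ → (1ℚ - x) ^ n ≤ ½
  decay n {x} 0≤x x≤1 nx≡1 = begin
    (1ℚ - x) ^ n                                  ≡⟨ halve ((1ℚ - x) ^ n) ⟩
    ½ * ((1ℚ - x) ^ n * (1ℚ + 1ℚ))                ≤⟨ *-monoˡ-≤ 0≤½ (*-monoˡ-≤ (^-nonneg n 0≤1-x) (≡-≤-trans (cong (1ℚ +_) (sym nx≡1)) (bernoulli n 0≤x))) ⟩
    ½ * ((1ℚ - x) ^ n * (1ℚ + x) ^ n)             ≡⟨ cong (½ *_) (sym (^-distrib-* (1ℚ - x) (1ℚ + x) n)) ⟩
    ½ * ((1ℚ - x) * (1ℚ + x)) ^ n                 ≤⟨ *-monoˡ-≤ 0≤½ (^-upper n (*-nonneg 0≤1-x (+-nonneg 0≤1 0≤x)) product≤1) ⟩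
    ½ * 1ℚ                                        ≡⟨ *-identityʳ ½ ⟩
    ½                                             ∎
    where
    open ≤-Reasoning
    0≤1-x : 0ℚ ≤ 1ℚ - x
    0≤1-x = p≤q⇒0≤q-p x≤1
    halve : ∀ p → p ≡ ½ * (p * (1ℚ + 1ℚ))
    halve = Solver.solve-∀ ℚ-ring
    expand : ∀ x → (1ℚ - x) * (1ℚ + x) ≡ 1ℚ - x * x
    expand = Solver.solve-∀ ℚ-ring
    product≤1 : (1ℚ - x) * (1ℚ + x) ≤ 1ℚ
    product≤1 = ≡-≤-trans (expand x) (+-monoʳ-≤ 1ℚ (neg-antimono-≤ (*-nonneg 0≤x 0≤x)))

  -- The origin of `p`: with T = 2^(k+1) it makes T / 2^p equal to `½ ^ (2 + 2e)`, whose power T/2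
  -- is at most half of the target `½ ^ (e * T)`. The collision term, exponentially small in the
  -- array length, takes the other half.
  selector-bound : ∀ k e → let p = suc k ℕ.+ (2 ℕ.+ (e ℕ.+ e)) in
    fromℕ (suc k) * ½ ^ size (Array p) + mean-bias₀ p (2 ℕ.^ suc k) ≤ pow₂ (suc k) (½ ^ e)
  selector-bound k e = begin
    fromℕ (suc k) * ½ ^ size (Array p) + mean-bias₀ p T     ≤⟨ +-mono-≤ first second ⟩
    ½ ^ suc (e ℕ.* T) + ½ ^ suc (e ℕ.* T)                   ≡⟨ double (½ ^ (e ℕ.* T)) ⟩
    ½ ^ (e ℕ.* T)                                           ≡⟨ sym (^-assoc ½ e T) ⟩
    (½ ^ e) ^ T                                             ≡⟨ sym (pow₂≡^ (suc k) (½ ^ e)) ⟩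
    pow₂ (suc k) (½ ^ e)                                    ∎
    where
    open ≤-Reasoning
    T p : ℕ
    T = 2 ℕ.^ suc k
    p = suc k ℕ.+ (2 ℕ.+ (e ℕ.+ e))
    double : ∀ x → ½ * x + ½ * x ≡ x
    double = Solver.solve-∀ ℚ-ring
    size-Array : size (Array p) ≡ T ℕ.* 2 ℕ.^ (2 ℕ.+ (e ℕ.+ e))
    size-Array = trans (size-fun (Pos p) bit) (trans (ℕ.*-identityʳ _) (trans
      (cong (2 ℕ.^_) (trans (size-pow bit p) (ℕ.*-identityʳ p))) (ℕ.^-distribˡ-+-* 2 (suc k) _)))
    large : suc k ℕ.+ suc (e ℕ.* T) ℕ.≤ size (Array p)
    large = ℕ.≤-trans (ℕ.≤-trans
      (ℕ.≤-reflexive (ℕ.+-suc (suc k) (e ℕ.* T)))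
      (ℕ.+-monoˡ-≤ (e ℕ.* T) (n<2^n (suc k))))
      (ℕ.≤-trans (ℕ.≤-reflexive (ℕ.*-comm (suc e) T)) (ℕ.≤-trans
        (ℕ.*-monoʳ-≤ T (ℕ.≤-trans (n<2^n e) (ℕ.^-monoʳ-≤ 2 (ℕ.≤-trans (ℕ.m≤m+n e e) (ℕ.m≤n+m _ 2)))))
        (ℕ.≤-reflexive (sym size-Array))))
    first : fromℕ (suc k) * ½ ^ size (Array p) ≤ ½ ^ suc (e ℕ.* T)
    first = begin
      fromℕ (suc k) * ½ ^ size (Array p)                 ≤⟨ *-mono-≤ (^-nonneg (suc k) 0≤2) (^-nonneg (size (Array p)) 0≤½)
                                                              (≤-≡-trans (fromℕ-mono-≤ (ℕ.<⇒≤ (n<2^n (suc k)))) (fromℕ-2^ (suc k)))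
                                                              (½^-antimono large) ⟩
      2ℚ ^ suc k * ½ ^ (suc k ℕ.+ suc (e ℕ.* T))         ≡⟨ 2^m*½^[m+n] (suc k) _ ⟩
      ½ ^ suc (e ℕ.* T)                                  ∎
    exponent : (2 ℕ.+ (e ℕ.+ e)) ℕ.* 2 ℕ.^ k ≡ e ℕ.* T ℕ.+ T
    exponent = lemma e (2 ℕ.^ k)
      where
      open Data.Nat.Solver.+-*-Solver
      lemma : ∀ e s → (2 ℕ.+ (e ℕ.+ e)) ℕ.* s ≡ e ℕ.* (2 ℕ.* s) ℕ.+ 2 ℕ.* s
      lemma = solve 2 (λ e s → (con 2 :+ (e :+ e)) :* s := e :* (con 2 :* s) :+ con 2 :* s) refl
    second : mean-bias₀ p T ≤ ½ ^ suc (e ℕ.* T)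
    second = begin
      mean-bias₀ p (2 ℕ.* 2 ℕ.^ k)               ≤⟨ mean-bias₀-bound p T (2 ℕ.^ k) ℕ.≤-refl ⟩
      (fromℕ T * ½ ^ p) ^ (2 ℕ.^ k)              ≡⟨ cong (_^ (2 ℕ.^ k)) (trans (cong (_* ½ ^ p) (fromℕ-2^ (suc k))) (2^m*½^[m+n] (suc k) _)) ⟩
      (½ ^ (2 ℕ.+ (e ℕ.+ e))) ^ (2 ℕ.^ k)        ≡⟨ ^-assoc ½ (2 ℕ.+ (e ℕ.+ e)) (2 ℕ.^ k) ⟩
      ½ ^ ((2 ℕ.+ (e ℕ.+ e)) ℕ.* 2 ℕ.^ k)        ≡⟨ cong (½ ^_) exponent ⟩
      ½ ^ (e ℕ.* T ℕ.+ T)                        ≤⟨ ½^-antimono (ℕ.≤-trans (ℕ.≤-reflexive (ℕ.+-comm 1 (e ℕ.* T))) (ℕ.+-monoʳ-≤ (e ℕ.* T) (ℕ.≤-trans (ℕ.s≤s ℕ.z≤n) (n<2^n (suc k))))) ⟩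
      ½ ^ suc (e ℕ.* T)                          ∎

  protocol-bound : ∀ c ℓ d → (c ℕ.+ 2) ℕ.* ℓ ℕ.≤ d → ½ ^ d * (3ℚ * 2ℚ ^ c) ^ ℓ ≤ 1ℚ
  protocol-bound c ℓ d small = begin
    -- Rounding 3 up to 2² is the source of the 2 added to `c`.
    ½ ^ d * (3ℚ * 2ℚ ^ c) ^ ℓ           ≤⟨ *-monoˡ-≤ (^-nonneg d 0≤½) (^-monoˡ-≤ ℓ (*-nonneg 0≤3 (^-nonneg c 0≤2)) (*-monoʳ-≤ {3ℚ} {2ℚ ^ 2} (^-nonneg c 0≤2) (≤ᵇ⇒≤ _))) ⟩
    ½ ^ d * (2ℚ ^ 2 * 2ℚ ^ c) ^ ℓ       ≡⟨ cong (λ q → ½ ^ d * q ^ ℓ) (trans (*-comm (2ℚ ^ 2) (2ℚ ^ c)) (sym (^-+ 2ℚ c 2))) ⟩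
    ½ ^ d * (2ℚ ^ (c ℕ.+ 2)) ^ ℓ        ≡⟨ cong (½ ^ d *_) (^-assoc 2ℚ (c ℕ.+ 2) ℓ) ⟩
    ½ ^ d * 2ℚ ^ ((c ℕ.+ 2) ℕ.* ℓ)      ≤⟨ *-monoˡ-≤ (^-nonneg d 0≤½) (^-monoʳ-≤ (≤ᵇ⇒≤ _) small) ⟩
    ½ ^ d * 2ℚ ^ d                      ≡⟨ ½^n*2^n≡1 d ⟩
    1ℚ                                  ∎
    where open ≤-Reasoning

  module Choice (v : ℕ) (2≤v : 2 ℕ.≤ v) where

    -- The cost to be excluded is below V = 2^v, and d = V⁴ exceeds the product of about V² in
    -- `cost-small`. Then m = d³ makes the tail at δ = 1 / d² at most 2^(-d), and β = 1 / 4m makes 2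
    -- β m = 1/2 for `growth-2`.
    u d m e : ℕ
    u = 4 ℕ.* v
    d = 2 ℕ.^ u
    m = 2 ℕ.^ (12 ℕ.* v)
    e = 12 ℕ.* v ℕ.+ 2

    δ β : ℚ
    δ = ½ ^ (u ℕ.+ u)
    β = ½ ^ e

    0≤δ : 0ℚ ≤ δ
    0≤δ = ^-nonneg (u ℕ.+ u) 0≤½

    δ≤1 : δ ≤ 1ℚ
    δ≤1 = ^-upper (u ℕ.+ u) 0≤½ ½≤1

    0≤β : 0ℚ ≤ β
    0≤β = ^-nonneg e 0≤½

    δd²≡1 : δ * fromℕ (d ℕ.* d) ≡ 1ℚ
    δd²≡1 = trans (cong (δ *_) (trans (cong fromℕ (sym (ℕ.^-distribˡ-+-* 2 u u))) (fromℕ-2^ (u ℕ.+ u)))) (½^n*2^n≡1 (u ℕ.+ u))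

    riesz-mass : (1ℚ + 2ℚ * β) ^ m ≤ 2ℚ
    riesz-mass = growth-2 m (*-nonneg 0≤2 0≤β) (begin
      fromℕ m * (2ℚ * ½ ^ e)                   ≡⟨ cong (_* (2ℚ * ½ ^ e)) (fromℕ-2^ (12 ℕ.* v)) ⟩
      2ℚ ^ (12 ℕ.* v) * (2ℚ * ½ ^ e)           ≡⟨ left-comm (2ℚ ^ (12 ℕ.* v)) 2ℚ (½ ^ e) ⟩
      2ℚ * (2ℚ ^ (12 ℕ.* v) * ½ ^ e)           ≡⟨ cong (2ℚ *_) (2^m*½^[m+n] (12 ℕ.* v) 2) ⟩
      ½                                        ∎)
      where
      open ≡-Reasoning
      left-comm : ∀ p q r → p * (q * r) ≡ q * (p * r)
      left-comm = Solver.solve-∀ ℚ-ring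

    -- The m = d² · d factors form d groups of d² = 1 / δ factors, and by `decay` each group is at
    -- most 1/2.
    tail : (1ℚ - δ) ^ m ≤ ½ ^ (2 ℕ.+ u)
    tail = begin
      (1ℚ - δ) ^ m                                      ≡⟨ cong ((1ℚ - δ) ^_) m≡ ⟩
      (1ℚ - δ) ^ (2 ℕ.^ (u ℕ.+ u) ℕ.* d)                ≡⟨ sym (^-assoc (1ℚ - δ) (2 ℕ.^ (u ℕ.+ u)) d) ⟩
      ((1ℚ - δ) ^ (2 ℕ.^ (u ℕ.+ u))) ^ d                ≤⟨ ^-monoˡ-≤ d (^-nonneg (2 ℕ.^ (u ℕ.+ u)) (p≤q⇒0≤q-p δ≤1)) (decay (2 ℕ.^ (u ℕ.+ u)) 0≤δ δ≤1 nδ≡1) ⟩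
      ½ ^ d                                             ≤⟨ ½^-antimono 2+u≤d ⟩
      ½ ^ (2 ℕ.+ u)                                     ∎
      where
      open ≤-Reasoning
      m≡ : m ≡ 2 ℕ.^ (u ℕ.+ u) ℕ.* d
      m≡ = trans (cong (2 ℕ.^_) (lemma v)) (ℕ.^-distribˡ-+-* 2 (u ℕ.+ u) u)
        where
        open Data.Nat.Solver.+-*-Solver
        lemma : ∀ v → 12 ℕ.* v ≡ 4 ℕ.* v ℕ.+ 4 ℕ.* v ℕ.+ 4 ℕ.* v
        lemma = solve 1 (λ v → con 12 :* v := con 4 :* v :+ con 4 :* v :+ con 4 :* v) refl
      nδ≡1 : fromℕ (2 ℕ.^ (u ℕ.+ u)) * δ ≡ 1ℚ
      nδ≡1 = trans (*-comm _ δ) (trans (cong (δ *_) (fromℕ-2^ (u ℕ.+ u))) (½^n*2^n≡1 (u ℕ.+ u)))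
      2+u≤d : 2 ℕ.+ u ℕ.≤ d
      2+u≤d = 2+n≤2^n u (ℕ.≤-trans 2≤v (ℕ.m≤m+n v _))

    central-large : 2ℚ ^ (d ℕ.+ d) * ½ ^ suc u ≤ fromℕ (central d)
    central-large = begin
      2ℚ ^ (d ℕ.+ d) * ½ ^ suc u                                ≡⟨ cong (_* ½ ^ suc u) (trans (sym (fromℕ-2^ (d ℕ.+ d))) (cong fromℕ 2^[d+d])) ⟩
      fromℕ (4 ℕ.^ d) * ½ ^ suc u                               ≤⟨ *-monoʳ-≤ (^-nonneg (suc u) 0≤½) (fromℕ-mono-≤ (lower d 0<d)) ⟩
      fromℕ (2 ℕ.* d ℕ.* central d) * ½ ^ suc u                 ≡⟨ cong (_* ½ ^ suc u) (trans (fromℕ-* (2 ℕ.* d) (central d)) (cong (_* fromℕ (central d)) (fromℕ-2^ (suc u)))) ⟩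
      2ℚ ^ suc u * fromℕ (central d) * ½ ^ suc u                ≡⟨ regroup (2ℚ ^ suc u) _ (½ ^ suc u) ⟩
      ½ ^ suc u * 2ℚ ^ suc u * fromℕ (central d)                ≡⟨ trans (cong (_* fromℕ (central d)) (½^n*2^n≡1 (suc u))) (*-identityˡ _) ⟩
      fromℕ (central d)                                         ∎
      where
      open ≤-Reasoning
      2^[d+d] : 2 ℕ.^ (d ℕ.+ d) ≡ 4 ℕ.^ d
      2^[d+d] = trans (cong (λ n → 2 ℕ.^ (d ℕ.+ n)) (sym (ℕ.+-identityʳ d))) (sym (ℕ.^-*-assoc 2 2 d))
      0<d : 0 ℕ.< d
      0<d = ℕ.≤-trans (ℕ.s≤s ℕ.z≤n) (n<2^n u)
      lower : ∀ d → 0 ℕ.< d → 4 ℕ.^ d ℕ.≤ 2 ℕ.* d ℕ.* central d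
      lower (suc d) _ = central-lower d
      regroup : ∀ p q r → p * q * r ≡ r * p * q
      regroup = Solver.solve-∀ ℚ-ring

    -- The central coefficient is at least the fraction `½ ^ suc u` = 1 / 2d of 2^(2d), and the tail
    -- takes at most half of that.
    gap-large : 2ℚ ^ (d ℕ.+ d) * ½ ^ (2 ℕ.+ u) ≤ fromℕ (central d) - 2ℚ ^ (d ℕ.+ d) * (1ℚ - δ) ^ m
    gap-large = begin
      2ℚ ^ (d ℕ.+ d) * ½ ^ (2 ℕ.+ u)                                          ≡⟨ split (2ℚ ^ (d ℕ.+ d)) (½ ^ u) ⟩
      2ℚ ^ (d ℕ.+ d) * ½ ^ suc u - 2ℚ ^ (d ℕ.+ d) * ½ ^ (2 ℕ.+ u)             ≤⟨ +-mono-≤ central-large (neg-antimono-≤ (*-monoˡ-≤ (^-nonneg (d ℕ.+ d) 0≤2) tail)) ⟩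
      fromℕ (central d) - 2ℚ ^ (d ℕ.+ d) * (1ℚ - δ) ^ m                       ∎
      where
      open ≤-Reasoning
      split : ∀ p q → p * (½ * (½ * q)) ≡ p * (½ * q) - p * (½ * (½ * q))
      split = Solver.solve-∀ ℚ-ring

    -- c₁ + (4 + u) is the number of repetitions used to amplify the protocol.
    cost-small : ∀ c₁ c₂ → c₁ ℕ.+ c₂ ℕ.< 2 ℕ.^ v → (c₂ ℕ.+ 2) ℕ.* (c₁ ℕ.+ (4 ℕ.+ u)) ℕ.≤ d
    cost-small c₁ c₂ c<V = begin
      (c₂ ℕ.+ 2) ℕ.* (c₁ ℕ.+ (4 ℕ.+ 4 ℕ.* v))
        ≤⟨ ℕ.*-mono-≤ (ℕ.+-mono-≤ c₂≤V 2≤V) (ℕ.+-mono-≤ c₁≤V (ℕ.≤-trans (ℕ.≤-reflexive (sym (ℕ.*-suc 4 v))) (ℕ.*-monoʳ-≤ 4 (n<2^n v)))) ⟩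
      (V ℕ.+ V) ℕ.* (V ℕ.+ 4 ℕ.* V)
        ≤⟨ ℕ.m≤m+n _ (6 ℕ.* (V ℕ.* V)) ⟩
      (V ℕ.+ V) ℕ.* (V ℕ.+ 4 ℕ.* V) ℕ.+ 6 ℕ.* (V ℕ.* V)
        ≡⟨ collect V ⟩
      4 ℕ.* V ℕ.* (4 ℕ.* V)
        ≤⟨ ℕ.*-mono-≤ (ℕ.*-monoˡ-≤ V 4≤V) (ℕ.*-monoˡ-≤ V 4≤V) ⟩
      V ℕ.* V ℕ.* (V ℕ.* V)
        ≡⟨ sym V⁴ ⟩
      d ∎
      where
      open ℕ.≤-Reasoning
      open Data.Nat.Solver.+-*-Solver
      V : ℕ
      V = 2 ℕ.^ v
      c₁≤V : c₁ ℕ.≤ V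
      c₁≤V = ℕ.≤-trans (ℕ.m≤m+n c₁ c₂) (ℕ.<⇒≤ c<V)
      c₂≤V : c₂ ℕ.≤ V
      c₂≤V = ℕ.≤-trans (ℕ.m≤n+m c₂ c₁) (ℕ.<⇒≤ c<V)
      4≤V : 4 ℕ.≤ V
      4≤V = ℕ.^-monoʳ-≤ 2 2≤v
      2≤V : 2 ℕ.≤ V
      2≤V = ℕ.≤-trans (ℕ.s≤s (ℕ.s≤s ℕ.z≤n)) 4≤V
      collect : ∀ V → (V ℕ.+ V) ℕ.* (V ℕ.+ 4 ℕ.* V) ℕ.+ 6 ℕ.* (V ℕ.* V) ≡ 4 ℕ.* V ℕ.* (4 ℕ.* V)
      collect = solve 1 (λ V → (V :+ V) :* (V :+ con 4 :* V) :+ con 6 :* (V :* V) := con 4 :* V :* (con 4 :* V)) refl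
      V⁴ : d ≡ V ℕ.* V ℕ.* (V ℕ.* V)
      V⁴ = trans (cong (2 ℕ.^_) (lemma v)) (trans (ℕ.^-distribˡ-+-* 2 (v ℕ.+ v) (v ℕ.+ v))
        (cong₂ ℕ._*_ (ℕ.^-distribˡ-+-* 2 v v) (ℕ.^-distribˡ-+-* 2 v v)))
        where
        lemma : ∀ v → 4 ℕ.* v ≡ v ℕ.+ v ℕ.+ (v ℕ.+ v)
        lemma = solve 1 (λ v → con 4 :* v := v :+ v :+ (v :+ v)) refl

-- The lower bound for Merlin-Arthur protocols.

module Separation where

  open import Defs
  open RationalFacts
  open Expectation
  open Box
  open RandomSelection
  open Protocols
  open Combination
  open Encoding
  open Parameters
  open AlternatingSums using (central)
  open import Data.Bool using (Bool; true; false; if_then_else_)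
  open import Data.Fin using (zero; suc)
  open import Data.Nat as ℕ using (ℕ; suc)
  import Data.Nat.Properties as ℕ
  open import Data.Product using (Σ; _×_; _,_; proj₁; proj₂)
  open import Data.Rational hiding (_≟_; neg; pos)
  open import Data.Rational.Properties hiding (_≟_)
  open import Data.Vec using (Vec)
  open import Relation.Binary.PropositionalEquality
  open import Relation.Nullary using (¬_; does; yes; no)
  open import Relation.Nullary.Negation using (contradiction)
  import Data.Nat.Solver
  import Tactic.RingSolver as Solver

  -- Needed for a single convincing message of Merlin, whose share of the average is one over the
  -- number of messages.
  E-≥-value : ∀ a {f : El a → ℚ} → (∀ x → 0ℚ ≤ f x) → ∀ x → ½ ^ size a * f x ≤ E a f
  E-≥-value a {f} 0≤f x = ≡-≤-trans (sym (trans (E-*ʳ a (f x) _) (cong (_* f x) (E-≟ a x)))) (E-mono a pointwise)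
    where
    pointwise : ∀ y → ⟦ does (_≟_ {a} x y) ⟧ * f x ≤ f y
    pointwise y with _≟_ {a} x y
    ... | yes refl = ≤-reflexive (*-identityˡ (f x))
    ... | no _     = ≡-≤-trans (*-zeroˡ (f x)) (0≤f y)

  module Lower (v : ℕ) (2≤v : 2 ℕ.≤ v) (k n p : ℕ) (φ : El (Selector p (Array p) (suc k)))
    (box-bits : box (Array p) (Array p) (suc k) (gadget p (Array p) (suc k) φ) ≤ pow₂ (suc k) (½ ^ Choice.e v 2≤v)) where

    open Choice v 2≤v
    open SelectedBits p (12 ℕ.* v) k n φ hiding (m)

    balanced : ∀ ys → E B (λ x → sgn (bits x ys)) ≡ 0ℚ
    balanced ys = E-app (Pos p) bit (select p B (suc k) φ ys) sgn

    module _ (fits : 2 ℕ.^ (12 ℕ.* v ℕ.+ p) ℕ.≤ n) where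

      P : Space
      P = pow B m

      P≤n : size P ℕ.≤ n
      P≤n = subst (ℕ._≤ n) (sym size-player) fits

      at : El P → El (pow P (suc k)) → Input (2 ℕ.+ k) n
      at = input P P (encode P n) (encode P n) (suc k)

      F-Bool-at : ∀ xs ys → F-Bool (at xs ys) ≡ some B B (suc k) bits m xs ys
      F-Bool-at xs ys = cong₂ (some B B (suc k) bits m) (decode-encode P P≤n xs) (decodes-encode P P≤n (suc k) ys)

      F-at : ∀ xs ys {t} → some B B (suc k) bits m xs ys ≡ t → negate (F (at xs ys)) ≡ (if t then pos else neg)
      F-at xs ys {t} eq = trans
        (cong (λ t′ → negate (if t′ then neg else pos)) (trans (F-Bool-at xs ys) eq)) (negate-if t)
        where
        negate-if : ∀ t → negate (if t then neg else pos) ≡ (if t then pos else neg)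
        negate-if true  = refl
        negate-if false = refl

      module _ {c₁ c₂ : ℕ} (π : MAProt (2 ℕ.+ k) n c₁ c₂) (π-computes : MAComputes π (λ x → negate (F x)))
               (cheap : c₁ ℕ.+ c₂ ℕ.< 2 ℕ.^ v) where

        ℓ : ℕ
        ℓ = c₁ ℕ.+ (4 ℕ.+ u)

        τ K : ℚ
        τ = ½ ^ c₁ * 2ℚ ^ ℓ
        K = (3ℚ * 2ℚ ^ c₂) ^ ℓ

        0≤τ : 0ℚ ≤ τ
        0≤τ = *-nonneg (^-nonneg c₁ 0≤½) (^-nonneg ℓ 0≤2)

        0≤K : 0ℚ ≤ K
        0≤K = ^-nonneg ℓ (*-nonneg 0≤3 (^-nonneg c₂ 0≤2))

        tripled : Vec Bool c₁ → El P → El (pow P (suc k)) → ℚ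
        tripled w xs ys = 3ℚ * acceptance P P (encode P n) (encode P n) (suc k) (π w) xs ys

        0≤tripled : ∀ w xs ys → 0ℚ ≤ tripled w xs ys
        0≤tripled w xs ys = *-nonneg 0≤3 (acceptance-nonneg P P (encode P n) (encode P n) (suc k) (π w) xs ys)

        -- Taking ℓ-th powers amplifies the gap between 2 and 1 on the two sides of the threshold,
        -- and averaging over Merlin's messages costs only the factor ½ ^ c₁ in τ.
        h : El P → El (pow P (suc k)) → ℚ
        h xs ys = E (pow bit c₁) λ ω → tripled (toVec c₁ ω) xs ys ^ ℓ

        0≤h : ∀ xs ys → 0ℚ ≤ h xs ys
        0≤h xs ys = E-nonneg (pow bit c₁) λ ω → ^-nonneg ℓ (0≤tripled (toVec c₁ ω) xs ys)

        h-none : ∀ xs ys → some B B (suc k) bits m xs ys ≡ false → τ ≤ h xs ys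
        h-none xs ys none = begin
          ½ ^ c₁ * 2ℚ ^ ℓ
            ≤⟨ *-monoˡ-≤ (^-nonneg c₁ 0≤½) (^-monoˡ-≤ ℓ 0≤2 (acceptance-neg P P (encode P n) (encode P n) (suc k) (π w) xs ys err)) ⟩
          ½ ^ c₁ * tripled w xs ys ^ ℓ
            ≡⟨ cong₂ (λ s w′ → ½ ^ s * tripled w′ xs ys ^ ℓ) (sym (trans (size-pow bit c₁) (ℕ.*-identityʳ c₁))) (sym (toVec-fromVec w)) ⟩
          ½ ^ size (pow bit c₁) * tripled (toVec c₁ (fromVec w)) xs ys ^ ℓ
            ≤⟨ E-≥-value (pow bit c₁) (λ ω → ^-nonneg ℓ (0≤tripled (toVec c₁ ω) xs ys)) (fromVec w) ⟩
          h xs ys ∎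
          where
          open ≤-Reasoning
          honest : Σ (Vec Bool c₁) λ w → ErrAtMostThird (π w) (at xs ys) (negate (F (at xs ys)))
          honest = proj₁ (π-computes (at xs ys)) (F-at xs ys none)
          w : Vec Bool c₁
          w = proj₁ honest
          err : ErrAtMostThird (π w) (at xs ys) neg
          err = subst (ErrAtMostThird (π w) (at xs ys)) (F-at xs ys none) (proj₂ honest)

        h-some : ∀ xs ys → some B B (suc k) bits m xs ys ≡ true → h xs ys ≤ 1ℚ
        h-some xs ys hit = E-≤-const (pow bit c₁) λ ω → ^-upper ℓ (0≤tripled (toVec c₁ ω) xs ys)
          (acceptance-pos P P (encode P n) (encode P n) (suc k) (π (toVec c₁ ω)) xs ys
            (subst (ErrAtMostThird (π (toVec c₁ ω)) (at xs ys)) (F-at xs ys hit)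
              (proj₂ (π-computes (at xs ys)) (F-at xs ys hit) (toVec c₁ ω))))

        -- Boundedness is used for the parity over `S` with `β ^ weight S` in place of `β`, and
        -- tested on the full space. Averaging over messages leaves `K` unchanged.
        h-small : ∀ S → ∣ a B B (suc k) bits d m δ 0≤δ δ≤1 δd²≡1 β 0≤β K 0≤K h S ∣ ≤ K * β ^ weight S
        h-small S = ≡-≤-trans
          (cong ∣_∣ (E-cong (P ⊗ pow P (suc k)) λ (xs , ys) → sym (trans
            (cong (λ t → ⟦ t ⟧ * (h xs ys * sgn (parity B B (suc k) bits S xs ys))) (member-everything P P (suc k) xs ys))
            (*-identityˡ _))))
          (Bounded.bound h-bounded (everything P P (suc k)))
          where
          h-bounded : Bounded P P (encode P n) (encode P n) (suc k) (parity B B (suc k) bits S) (β ^ weight S) h K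
          h-bounded = Bounded-E P P (encode P n) (encode P n) (suc k) (parity B B (suc k) bits S) (β ^ weight S) (pow bit c₁) λ ω →
            Bounded-acceptance^ P P (encode P n) (encode P n) (suc k) (parity B B (suc k) bits S) (β ^ weight S)
              (^-nonneg (weight S) 0≤β) (π (toVec c₁ ω)) ℓ
              λ C → correlation-parity B B (suc k) bits 0≤β box-bits C S

        -- The repetitions beyond c₁ contribute 2^(4 + u), against the fraction 2^(-2 - u) in
        -- `gap-large`. With Z = 2^(2d) this leaves 4Z, so the witness totals at least 4Z - Z = 3Z,
        -- yet at most 2Z by the upper bound.
        impossible : 3ℚ * 2ℚ ^ (d ℕ.+ d) ≤ 2ℚ * 2ℚ ^ (d ℕ.+ d)
        impossible = begin
          3ℚ * Z                                                   ≡⟨ rearrange Z ⟩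
          2ℚ ^ 4 * (Z * ½ ^ 2) - Z                                 ≡⟨ cong (_- Z) (sym τ-gap) ⟩
          τ * (Z * ½ ^ (2 ℕ.+ u)) - Z                              ≤⟨ +-monoˡ-≤ (- Z) (*-monoˡ-≤ 0≤τ gap-large) ⟩
          τ * (fromℕ (central d) - Z * (1ℚ - δ) ^ m) - Z           ≤⟨ total-lower B B (suc k) bits d m δ 0≤δ δ≤1 δd²≡1 β 0≤β K 0≤K h τ 0≤τ 0≤gap 0≤h h-none h-some balanced ⟩
          total B B (suc k) bits d m δ 0≤δ δ≤1 δd²≡1 β 0≤β K 0≤K h ≤⟨ total-upper B B (suc k) bits d m δ 0≤δ δ≤1 δd²≡1 β 0≤β K 0≤K h h-small riesz-mass ⟩
          Z * ½ ^ d * K * 2ℚ                                       ≡⟨ regroup Z (½ ^ d) K 2ℚ ⟩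
          2ℚ * Z * (½ ^ d * K)                                     ≤⟨ *-monoˡ-≤ (*-nonneg 0≤2 0≤Z) (protocol-bound c₂ ℓ d (cost-small c₁ c₂ cheap)) ⟩
          2ℚ * Z * 1ℚ                                              ≡⟨ *-identityʳ _ ⟩
          2ℚ * Z                                                   ∎
          where
          open ≤-Reasoning
          Z : ℚ
          Z = 2ℚ ^ (d ℕ.+ d)
          0≤Z : 0ℚ ≤ Z
          0≤Z = ^-nonneg (d ℕ.+ d) 0≤2
          0≤gap : 0ℚ ≤ fromℕ (central d) - Z * (1ℚ - δ) ^ m
          0≤gap = ≤-trans (*-nonneg 0≤Z (^-nonneg (2 ℕ.+ u) 0≤½)) gap-large
          rearrange : ∀ z → 3ℚ * z ≡ 2ℚ ^ 4 * (z * ½ ^ 2) - z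
          rearrange = Solver.solve-∀ ℚ-ring
          regroup : ∀ z q r t → z * q * r * t ≡ t * z * (q * r)
          regroup = Solver.solve-∀ ℚ-ring
          τ-gap : τ * (Z * ½ ^ (2 ℕ.+ u)) ≡ 2ℚ ^ 4 * (Z * ½ ^ 2)
          τ-gap = begin-equality
            ½ ^ c₁ * 2ℚ ^ (c₁ ℕ.+ (4 ℕ.+ u)) * (Z * ½ ^ (2 ℕ.+ u))
              ≡⟨ cong₂ (λ s t → ½ ^ c₁ * s * (Z * t)) (trans (^-+ 2ℚ c₁ (4 ℕ.+ u)) (cong (2ℚ ^ c₁ *_) (^-+ 2ℚ 4 u))) (^-+ ½ 2 u) ⟩
            ½ ^ c₁ * (2ℚ ^ c₁ * (2ℚ ^ 4 * 2ℚ ^ u)) * (Z * (½ ^ 2 * ½ ^ u))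
              ≡⟨ collect (½ ^ c₁) (2ℚ ^ c₁) (2ℚ ^ 4) (2ℚ ^ u) Z (½ ^ 2) (½ ^ u) ⟩
            ½ ^ c₁ * 2ℚ ^ c₁ * (½ ^ u * 2ℚ ^ u) * (2ℚ ^ 4 * (Z * ½ ^ 2))
              ≡⟨ cong₂ (λ s t → s * t * (2ℚ ^ 4 * (Z * ½ ^ 2))) (½^n*2^n≡1 c₁) (½^n*2^n≡1 u) ⟩
            1ℚ * 1ℚ * (2ℚ ^ 4 * (Z * ½ ^ 2))
              ≡⟨ *-identityˡ _ ⟩
            2ℚ ^ 4 * (Z * ½ ^ 2) ∎
            where
            collect : ∀ a b c d e f g → a * (b * (c * d)) * (e * (f * g)) ≡ a * b * (g * d) * (c * (e * f))
            collect = Solver.solve-∀ ℚ-ring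

        contradictory : ¬ (3ℚ * 2ℚ ^ (d ℕ.+ d) ≤ 2ℚ * 2ℚ ^ (d ℕ.+ d))
        contradictory 3Z≤2Z = contradiction (≤-trans (^-lower {2ℚ} (d ℕ.+ d) (≤ᵇ⇒≤ _)) Z≤0) 1≰0
          where
          1≰0 : ¬ (1ℚ ≤ 0ℚ)
          1≰0 1≤0 = ≤⇒≤ᵇ 1≤0
          difference : ∀ z → - z ≡ 2ℚ * z - 3ℚ * z
          difference = Solver.solve-∀ ℚ-ring
          neg-involutive : ∀ z → - (- z) ≡ z
          neg-involutive = Solver.solve-∀ ℚ-ring
          Z≤0 : 2ℚ ^ (d ℕ.+ d) ≤ 0ℚ
          Z≤0 = ≡-≤-trans (sym (neg-involutive (2ℚ ^ (d ℕ.+ d))))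
            (neg-antimono-≤ (≤-≡-trans (p≤q⇒0≤q-p 3Z≤2Z) (sym (difference (2ℚ ^ (d ℕ.+ d))))))

      MA-lower-bound : ∀ c₁ c₂ (π : MAProt (2 ℕ.+ k) n c₁ c₂) → MAComputes π (λ x → negate (F x)) → 2 ℕ.^ v ℕ.≤ c₁ ℕ.+ c₂
      MA-lower-bound c₁ c₂ π computes = ℕ.≮⇒≥ λ cheap → contradictory π computes cheap (impossible π computes cheap)

  -- Each player's string holds 2^(12v) arrays of 2^p bits, where p = (k + 1) + 2 + 2 (12v + 2);
  -- hence the exponent. The cost consists of the same number of guessed bits and two communicated
  -- ones.
  separation : ∀ v k n → 2 ℕ.≤ v → 2 ℕ.^ (suc k ℕ.+ (36 ℕ.* v ℕ.+ 6)) ℕ.≤ n →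
    Σ (Input (2 ℕ.+ k) n → Sign) λ F →
      NCostAtMost F (suc k ℕ.+ (36 ℕ.* v ℕ.+ 8)) ×
      ((c₁ c₂ : ℕ) (π : MAProt (2 ℕ.+ k) n c₁ c₂) → MAComputes π (λ x → negate (F x)) → 2 ℕ.^ v ℕ.≤ c₁ ℕ.+ c₂)
  separation v k n 2≤v fits = separate (good-selector p (Array p) (suc k))
    where
    open Data.Nat.Solver.+-*-Solver
    p : ℕ
    p = suc k ℕ.+ (2 ℕ.+ (Choice.e v 2≤v ℕ.+ Choice.e v 2≤v))
    exponent : ∀ v k → 12 ℕ.* v ℕ.+ (suc k ℕ.+ (2 ℕ.+ (12 ℕ.* v ℕ.+ 2 ℕ.+ (12 ℕ.* v ℕ.+ 2)))) ≡ suc k ℕ.+ (36 ℕ.* v ℕ.+ 6)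
    exponent = solve 2 (λ v k → con 12 :* v :+ (con 1 :+ k :+ (con 2 :+ (con 12 :* v :+ con 2 :+ (con 12 :* v :+ con 2))))
                             := con 1 :+ k :+ (con 36 :* v :+ con 6)) refl
    cost : ∀ v k → suc k ℕ.+ (36 ℕ.* v ℕ.+ 6) ℕ.+ 2 ≡ suc k ℕ.+ (36 ℕ.* v ℕ.+ 8)
    cost = solve 2 (λ v k → con 1 :+ k :+ (con 36 :* v :+ con 6) :+ con 2 := con 1 :+ k :+ (con 36 :* v :+ con 8)) refl
    separate : (Σ (El (Selector p (Array p) (suc k))) λ φ →
        box (Array p) (Array p) (suc k) (gadget p (Array p) (suc k) φ) ≤
        fromℕ (suc k) * ½ ^ size (Array p) + mean-bias₀ p (2 ℕ.^ suc k)) →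
      Σ (Input (2 ℕ.+ k) n → Sign) λ F →
        NCostAtMost F (suc k ℕ.+ (36 ℕ.* v ℕ.+ 8)) ×
        ((c₁ c₂ : ℕ) (π : MAProt (2 ℕ.+ k) n c₁ c₂) → MAComputes π (λ x → negate (F x)) → 2 ℕ.^ v ℕ.≤ c₁ ℕ.+ c₂)
    separate (φ , box-bits) =
        F
      , subst (NCostAtMost F) (trans (cong (ℕ._+ 2) (exponent v k)) (cost v k)) NCost-F
      , Lower.MA-lower-bound v 2≤v k n p φ (≤-trans box-bits (selector-bound k (Choice.e v 2≤v)))
          (subst (λ s → 2 ℕ.^ s ℕ.≤ n) (sym (exponent v k)) fits)
      where open SelectedBits p (12 ℕ.* v) k n φ

-- From the bound on the number of players to the parameters.

open import Defs
open import Data.Nat using (ℕ; zero; suc; z≤n; s≤s; _+_; _*_; _^_; _∸_; _/_; _%_; _≤_; _<_; ⌊_/2⌋; ⌈_/2⌉; NonZero; >-nonZero)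
open import Data.Nat.DivMod using (m/n*n≤m; m≡m%n+[m/n]*n; m%n<n; /-monoˡ-≤; m*n/n≡m)
open import Data.Nat.Logarithm using (⌊log₂_⌋; ⌊log₂⌋-mono-≤; ⌊log₂[2^n]⌋≡n; ⌊log₂⌊n/2⌋⌋≡⌊log₂n⌋∸1)
open import Data.Nat.Properties
open import Data.Nat.Solver using (module +-*-Solver)
open import Data.Product using (Σ; _×_; _,_)
open import Relation.Binary.PropositionalEquality using (_≡_; refl; sym; trans; cong)
open Separation using (separation)

-- Induction on the value of the logarithm, which drops by one when `n` is halved.
2^⌊log₂n⌋≤n : ∀ n → 1 ≤ n → 2 ^ ⌊log₂ n ⌋ ≤ n
2^⌊log₂n⌋≤n n = bound ⌊log₂ n ⌋ n refl
  where
  open ≤-Reasoning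
  bound : ∀ ν n → ⌊log₂ n ⌋ ≡ ν → 1 ≤ n → 2 ^ ν ≤ n
  bound zero    n             log≡ 1≤n = 1≤n
  bound (suc ν) (suc (suc n)) log≡ _   = begin
    2 ^ ν + (2 ^ ν + 0)              ≡⟨ cong (2 ^ ν +_) (+-identityʳ (2 ^ ν)) ⟩
    2 ^ ν + 2 ^ ν                    ≤⟨ +-mono-≤ half (≤-trans half (⌊n/2⌋≤⌈n/2⌉ (2 + n))) ⟩
    ⌊ 2 + n /2⌋ + ⌈ 2 + n /2⌉        ≡⟨ ⌊n/2⌋+⌈n/2⌉≡n (2 + n) ⟩
    2 + n                            ∎
    where
    half : 2 ^ ν ≤ ⌊ 2 + n /2⌋
    half = bound ν ⌊ 2 + n /2⌋ (trans (⌊log₂⌊n/2⌋⌋≡⌊log₂n⌋∸1 (2 + n)) (cong (_∸ 1) log≡)) (s≤s z≤n)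

n<2^[1+⌊log₂n⌋] : ∀ n → n < 2 ^ suc ⌊log₂ n ⌋
n<2^[1+⌊log₂n⌋] n = ≰⇒> λ 2^≤n → <-irrefl refl
  (≤-trans (≤-reflexive (sym (⌊log₂[2^n]⌋≡n (suc ⌊log₂ n ⌋)))) (⌊log₂⌋-mono-≤ 2^≤n))

2^-cancel-≤ : ∀ {m n} → 2 ^ m ≤ 2 ^ n → m ≤ n
2^-cancel-≤ 2^m≤2^n = ≮⇒≥ λ n<m → <⇒≱ (^-monoʳ-< 2 (s≤s (s≤s z≤n)) n<m) 2^m≤2^n

NCostAtMost-mono : ∀ {p n c c′} {G : Input p n → Sign} → c ≤ c′ → NCostAtMost G c → NCostAtMost G c′
NCostAtMost-mono c≤c′ (c₁ , c₂ , c₁+c₂≤c , P) = c₁ , c₂ , ≤-trans c₁+c₂≤c c≤c′ , P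

theorem5p5 : (a b : ℕ) → 1 ≤ a → 1 ≤ b →
    Σ ℕ λ C → Σ ℕ λ D → Σ ℕ λ q → Σ ℕ λ n₀ → 1 ≤ q ×
    ((n k : ℕ) → n₀ ≤ n → 1 ≤ k → 2 ^ (b * k) * n ^ a ≤ n ^ b →
    Σ (Input (1 + k) n → Sign) λ F →
    NCostAtMost F (C * ⌊log₂ n ⌋) ×
    ((c1 c2 : ℕ) → (P : MAProt (1 + k) n c1 c2) →
    MAComputes P (λ x → negate (F x)) → n ≤ (D * (c1 + c2)) ^ q))
-- Here ε = a / b. The choice v = ν / (43 b) with ν = ⌊log₂ n⌋ makes the 43 v extra exponent fit
-- into a share ν / b of ν; 86 = 2 · 43 absorbs the rounding of this quotient, and n₀ ensures v ≥ 2.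
theorem5p5 (suc a) b 1≤a 1≤b = 3 , 1 , 86 * b , 2 ^ (86 * b) , *-mono-≤ (s≤s (z≤n {85})) 1≤b , main
  where
  open ≤-Reasoning
  open +-*-Solver
  main : (n k : ℕ) → 2 ^ (86 * b) ≤ n → 1 ≤ k → 2 ^ (b * k) * n ^ suc a ≤ n ^ b →
    Σ (Input (1 + k) n → Sign) λ F →
    NCostAtMost F (3 * ⌊log₂ n ⌋) ×
    ((c1 c2 : ℕ) → (P : MAProt (1 + k) n c1 c2) →
    MAComputes P (λ x → negate (F x)) → n ≤ (1 * (c1 + c2)) ^ (86 * b))
  main n (suc k) n₀≤n _ few-players =
    let F , cheap , hard = separation v k n 2≤v (≤-trans (^-monoʳ-≤ 2 exponent≤ν) (2^⌊log₂n⌋≤n n 1≤n))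
    in F , NCostAtMost-mono cost≤3ν cheap , λ c1 c2 P P-computes → begin
      n                              ≤⟨ <⇒≤ (n<2^[1+⌊log₂n⌋] n) ⟩
      2 ^ suc ν                      ≤⟨ ^-monoʳ-≤ 2 ν<v*86b ⟩
      2 ^ (v * (86 * b))             ≡⟨ sym (^-*-assoc 2 v (86 * b)) ⟩
      (2 ^ v) ^ (86 * b)             ≤⟨ ^-monoˡ-≤ (86 * b) (hard c1 c2 P P-computes) ⟩
      (c1 + c2) ^ (86 * b)           ≡⟨ cong (_^ (86 * b)) (sym (*-identityˡ (c1 + c2))) ⟩
      (1 * (c1 + c2)) ^ (86 * b)     ∎
    where
    instance
      b≢0 : NonZero b
      b≢0 = >-nonZero 1≤b
      43b≢0 : NonZero (43 * b)
      43b≢0 = >-nonZero (*-mono-≤ (s≤s (z≤n {42})) 1≤b)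
      n≢0 : NonZero n
      n≢0 = >-nonZero (≤-trans (m^n>0 2 (86 * b)) n₀≤n)
    1≤n : 1 ≤ n
    1≤n = ≤-trans (m^n>0 2 (86 * b)) n₀≤n
    ν v : ℕ
    ν = ⌊log₂ n ⌋
    v = ν / (43 * b)
    86b≤ν : 2 * (43 * b) ≤ ν
    86b≤ν = begin
      2 * (43 * b)                   ≡⟨ sym (*-assoc 2 43 b) ⟩
      86 * b                         ≡⟨ sym (⌊log₂[2^n]⌋≡n (86 * b)) ⟩
      ⌊log₂ 2 ^ (86 * b) ⌋           ≤⟨ ⌊log₂⌋-mono-≤ n₀≤n ⟩
      ν                              ∎
    2≤v : 2 ≤ v
    2≤v = ≤-trans (≤-reflexive (sym (m*n/n≡m 2 (43 * b)))) (/-monoˡ-≤ (43 * b) 86b≤ν)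
    1≤v : 1 ≤ v
    1≤v = ≤-trans (s≤s z≤n) 2≤v
    v*43b≤ν : v * (43 * b) ≤ ν
    v*43b≤ν = m/n*n≤m ν (43 * b)
    ν<v*86b : suc ν ≤ v * (86 * b)
    ν<v*86b = begin
      suc ν                                          ≡⟨ cong suc (m≡m%n+[m/n]*n ν (43 * b)) ⟩
      suc (ν % (43 * b)) + v * (43 * b)              ≤⟨ +-monoˡ-≤ (v * (43 * b)) (m%n<n ν (43 * b)) ⟩
      43 * b + v * (43 * b)                          ≤⟨ +-monoˡ-≤ (v * (43 * b)) (≤-trans (≤-reflexive (sym (*-identityˡ (43 * b)))) (*-monoˡ-≤ (43 * b) 1≤v)) ⟩
      v * (43 * b) + v * (43 * b)                    ≡⟨ solve 2 (λ v b → v :* (con 43 :* b) :+ v :* (con 43 :* b) := v :* (con 86 :* b)) refl v b ⟩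
      v * (86 * b)                                   ∎
    players≤ : b * suc k + ν ≤ suc ν * b
    players≤ = 2^-cancel-≤ (begin
      2 ^ (b * suc k + ν)            ≡⟨ ^-distribˡ-+-* 2 (b * suc k) ν ⟩
      -- Lowering `n ^ suc a` to `n` keeps the slack ν / b, so that the exponent `q` depends on `b`
      -- alone.
      2 ^ (b * suc k) * 2 ^ ν        ≤⟨ *-monoʳ-≤ (2 ^ (b * suc k)) (≤-trans (2^⌊log₂n⌋≤n n 1≤n) (m≤m*n n (n ^ a) {{m^n≢0 n a}})) ⟩
      2 ^ (b * suc k) * n ^ suc a    ≤⟨ few-players ⟩
      n ^ b                          ≤⟨ ^-monoˡ-≤ b (<⇒≤ (n<2^[1+⌊log₂n⌋] n)) ⟩
      (2 ^ suc ν) ^ b                ≡⟨ ^-*-assoc 2 (suc ν) b ⟩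
      2 ^ (suc ν * b)                ∎)
    exponent≤ν : suc k + (36 * v + 6) ≤ ν
    exponent≤ν = *-cancelˡ-≤ b (+-cancelʳ-≤ ν _ _ (begin
      b * (suc k + (36 * v + 6)) + ν                 ≡⟨ solve 4 (λ b k v ν → b :* (k :+ (con 36 :* v :+ con 6)) :+ ν := b :* k :+ ν :+ (b :* (con 36 :* v) :+ con 6 :* b)) refl b (suc k) v ν ⟩
      b * suc k + ν + (b * (36 * v) + 6 * b)         ≤⟨ +-monoˡ-≤ (b * (36 * v) + 6 * b) players≤ ⟩
      -- Six copies of `b` come from the exponent and one from rounding the logarithm. Since v ≥ 1,
      -- all seven are charged to `v`, and 36 + 7 = 43.
      suc ν * b + (b * (36 * v) + 6 * b)             ≡⟨ solve 3 (λ b v ν → (con 1 :+ ν) :* b :+ (b :* (con 36 :* v) :+ con 6 :* b) := b :* ν :+ (b :* (con 36 :* v) :+ con 1 :* (con 7 :* b))) refl b v ν ⟩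
      b * ν + (b * (36 * v) + 1 * (7 * b))           ≤⟨ +-monoʳ-≤ (b * ν) (+-monoʳ-≤ (b * (36 * v)) (*-monoˡ-≤ (7 * b) 1≤v)) ⟩
      b * ν + (b * (36 * v) + v * (7 * b))           ≡⟨ solve 3 (λ b v ν → b :* ν :+ (b :* (con 36 :* v) :+ v :* (con 7 :* b)) := b :* ν :+ v :* (con 43 :* b)) refl b v ν ⟩
      b * ν + v * (43 * b)                           ≤⟨ +-monoʳ-≤ (b * ν) v*43b≤ν ⟩
      b * ν + ν                                      ∎))
    cost≤3ν : suc k + (36 * v + 8) ≤ 3 * ν
    cost≤3ν = begin
      suc k + (36 * v + 8)           ≡⟨ solve 2 (λ k v → k :+ (con 36 :* v :+ con 8) := k :+ (con 36 :* v :+ con 6) :+ con 2) refl (suc k) v ⟩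
      suc k + (36 * v + 6) + 2       ≤⟨ +-mono-≤ exponent≤ν (*-monoʳ-≤ 2 1≤ν) ⟩
      ν + 2 * ν                      ≡⟨⟩
      3 * ν                          ∎
      where
      1≤ν : 1 ≤ ν
      1≤ν = ≤-trans (s≤s z≤n) exponent≤ν
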